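{- Let $G$ be a cubic (i.e. $3$-regular) graph on $n$ vertices. If $G$ is not isomorphic to $K_4$, $3K_4$ or $K_{3,3}$, then $G$ contains a spanning subgraph $H$ such that for every integer $k$ with $0 \le k \le 3$, $$\left| m(H,k) - \frac{n}{4} \right| \le \frac{1}{2}.$$ If $G$ is isomorphic to $K_4$, $3K_4$ or $K_{3,3}$, then $G$ contains a spanning subgraph $H$ such that $$\max_{0\le k \le 3} \left|m(H,k) - \frac{n}{4}\right| \le \frac{3}{2}.$$
   Context: All graphs are finite and simple (no loops, no parallel edges); they are not assumed to be connected. A spanning subgraph of $G$ is a subgraph with the same vertex set as $G$. For a graph $H$ and a nonnegative integer $k$, $m(H,k)$ denotes the number of vertices of degree $k$ in $H$. $K_4$ is the complete graph on $4$ vertices, $K_{3,3}$ the complete bipartite graph with parts of size $3$ and $3$, and $3K_4$ the disjoint union of three copies of $K_4$. -}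

module Defs where

open import Data.Fin.Base using (Fin; splitAt)
open import Data.Fin.Properties using (_≟_)
open import Data.Integer.Base using (+_)
open import Data.List.Base using (length; filter; allFin)
open import Data.Nat.Base as ℕ using (ℕ)
import Data.Nat.Properties as ℕ
open import Data.Rational.Base using (ℚ; _/_; _-_; ∣_∣; _⊔_)
open import Data.Sum.Base using (_⊎_; inj₁; inj₂)
open import Data.Sum.Relation.Binary.Pointwise
  using (Pointwise; ⊎-symmetric; ⊎-irreflexive; ⊎-decidable; ≡⇒Pointwise-≡)
open import Function.Base using (_on_; _∘_)
open import Function.Bundles using (_↔_; _⇔_; Inverse)
open import Level using (0ℓ)
open import Relation.Binary.Core using (Rel)
open import Relation.Binary.Definitions using (Decidable; Symmetric; Irreflexive)
open import Relation.Binary.PropositionalEquality.Core using (_≡_; _≢_; refl; ≢-sym; cong)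
open import Relation.Nullary.Decidable using (yes; no; ¬?)

-- Finite simple graphs on n vertices. Decidability of adjacency is the
-- constructive content of the edge set being a finite set; Adj need not be
-- proof-irrelevant, since only its inhabitation is ever used.
record Graph (n : ℕ) : Set₁ where
  field
    Adj    : Rel (Fin n) 0ℓ
    adj?   : Decidable Adj
    sym    : Symmetric Adj
    irrefl : Irreflexive _≡_ Adj

  degree : Fin n → ℕ
  degree v = length (filter (adj? v) (allFin n))

open Graph public using (Adj; degree)

m : ∀ {n} → Graph n → ℕ → ℕ
m {n} H k = length (filter (λ v → degree H v ℕ.≟ k) (allFin n))

Cubic : ∀ {n} → Graph n → Set
Cubic G = ∀ v → degree G v ≡ 3

IsSpanningSubgraph : ∀ {n} → Graph n → Graph n → Set
IsSpanningSubgraph H G = ∀ {u v} → Adj H u v → Adj G u v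

record _≅_ {n n′ : ℕ} (G : Graph n) (H : Graph n′) : Set where
  field
    vertices : Fin n ↔ Fin n′
    adjacent : ∀ u v → Adj G u v ⇔ Adj H (Inverse.to vertices u) (Inverse.to vertices v)

infix 4 _≅_

K : ∀ n → Graph n
K n = record
  { Adj    = _≢_
  ; adj?   = λ u v → ¬? (u ≟ v)
  ; sym    = ≢-sym
  ; irrefl = λ u≡v u≢v → u≢v u≡v
  }

-- Pointwise R S relates inj₁ only to inj₁ (by R) and inj₂ only to inj₂ (by S).
_⊍_ : ∀ {p q} → Graph p → Graph q → Graph (p ℕ.+ q)
_⊍_ {p} G H = record
  { Adj    = Pointwise (Adj G) (Adj H) on splitAt p
  ; adj?   = λ u v → ⊎-decidable (Graph.adj? G) (Graph.adj? H) (splitAt p u) (splitAt p v)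
  ; sym    = ⊎-symmetric (Graph.sym G) (Graph.sym H)
  ; irrefl = ⊎-irreflexive (Graph.irrefl G) (Graph.irrefl H) ∘ ≡⇒Pointwise-≡ ∘ cong (splitAt p)
  }

infixr 5 _⊍_

data Across {A B : Set} : Rel (A ⊎ B) 0ℓ where
  left-right : ∀ {a b} → Across (inj₁ a) (inj₂ b)
  right-left : ∀ {a b} → Across (inj₂ b) (inj₁ a)

across? : ∀ {A B : Set} → Decidable (Across {A} {B})
across? (inj₁ _) (inj₁ _) = no λ ()
across? (inj₁ _) (inj₂ _) = yes left-right
across? (inj₂ _) (inj₁ _) = yes right-left
across? (inj₂ _) (inj₂ _) = no λ ()

across-sym : ∀ {A B : Set} → Symmetric (Across {A} {B})
across-sym left-right = right-left
across-sym right-left = left-right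

across-irrefl : ∀ {A B : Set} → Irreflexive _≡_ (Across {A} {B})
across-irrefl refl ()

Kᵇ : ∀ p q → Graph (p ℕ.+ q)
Kᵇ p q = record
  { Adj    = Across on splitAt p
  ; adj?   = λ u v → across? (splitAt p u) (splitAt p v)
  ; sym    = across-sym
  ; irrefl = across-irrefl ∘ cong (splitAt p)
  }

3K₄ : Graph 12
3K₄ = K 4 ⊍ K 4 ⊍ K 4

Exceptional : ∀ {n} → Graph n → Set
Exceptional G = G ≅ K 4 ⊎ G ≅ 3K₄ ⊎ G ≅ Kᵇ 3 3

deviation : ∀ {n} → Graph n → ℕ → ℚ
deviation {n} H k = ∣ + m H k / 1 - + n / 4 ∣

maxDeviation : ∀ {n} → Graph n → ℚ
maxDeviation H = deviation H 0 ⊔ deviation H 1 ⊔ deviation H 2 ⊔ deviation H 3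

{-# OPTIONS --safe #-}
module Submission where

-- Write n = 2 (q + q′) with q ≤ q′ ≤ q + 1. The subgraph will have q, q′, q, q′ vertices of degree
-- 0, 1, 2, 3. First choose disjoint and non-adjacent vertex sets A of size q and D of size q′, both
-- spanning many edges, and colour the edges in or out: those at A out, those at D in, and the others
-- so that every remaining vertex sees both colours. A greedy colouring succeeds if at most one vertex
-- has only one free edge left, and it makes A and D the vertices of degree 0 and 3. Then the degrees
-- 1 and 2 are balanced: when there are too many vertices of degree 1, the small boundary of A forces
-- an unused edge between two of them, which is added; dually, edges between vertices of degree 2 are
-- removed. The sets A and D are grown vertex by vertex, where a vertex with two neighbours in the
-- set is always absorbed first. This fails only next to small components, and in the end only for
-- K₄, 3K₄ and K₃,₃.

-- The order q, q′, q, q′ respects parity: the number of vertices of odd degree is even, and degrees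
-- 1 and 3 together get 2q′. Once degrees 0 and 3 occur q and q′ times, the number of vertices and
-- the degree sum 2q + 4q′ determine the other two counts, so balancing only has to move the degree
-- sum, in steps of 2. Inner edges matter because a set P has 3|P| - e(P) boundary edges, where e(P)
-- is twice the number of inner edges. The edge count of a tree leaves |P| + 2 of them, few enough
-- for the counting that excludes a premature halt. The colouring asks for care outside the sets: a
-- vertex with two edges into A or D keeps one free edge, with three none. D has to live among
-- vertices without neighbours in A, a zone that may be sparse. Vertices with at most one neighbour
-- in it are peeled off first. If only q′ vertices survive, they form D, which is then less dense,
-- and a surplus of 2 in the degree sum can remain; it is removed by trading vertices in and out of
-- the sets of degree 0 and 3.

module Development where

  open import Data.Bool.Base as Bool using (Bool; true; false; _∧_; _∨_; not)
  import Data.Bool.Properties as Bool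
  open import Data.Empty using (⊥; ⊥-elim)
  open import Data.Fin.Base as Fin using (Fin; zero; suc; splitAt; punchOut)
  open import Data.Fin.Patterns using (0F; 1F; 2F; 3F; 4F; 5F; 6F; 7F; 8F; 9F)
  open import Data.Fin.Permutation using (↔⇒≡)
  open import Data.Fin.Properties as Fin using (_≟_; any?; all?)
  open import Data.Integer.Base as ℤ using (ℤ; _⊖_)
  import Data.Integer.Properties as ℤ
  open import Data.List.Base using (length; filter; tabulate; allFin)
  open import Data.Nat.Base hiding (_/_)
  open import Data.Nat.Properties as ℕ hiding (_≟_; ≟-diag)
  open import Data.Product.Base using (_×_; _,_; ∃-syntax; proj₁; proj₂)
  open import Data.Rational.Base as ℚ using (toℚᵘ)
  import Data.Rational.Properties as ℚ
  open import Data.Rational.Unnormalised.Base as ℚᵘ using (mkℚᵘ; *≤*)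
  import Data.Rational.Unnormalised.Properties as ℚᵘ
  open import Data.Sum.Base using (_⊎_; inj₁; inj₂; [_,_]′)
  open import Data.Sum.Relation.Binary.Pointwise using (Pointwise; inj₁; inj₂)
  open import Data.Unit.Base using (tt)
  open import Data.Vec.Base using (Vec; []; _∷_; lookup; zipWith; map; replicate; updateAt)
  import Defs as D
  open import Defs using (Graph; K; Kᵇ; _⊍_; 3K₄; Across; left-right; right-left; _≅_; Exceptional;
      IsSpanningSubgraph; deviation; maxDeviation)
  open import Function.Base using (_∘_)
  open import Function.Bundles using (_↔_; _⇔_; mk⇔; mk↔ₛ′; Inverse; Equivalence)
  open import Relation.Binary.Definitions using (Tri; tri<; tri≈; tri>)
  open import Relation.Binary.PropositionalEquality using (_≡_; _≢_; refl; sym; trans; cong; cong₂; subst;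
      subst₂)
  open import Relation.Nullary using (¬_; Dec; yes; no; does)
  open import Relation.Nullary.Decidable using (dec-true; dec-false; from-yes; ¬?; _×-dec_; _→-dec_)
  open import Algebra.Properties.CommutativeMonoid.Sum +-0-commutativeMonoid
    using (sum; sum-cong-≗; ∑-distrib-+; ∑-comm; sum-replicate-zero; sum-permute)

  private variable
    n k l : ℕ

  -- Linear arithmetic

  -- Linear arithmetic over ℕ by Farkas certificates: an inequality follows from
  -- the hypotheses when a multiple of it is, coefficient by coefficient, implied
  -- by the given combination of hypotheses.

  infixl 6 _⊕_
  infixl 7 _⊗_
  infix 4 _≼_ _≐_

  data Expr (k : ℕ) : Set where
    con : ℕ → Expr k
    var : Fin k → Expr k
    _⊕_ : Expr k → Expr k → Expr k
    _⊗_ : ℕ → Expr k → Expr k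

  data Fact (k : ℕ) : Set where
    _≼_ _≐_ : Expr k → Expr k → Fact k

  module _ {k : ℕ} (ρ : Vec ℕ k) where

    ⟦_⟧ : Expr k → ℕ
    ⟦ con c ⟧ = c
    ⟦ var i ⟧ = lookup ρ i
    ⟦ a ⊕ b ⟧ = ⟦ a ⟧ + ⟦ b ⟧
    ⟦ c ⊗ a ⟧ = c * ⟦ a ⟧

    Holds : Fact k → Set
    Holds (a ≼ b) = ⟦ a ⟧ ≤ ⟦ b ⟧
    Holds (a ≐ b) = ⟦ a ⟧ ≡ ⟦ b ⟧

    infix  3 _·_∵_ _·⁻_∵_
    infixr 2 _⨾_

    -- A linear combination of facts; _·⁻_∵_ uses an equation from right to left.
    data Combination : Set where
      _·_∵_ : ℕ → (f : Fact k) → Holds f → Combination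
      _·⁻_∵_ : ℕ → (f : Fact k) → Holds f → Combination
      _⨾_   : Combination → Combination → Combination

  Form : ℕ → Set
  Form k = ℕ × Vec ℕ k

  _+ᶠ_ : ∀ {k} → Form k → Form k → Form k
  (c , xs) +ᶠ (d , ys) = c + d , zipWith _+_ xs ys

  _*ᶠ_ : ∀ {k} → ℕ → Form k → Form k
  c *ᶠ (d , xs) = c * d , map (c *_) xs

  0ᶠ : ∀ {k} → Form k
  0ᶠ = 0 , replicate _ 0

  form : ∀ {k} → Expr k → Form k
  form (con c) = c , replicate _ 0
  form (var i) = 0 , updateAt (replicate _ 0) i (λ _ → 1)
  form (a ⊕ b) = form a +ᶠ form b
  form (c ⊗ a) = c *ᶠ form a

  dot : ∀ {k} → Vec ℕ k → Vec ℕ k → ℕ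
  dot []       []       = 0
  dot (x ∷ xs) (y ∷ ys) = x * y + dot xs ys

  value : ∀ {k} → Vec ℕ k → Form k → ℕ
  value ρ (c , xs) = c + dot xs ρ

  _≤ᵛ_ : ∀ {k} → Vec ℕ k → Vec ℕ k → Bool
  []       ≤ᵛ []       = true
  (x ∷ xs) ≤ᵛ (y ∷ ys) = (x ≤ᵇ y) ∧ (xs ≤ᵛ ys)

  _≤ᶠ_ : ∀ {k} → Form k → Form k → Bool
  (c , xs) ≤ᶠ (d , ys) = (c ≤ᵇ d) ∧ (xs ≤ᵛ ys)

  +-swap : ∀ a b c d → (a + b) + (c + d) ≡ (a + c) + (b + d)
  +-swap a b c d = trans (+-assoc a b (c + d)) (trans (cong (a +_) (trans (sym (+-assoc b c d))
    (trans (cong (_+ d) (+-comm b c)) (+-assoc c b d)))) (sym (+-assoc a c (b + d))))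

  dot-0 : ∀ {k} (ρ : Vec ℕ k) → dot (replicate _ 0) ρ ≡ 0
  dot-0 []      = refl
  dot-0 (x ∷ ρ) = dot-0 ρ

  dot-var : ∀ {k} (i : Fin k) ρ → dot (updateAt (replicate _ 0) i (λ _ → 1)) ρ ≡ lookup ρ i
  dot-var Fin.zero    (x ∷ ρ) = trans (cong (x + 0 +_) (dot-0 ρ)) (trans (+-identityʳ _) (+-identityʳ x))
  dot-var (Fin.suc i) (x ∷ ρ) = dot-var i ρ

  dot-+ : ∀ {k} (xs ys : Vec ℕ k) ρ → dot (zipWith _+_ xs ys) ρ ≡ dot xs ρ + dot ys ρ
  dot-+ []       []       []      = refl
  dot-+ (x ∷ xs) (y ∷ ys) (r ∷ ρ) =
    trans (cong₂ _+_ (*-distribʳ-+ r x y) (dot-+ xs ys ρ)) (+-swap (x * r) (y * r) (dot xs ρ) (dot ys ρ))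

  dot-* : ∀ {k} c (xs : Vec ℕ k) ρ → dot (map (c *_) xs) ρ ≡ c * dot xs ρ
  dot-* c []       []      = sym (*-zeroʳ c)
  dot-* c (x ∷ xs) (r ∷ ρ) =
    trans (cong₂ _+_ (*-assoc c x r) (dot-* c xs ρ)) (sym (*-distribˡ-+ c (x * r) (dot xs ρ)))

  value-+ : ∀ {k} (ρ : Vec ℕ k) a b → value ρ (a +ᶠ b) ≡ value ρ a + value ρ b
  value-+ ρ (c , xs) (d , ys) =
    trans (cong (c + d +_) (dot-+ xs ys ρ)) (+-swap c d (dot xs ρ) (dot ys ρ))

  value-* : ∀ {k} (ρ : Vec ℕ k) c a → value ρ (c *ᶠ a) ≡ c * value ρ a
  value-* ρ c (d , xs) = trans (cong (c * d +_) (dot-* c xs ρ)) (sym (*-distribˡ-+ c d (dot xs ρ)))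

  value-form : ∀ {k} (ρ : Vec ℕ k) a → value ρ (form a) ≡ ⟦_⟧ ρ a
  value-form ρ (con c) = trans (cong (c +_) (dot-0 ρ)) (+-identityʳ c)
  value-form ρ (var i) = dot-var i ρ
  value-form ρ (a ⊕ b) = trans (value-+ ρ (form a) (form b)) (cong₂ _+_ (value-form ρ a) (value-form ρ b))
  value-form ρ (c ⊗ a) = trans (value-* ρ c (form a)) (cong (c *_) (value-form ρ a))

  ∧-T : ∀ {x y} → Bool.T (x ∧ y) → Bool.T x × Bool.T y
  ∧-T {true} {true} _ = tt , tt

  dot-mono : ∀ {k} (xs ys : Vec ℕ k) ρ → Bool.T (xs ≤ᵛ ys) → dot xs ρ ≤ dot ys ρ
  dot-mono []       []       []      _ = z≤n
  dot-mono (x ∷ xs) (y ∷ ys) (r ∷ ρ) p with ∧-T p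
  ... | x≤y , xs≤ys = +-mono-≤ (*-monoˡ-≤ r (≤ᵇ⇒≤ x y x≤y)) (dot-mono xs ys ρ xs≤ys)

  value-mono : ∀ {k} (ρ : Vec ℕ k) a b → Bool.T (a ≤ᶠ b) → value ρ a ≤ value ρ b
  value-mono ρ (c , xs) (d , ys) p with ∧-T p
  ... | c≤d , xs≤ys = +-mono-≤ (≤ᵇ⇒≤ c d c≤d) (dot-mono xs ys ρ xs≤ys)

  left right : ∀ {k} {ρ : Vec ℕ k} → Combination ρ → Form k
  left (c · a ≼ b ∵ _)  = c *ᶠ form a
  left (c · a ≐ b ∵ _)  = c *ᶠ form a
  left (c ·⁻ a ≼ b ∵ _) = 0ᶠ
  left (c ·⁻ a ≐ b ∵ _) = c *ᶠ form b
  left (x ⨾ y)          = left x +ᶠ left y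
  right (c · a ≼ b ∵ _)  = c *ᶠ form b
  right (c · a ≐ b ∵ _)  = c *ᶠ form b
  right (c ·⁻ a ≼ b ∵ _) = 0ᶠ
  right (c ·⁻ a ≐ b ∵ _) = c *ᶠ form a
  right (x ⨾ y)          = right x +ᶠ right y

  scaled : ∀ {k} (ρ : Vec ℕ k) c a b → ⟦_⟧ ρ a ≤ ⟦_⟧ ρ b → value ρ (c *ᶠ form a) ≤ value ρ (c *ᶠ form b)
  scaled ρ c a b p
    rewrite value-* ρ c (form a) | value-* ρ c (form b) | value-form ρ a | value-form ρ b = *-monoʳ-≤ c p

  sound : ∀ {k} {ρ : Vec ℕ k} (x : Combination ρ) → value ρ (left x) ≤ value ρ (right x)
  sound {ρ = ρ} (c · a ≼ b ∵ p)  = scaled ρ c a b p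
  sound {ρ = ρ} (c · a ≐ b ∵ p)  = scaled ρ c a b (≤-reflexive p)
  sound         (c ·⁻ a ≼ b ∵ p) = ≤-refl
  sound {ρ = ρ} (c ·⁻ a ≐ b ∵ p) = scaled ρ c b a (≤-reflexive (sym p))
  sound {ρ = ρ} (x ⨾ y) rewrite value-+ ρ (left x) (left y) | value-+ ρ (right x) (right y) = +-mono-≤
      (sound x) (sound y)

  -- The two sides of the combination are added crosswise, so no coefficient is ever subtracted;
  -- `suc s` keeps the multiple of the goal positive and hence cancellable.
  certified : ∀ {k} {ρ : Vec ℕ k} → Expr k → Expr k → ℕ → Combination ρ → Bool
  certified a b s x = ((suc s *ᶠ form a) +ᶠ right x) ≤ᶠ ((suc s *ᶠ form b) +ᶠ left x)

  conclusion : ∀ {k} {ρ : Vec ℕ k} a b s (x : Combination ρ) → Bool.T (certified a b s x) →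
      ⟦_⟧ ρ a ≤ ⟦_⟧ ρ b
  conclusion {ρ = ρ} a b s x ok =
    *-cancelˡ-≤ (suc s) (+-cancelʳ-≤ (value ρ (right x)) _ _
        (≤-trans step (+-monoʳ-≤ (suc s * ⟦_⟧ ρ b) (sound x))))
    where
    unfold : ∀ c y → value ρ ((suc s *ᶠ form c) +ᶠ y) ≡ suc s * ⟦_⟧ ρ c + value ρ y
    unfold c y = trans (value-+ ρ (suc s *ᶠ form c) y)
      (cong (_+ value ρ y) (trans (value-* ρ (suc s) (form c)) (cong (suc s *_) (value-form ρ c))))
    step : suc s * ⟦_⟧ ρ a + value ρ (right x) ≤ suc s * ⟦_⟧ ρ b + value ρ (left x)
    step = ≤-trans (≤-reflexive (sym (unfold a (right x))))
      (≤-trans (value-mono ρ ((suc s *ᶠ form a) +ᶠ right x) ((suc s *ᶠ form b) +ᶠ left x) ok)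
          (≤-reflexive (unfold b (left x))))

  -- Serves the converse inequality of an equation: equations change direction, and an inequality,
  -- which has no converse, then contributes zero on both sides.
  reversed : ∀ {k} {ρ : Vec ℕ k} → Combination ρ → Combination ρ
  reversed (c · f ∵ p)  = c ·⁻ f ∵ p
  reversed (c ·⁻ f ∵ p) = c · f ∵ p
  reversed (x ⨾ y)      = reversed x ⨾ reversed y

  verified : ∀ {k} {ρ : Vec ℕ k} → Fact k → ℕ → Combination ρ → Bool
  verified (a ≼ b) s x = certified a b s x
  verified (a ≐ b) s x = certified a b s x ∧ certified b a s (reversed x)

  linear : ∀ {k} (ρ : Vec ℕ k) (f : Fact k) (s : ℕ) (x : Combination ρ) → {Bool.T (verified f s x)} →
      Holds ρ f
  linear ρ (a ≼ b) s x {ok} = conclusion a b s x ok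
  linear ρ (a ≐ b) s x {ok} with ∧-T ok
  ... | p , q = ≤-antisym (conclusion a b s x p) (conclusion b a s (reversed x) q)

  -- Finite sets and sums

  pattern x0 = var 0F
  pattern x1 = var 1F
  pattern x2 = var 2F
  pattern x3 = var 3F
  pattern x4 = var 4F
  pattern x5 = var 5F
  pattern x6 = var 6F
  pattern x7 = var 7F
  pattern x8 = var 8F
  pattern x9 = var 9F
  pattern x10 = var (suc 9F)
  pattern x11 = var (suc (suc 9F))
  pattern x12 = var (suc (suc (suc 9F)))
  pattern x13 = var (suc (suc (suc (suc 9F))))
  pattern x14 = var (suc (suc (suc (suc (suc 9F)))))
  pattern x15 = var (suc (suc (suc (suc (suc (suc 9F))))))
  pattern x16 = var (suc (suc (suc (suc (suc (suc (suc 9F)))))))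
  pattern x17 = var (suc (suc (suc (suc (suc (suc (suc (suc 9F))))))))

  1≰0 : ∀ {a} {A : Set a} → 1 ≤ 0 → A
  1≰0 ()

  Sub : ℕ → Set
  Sub n = Fin n → Bool

  infix 4 _∈_ _∉_
  infixr 7 _∩_ _∖_
  infixr 6 _∪_

  infix 4 _⊆_ _#_

  _∈_ _∉_ : Fin n → Sub n → Set
  v ∈ P = P v ≡ true
  v ∉ P = P v ≡ false

  _⊆_ _#_ : Sub n → Sub n → Set
  P ⊆ Q = ∀ v → v ∈ P → v ∈ Q
  P # Q = ∀ v → v ∈ P → v ∉ Q

  _∪_ _∩_ _∖_ : Sub n → Sub n → Sub n
  (P ∪ Q) v = P v ∨ Q v
  (P ∩ Q) v = P v ∧ Q v
  (P ∖ Q) v = P v ∧ not (Q v)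

  ∁ : Sub n → Sub n
  ∁ P v = not (P v)

  ∅ full : Sub n
  ∅ _ = false
  full _ = true

  opaque
    ⁅_⁆ : Fin n → Sub n
    ⁅ v ⁆ u = does (u ≟ v)

  _∈?_ : (v : Fin n) (P : Sub n) → v ∈ P ⊎ v ∉ P
  v ∈? P with P v
  ... | true  = inj₁ refl
  ... | false = inj₂ refl

  from-does : ∀ {a} {A : Set a} (a? : Dec A) → does a? ≡ true → A
  from-does (yes a) _ = a

  clash : ∀ {a} {A : Set a} {b} → b ≡ true → b ≡ false → A
  clash refl ()

  ∧⁺ : ∀ {x y} → x ≡ true → y ≡ true → x ∧ y ≡ true
  ∧⁺ refl refl = refl

  ∧⁻ˡ : ∀ {x y} → x ∧ y ≡ true → x ≡ true
  ∧⁻ˡ {true} _ = refl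

  ∧⁻ʳ : ∀ {x y} → x ∧ y ≡ true → y ≡ true
  ∧⁻ʳ {true} p = p

  ∨⁺ˡ : ∀ {x y} → x ≡ true → x ∨ y ≡ true
  ∨⁺ˡ refl = refl

  ∨⁺ʳ : ∀ {x y} → y ≡ true → x ∨ y ≡ true
  ∨⁺ʳ {true}  _ = refl
  ∨⁺ʳ {false} p = p

  ∨⁻ : ∀ {x y} → x ∨ y ≡ true → x ≡ true ⊎ y ≡ true
  ∨⁻ {true}  _ = inj₁ refl
  ∨⁻ {false} p = inj₂ p

  not⁺ : ∀ {x} → x ≡ false → not x ≡ true
  not⁺ refl = refl

  not⁻ : ∀ {x} → not x ≡ true → x ≡ false
  not⁻ {false} _ = refl

  refute : ∀ {x} → (x ≡ true → ⊥) → x ≡ false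
  refute {true}  f = ⊥-elim (f refl)
  refute {false} f = refl

  ∖⁺ : ∀ {x y} → x ≡ true → y ≡ false → x ∧ not y ≡ true
  ∖⁺ refl refl = refl

  ∖⁻ : ∀ {x y} → x ∧ not y ≡ true → y ≡ false
  ∖⁻ {true} p = not⁻ p

  ∪-no : ∀ {x y} → x ≡ false → y ≡ false → x ∨ y ≡ false
  ∪-no refl refl = refl

  ∪-noˡ : ∀ {x y} → x ∨ y ≡ false → x ≡ false
  ∪-noˡ {false} _ = refl

  ∪-noʳ : ∀ {x y} → x ∨ y ≡ false → y ≡ false
  ∪-noʳ {false} p = p

  ∖-no : ∀ {x y} → y ≡ true → x ∧ not y ≡ false
  ∖-no {true}  refl = refl
  ∖-no {false} refl = refl

  opaque
    unfolding ⁅_⁆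

    ⁅⁆-refl : (v : Fin n) → v ∈ ⁅ v ⁆
    ⁅⁆-refl v = dec-true (v ≟ v) refl

    ⁅⁆⇒≡ : {u v : Fin n} → u ∈ ⁅ v ⁆ → u ≡ v
    ⁅⁆⇒≡ {u = u} {v} p with u ≟ v
    ... | yes u≡v = u≡v
    ⁅⁆⇒≡ () | no _

    ≢⇒∉⁅⁆ : {u v : Fin n} → u ≢ v → u ∉ ⁅ v ⁆
    ≢⇒∉⁅⁆ {u = u} {v} p = dec-false (u ≟ v) p

  ∈∉⇒≢ : (P : Sub n) {u v : Fin n} → u ∈ P → v ∉ P → u ≢ v
  ∈∉⇒≢ P p q refl = clash p q

  find : (P : Sub n) → (∃[ v ] v ∈ P) ⊎ (∀ v → v ∉ P)
  find P with any? (λ v → P v Bool.≟ true)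
  ... | yes p = inj₁ p
  ... | no ¬p = inj₂ λ v → refute λ p → ¬p (v , p)

  ind : Bool → ℕ
  ind true  = 1
  ind false = 0

  sum-mono : {f g : Fin n → ℕ} → (∀ v → f v ≤ g v) → sum f ≤ sum g
  sum-mono {zero}  p = z≤n
  sum-mono {suc n} p = +-mono-≤ (p Fin.zero) (sum-mono (p ∘ Fin.suc))

  sum-*ˡ : ∀ k (f : Fin n → ℕ) → sum (λ v → k * f v) ≡ k * sum f
  sum-*ˡ {zero}  k f = sym (*-zeroʳ k)
  sum-*ˡ {suc n} k f =
    trans (cong (_+_ (k * f Fin.zero)) (sum-*ˡ k (f ∘ Fin.suc))) (sym (*-distribˡ-+ k (f Fin.zero) _))

  opaque
    unfolding ⁅_⁆

    sum-single : (v : Fin n) (f : Fin n → ℕ) → sum (λ u → ind (⁅ v ⁆ u) * f u) ≡ f v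
    sum-single {suc n} Fin.zero f =
      trans (cong₂ _+_ (*-identityˡ (f Fin.zero)) (sum-replicate-zero n)) (+-identityʳ _)
    sum-single (Fin.suc v) f = trans (sum-cong-≗ λ u → cong (λ b → ind b * f (Fin.suc u)) (same u))
        (sum-single v (f ∘ Fin.suc))
      where
      same : ∀ u → ⁅ Fin.suc v ⁆ (Fin.suc u) ≡ ⁅ v ⁆ u
      same u with u ≟ v
      ... | yes _ = refl
      ... | no _  = refl

  opaque
    -- Opaque, so that cardinalities are handled through the laws below and each `count P` stays an
    -- atom for `linear`.
    count : Sub n → ℕ
    count P = sum (ind ∘ P)

    ∑∈ : Sub n → (Fin n → ℕ) → ℕ
    ∑∈ P f = sum (λ v → ind (P v) * f v)

    ∑-mono : (P : Sub n) {f g : Fin n → ℕ} → (∀ v → v ∈ P → f v ≤ g v) → ∑∈ P f ≤ ∑∈ P g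
    ∑-mono P {f} {g} p = sum-mono λ v → aux v (P v) refl
      where
      aux : ∀ v b → P v ≡ b → ind b * f v ≤ ind b * g v
      aux v true  e = *-monoʳ-≤ 1 (p v e)
      aux v false e = z≤n

    ∑-cong : (P : Sub n) {f g : Fin n → ℕ} → (∀ v → v ∈ P → f v ≡ g v) → ∑∈ P f ≡ ∑∈ P g
    ∑-cong P p = ≤-antisym (∑-mono P λ v q → ≤-reflexive (p v q))
        (∑-mono P λ v q → ≤-reflexive (sym (p v q)))

    ∑-+ : (P : Sub n) (f g : Fin n → ℕ) → ∑∈ P (λ v → f v + g v) ≡ ∑∈ P f + ∑∈ P g
    ∑-+ P f g = trans (sum-cong-≗ λ v → *-distribˡ-+ (ind (P v)) (f v) (g v))
        (∑-distrib-+ (λ v → ind (P v) * f v) _)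

    ∑-* : (P : Sub n) (k : ℕ) (f : Fin n → ℕ) → ∑∈ P (λ v → k * f v) ≡ k * ∑∈ P f
    ∑-* P k f = trans (sum-cong-≗ λ v → trans (sym (*-assoc (ind (P v)) k (f v)))
      (trans (cong (_* f v) (*-comm (ind (P v)) k)) (*-assoc k (ind (P v)) (f v))))
          (sum-*ˡ k (λ v → ind (P v) * f v))

    ∑-const : (P : Sub n) (k : ℕ) → ∑∈ P (λ _ → k) ≡ k * count P
    ∑-const P k = trans (sum-cong-≗ λ v → *-comm (ind (P v)) k) (sum-*ˡ k (ind ∘ P))

    ∑-set : {P Q : Sub n} (f : Fin n → ℕ) → (∀ v → P v ≡ Q v) → ∑∈ P f ≡ ∑∈ Q f
    ∑-set f p = sum-cong-≗ λ v → cong (λ b → ind b * f v) (p v)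

    ind-∪ : ∀ x y → (x ≡ true → y ≡ false) → ind (x ∨ y) ≡ ind x + ind y
    ind-∪ true  true  d with () ← d refl
    ind-∪ true  false d = refl
    ind-∪ false y     d = refl

    ind-split : ∀ x y → ind x ≡ ind (x ∧ y) + ind (x ∧ not y)
    ind-split true  true  = refl
    ind-split true  false = refl
    ind-split false y     = refl

    ∑-∪ : (P Q : Sub n) (f : Fin n → ℕ) → (P # Q) → ∑∈ (P ∪ Q) f ≡ ∑∈ P f + ∑∈ Q f
    ∑-∪ P Q f d = trans (sum-cong-≗ λ v →
      trans (cong (_* f v) (ind-∪ (P v) (Q v) (d v))) (*-distribʳ-+ (f v) (ind (P v)) _))
          (∑-distrib-+ (λ v → ind (P v) * f v) _)

    ∑-split : (P Q : Sub n) (f : Fin n → ℕ) → ∑∈ P f ≡ ∑∈ (P ∩ Q) f + ∑∈ (P ∖ Q) f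
    ∑-split P Q f = trans (sum-cong-≗ λ v →
      trans (cong (_* f v) (ind-split (P v) (Q v))) (*-distribʳ-+ (f v) (ind (P v ∧ Q v)) _))
          (∑-distrib-+ (λ v → ind ((P ∩ Q) v) * f v) _)

    ∑-⊆ : (P Q : Sub n) (f : Fin n → ℕ) → (P ⊆ Q) → ∑∈ P f ≤ ∑∈ Q f
    ∑-⊆ P Q f s = sum-mono λ v → *-monoˡ-≤ (f v) (aux (P v) (Q v) (s v))
      where
      aux : ∀ x y → (x ≡ true → y ≡ true) → ind x ≤ ind y
      aux false y s = z≤n
      aux true  y s rewrite s refl = ≤-refl

    ∑-⁅⁆ : (v : Fin n) (f : Fin n → ℕ) → ∑∈ ⁅ v ⁆ f ≡ f v
    ∑-⁅⁆ = sum-single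

    ∑-ind : (P : Sub n) → ∑∈ full (ind ∘ P) ≡ count P
    ∑-ind P = sum-cong-≗ λ v → *-identityˡ (ind (P v))

    count-as-∑ : (P : Sub n) → count P ≡ ∑∈ P (λ _ → 1)
    count-as-∑ P = sum-cong-≗ λ v → sym (*-identityʳ (ind (P v)))

    count-cong : {P Q : Sub n} → (∀ v → P v ≡ Q v) → count P ≡ count Q
    count-cong p = sum-cong-≗ λ v → cong ind (p v)

    count-⊆ : {P Q : Sub n} → (P ⊆ Q) → count P ≤ count Q
    count-⊆ {P = P} {Q} s = subst₂ _≤_ (sym (count-as-∑ P)) (sym (count-as-∑ Q)) (∑-⊆ P Q _ s)

    count-∪ : (P Q : Sub n) → (P # Q) → count (P ∪ Q) ≡ count P + count Q
    count-∪ P Q d = trans (sum-cong-≗ λ v → ind-∪ (P v) (Q v) (d v)) (∑-distrib-+ (ind ∘ P) _)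

    count-split : (P Q : Sub n) → count P ≡ count (P ∩ Q) + count (P ∖ Q)
    count-split P Q = trans (sum-cong-≗ λ v → ind-split (P v) (Q v)) (∑-distrib-+ (ind ∘ (P ∩ Q)) _)

    count-∅ : {P : Sub n} → (∀ v → v ∉ P) → count P ≡ 0
    count-∅ {n} p = trans (count-cong p) (sum-replicate-zero n)

    count-full : count {n} full ≡ n
    count-full {zero}  = refl
    count-full {suc n} = cong suc count-full

    count-⁅⁆∩ : (v : Fin n) (P : Sub n) → count (P ∩ ⁅ v ⁆) ≡ ind (P v)
    count-⁅⁆∩ v P = trans (sum-cong-≗ λ u → aux (P u) (⁅ v ⁆ u)) (sum-single v (ind ∘ P))
      where
      aux : ∀ x y → ind (x ∧ y) ≡ ind y * ind x
      aux true  true  = refl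
      aux true  false = refl
      aux false true  = refl
      aux false false = refl

  count-delete : (P : Sub n) {v : Fin n} → v ∈ P → count P ≡ suc (count (P ∖ ⁅ v ⁆))
  count-delete P {v} p = trans (count-split P ⁅ v ⁆)
      (cong (_+ count (P ∖ ⁅ v ⁆)) (trans (count-⁅⁆∩ v P) (cong ind p)))

  count-⁅⁆ : (v : Fin n) → count ⁅ v ⁆ ≡ 1
  count-⁅⁆ v = count-⁅⁆∩ v full

  count-insert : (P : Sub n) {v : Fin n} → v ∉ P → count (P ∪ ⁅ v ⁆) ≡ suc (count P)
  count-insert P {v} p = trans (count-∪ P ⁅ v ⁆ λ u q → ≢⇒∉⁅⁆ (∈∉⇒≢ P q p))
    (trans (cong (_+_ (count P)) (count-⁅⁆ v)) (+-comm _ 1))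

  inhabited : (P : Sub n) → 1 ≤ count P → ∃[ v ] v ∈ P
  inhabited P p with find P
  ... | inj₁ q = q
  ... | inj₂ e with () ← subst (1 ≤_) (count-∅ e) p

  other : (P : Sub n) (v : Fin n) → 2 ≤ count P → ∃[ u ] u ∈ P × u ≢ v
  other P v p with inhabited (P ∖ ⁅ v ⁆)
      (+-cancelˡ-≤ 1 _ _ (≤-trans p (≤-trans (≤-reflexive (count-split P ⁅ v ⁆))
      (+-monoˡ-≤ _ (≤-trans (≤-reflexive (count-⁅⁆∩ v P)) (aux (P v)))))))
    where
    aux : ∀ b → ind b ≤ 1
    aux true  = ≤-refl
    aux false = z≤n
  ... | u , q = u , ∧⁻ˡ q , λ { refl → clash (⁅⁆-refl u) (∖⁻ {P u} q) }

  positive : (P : Sub n) {v : Fin n} → v ∈ P → 1 ≤ count P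
  positive P p = subst (1 ≤_) (sym (count-delete P p)) (s≤s z≤n)

  two : (P : Sub n) {u v : Fin n} → u ∈ P → v ∈ P → u ≢ v → 2 ≤ count P
  two P {u} {v} p q u≢v = subst (2 ≤_) (sym (count-delete P p))
    (s≤s (positive (P ∖ ⁅ u ⁆) (∖⁺ q (≢⇒∉⁅⁆ (u≢v ∘ sym)))))

  unique : (P : Sub n) {u v : Fin n} → u ∈ P → v ∈ P → count P ≤ 1 → u ≡ v
  unique P {u} {v} p q c with u ≟ v
  ... | yes u≡v = u≡v
  ... | no  u≢v = 1≰0 (+-cancelˡ-≤ 1 _ _ (≤-trans (two P p q u≢v) c))

  absent : (P : Sub n) → count P ≡ 0 → ∀ v → v ∉ P
  absent P c v = refute λ p → 1≰0 (subst (1 ≤_) c (positive P p))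

  -- A missing v would make `P ∪ ⁅ v ⁆` a subset of Q with more elements than Q.
  ⊆-count⇒⊇ : (P Q : Sub n) → (P ⊆ Q) → count Q ≤ count P → ∀ v → v ∈ Q → v ∈ P
  ⊆-count⇒⊇ P Q s c v q with v ∈? P
  ... | inj₁ p  = p
  ... | inj₂ ¬p = 1≰0 ((linear (count P ∷ count Q ∷ count (P ∪ ⁅ v ⁆) ∷ []) (con 1 ≼ con 0) 0
      ( 1 · x1 ≼ x0 ∵ c
      ⨾ 1 ·⁻ x2 ≐ con 1 ⊕ x0 ∵ count-insert P ¬p
      ⨾ 1 · x2 ≼ x1 ∵ count-⊆ (λ u r → sub u (∨⁻ r)))))
    where
    sub : ∀ u → u ∈ P ⊎ u ∈ ⁅ v ⁆ → u ∈ Q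
    sub u (inj₁ r) = s u r
    sub u (inj₂ r) = subst (_∈ Q) (sym (⁅⁆⇒≡ r)) q

  search : (P : Sub n) {Q : Fin n → Set} → (∀ v → Dec (Q v)) →
           (∃[ v ] v ∈ P × Q v) ⊎ (∀ v → v ∈ P → ¬ Q v)
  search P Q? with any? (λ v → (P v Bool.≟ true) ×-dec Q? v)
  ... | yes p = inj₁ p
  ... | no ¬p = inj₂ λ v p q → ¬p (v , p , q)

  ind≤1 : ∀ b → ind b ≤ 1
  ind≤1 true  = ≤-refl
  ind≤1 false = z≤n

  ind-pos : ∀ {b} → 1 ≤ ind b → b ≡ true
  ind-pos {true} _ = refl

  _where?_ : (P : Sub n) {Q : Fin n → Set} → (∀ v → Dec (Q v)) → Sub n
  (P where? Q?) v = P v ∧ does (Q? v)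

  where⁺ : (P : Sub n) {Q : Fin n → Set} (Q? : ∀ v → Dec (Q v)) {v : Fin n} → v ∈ P → Q v →
      v ∈ P where? Q?
  where⁺ P Q? {v} p q = ∧⁺ p (dec-true (Q? v) q)

  where⁻ : (P : Sub n) {Q : Fin n → Set} (Q? : ∀ v → Dec (Q v)) {v : Fin n} → v ∈ P where? Q? → Q v
  where⁻ P Q? {v} p with Q? v | ∧⁻ʳ {P v} p
  ... | yes q | _ = q

  ∑-strict : {f g : Fin n → ℕ} (u : Fin n) → (∀ v → f v ≤ g v) → suc (f u) ≤ g u →
      suc (∑∈ full f) ≤ ∑∈ full g
  ∑-strict {f = f} {g} u p q = linear (∑∈ full f ∷ ∑∈ full g ∷ ∑∈ (full ∩ ⁅ u ⁆) f ∷ ∑∈ (full ∩ ⁅ u ⁆)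
      g ∷ ∑∈ (full ∖ ⁅ u ⁆) f ∷ ∑∈ (full ∖ ⁅ u ⁆) g ∷ f u ∷ g u ∷ [])
      (con 1 ⊕ x0 ≼ x1) 0
      ( 1 · x0 ≐ x2 ⊕ x4 ∵ ∑-split full ⁅ u ⁆ f
      ⨾ 1 ·⁻ x1 ≐ x3 ⊕ x5 ∵ ∑-split full ⁅ u ⁆ g
      ⨾ 1 · x2 ≐ x6 ∵ ∑-⁅⁆ u f
      ⨾ 1 ·⁻ x3 ≐ x7 ∵ ∑-⁅⁆ u g
      ⨾ 1 · x4 ≼ x5 ∵ ∑-mono (full ∖ ⁅ u ⁆) (λ v _ → p v)
      ⨾ 1 · con 1 ⊕ x6 ≼ x7 ∵ q)

  -- The effect on the degree sum of adding one edge uw.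
  ∑-bump : {f g : Fin n → ℕ} {u w : Fin n} → u ≢ w → g u ≡ suc (f u) → g w ≡ suc (f w) →
           (∀ v → v ≢ u → v ≢ w → g v ≡ f v) → ∑∈ full g ≡ 2 + ∑∈ full f
  ∑-bump {f = f} {g} {u} {w} u≢w gu gw same =
    (linear (∑∈ full g ∷ ∑∈ full f ∷ ∑∈ full (λ v → f v + (ind (⁅ u ⁆ v) + ind (⁅ w ⁆ v))) ∷ ∑∈ full
        (λ v → ind (⁅ u ⁆ v) + ind (⁅ w ⁆ v)) ∷ ∑∈ full (ind ∘ ⁅ u ⁆) ∷ ∑∈ full (ind ∘ ⁅ w ⁆) ∷ [])
        (x0 ≐ con 2 ⊕ x1) 0
        ( 1 · x0 ≐ x2 ∵ ∑-cong full (λ v _ → point v)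
        ⨾ 1 · x2 ≐ x1 ⊕ x3 ∵ ∑-+ full f (λ v → ind (⁅ u ⁆ v) + ind (⁅ w ⁆ v))
        ⨾ 1 · x3 ≐ x4 ⊕ x5 ∵ ∑-+ full (ind ∘ ⁅ u ⁆) (ind ∘ ⁅ w ⁆)
        ⨾ 1 · x4 ≐ con 1 ∵ trans (∑-ind ⁅ u ⁆) (count-⁅⁆ u)
        ⨾ 1 · x5 ≐ con 1 ∵ trans (∑-ind ⁅ w ⁆) (count-⁅⁆ w)))
    where
    point : ∀ v → g v ≡ f v + (ind (⁅ u ⁆ v) + ind (⁅ w ⁆ v))
    point v with v ≟ u
    ... | yes refl rewrite ⁅⁆-refl u | ≢⇒∉⁅⁆ u≢w = trans gu (+-comm 1 (f u))
    ... | no v≢u with v ≟ w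
    ...   | yes refl rewrite ≢⇒∉⁅⁆ v≢u | ⁅⁆-refl w = trans gw (+-comm 1 (f w))
    ...   | no v≢w rewrite ≢⇒∉⁅⁆ v≢u | ≢⇒∉⁅⁆ v≢w = trans (same v v≢u v≢w) (sym (+-identityʳ (f v)))

  count≤1 : (P : Sub n) → (∀ u v → u ∈ P → v ∈ P → u ≡ v) → count P ≤ 1
  count≤1 P uniq with 2 ≤? count P
  ... | no  ¬two = ≤-pred (≰⇒> ¬two)
  ... | yes 2≤ with u , p ← inhabited P (≤-trans (s≤s z≤n) 2≤) with v , q , v≢u ← other P u 2≤ =
      ⊥-elim (v≢u (uniq v u q p))

  ⇔⇒≡ : ∀ {x y : Bool} → (x ≡ true → y ≡ true) → (y ≡ true → x ≡ true) → x ≡ y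
  ⇔⇒≡ {true}  {y}     f g = sym (f refl)
  ⇔⇒≡ {false} {true}  f g = g refl
  ⇔⇒≡ {false} {false} f g = refl

  count-exchange : (P : Sub n) {u v : Fin n} → u ∈ P → v ∉ P → count ((P ∖ ⁅ u ⁆) ∪ ⁅ v ⁆) ≡ count P
  count-exchange P {u} {v} p q = trans (count-insert (P ∖ ⁅ u ⁆) (refute λ r → clash (∧⁻ˡ r) q))
      (sym (count-delete P p))

  -- Degrees and edge counts

  -- Edges are counted as ordered pairs. Hence `e P` below is twice the number of edges inside P,
  -- while `E adj P (∁ P)` is the exact size of the edge boundary.
  E : (Fin n → Sub n) → Sub n → Sub n → ℕ
  E r P Q = ∑∈ P (λ u → count (r u ∩ Q))

  opaque
    unfolding count ∑∈

    -- Double counting: both sides sum over the same pairs, in the two possible orders.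
    E-sym : (r : Fin n → Sub n) → (∀ u v → r u v ≡ r v u) → ∀ P Q → E r P Q ≡ E r Q P
    E-sym r r-sym P Q =
      trans (sum-cong-≗ λ u → sym (sum-*ˡ (ind (P u)) (ind ∘ (r u ∩ Q))))
      (trans (∑-comm λ u v → ind (P u) * ind (r u v ∧ Q v))
      (sum-cong-≗ λ v → trans (sum-cong-≗ λ u → aux u v (P u) (Q v))
          (sum-*ˡ (ind (Q v)) (ind ∘ (r v ∩ P)))))
      where
      ind-∧ : ∀ x p q → ind p * ind (x ∧ q) ≡ ind q * ind (x ∧ p)
      ind-∧ false p q = trans (*-zeroʳ (ind p)) (sym (*-zeroʳ (ind q)))
      ind-∧ true  p q = *-comm (ind p) (ind q)
      aux : ∀ u v p q → ind p * ind (r u v ∧ q) ≡ ind q * ind (r v u ∧ p)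
      aux u v p q rewrite r-sym u v = ind-∧ (r v u) p q

  E-cong : (r : Fin n → Sub n) {P P′ Q Q′ : Sub n} → (∀ v → P v ≡ P′ v) → (∀ v → Q v ≡ Q′ v) →
      E r P Q ≡ E r P′ Q′
  E-cong r {P} {P′} {Q} {Q′} p q = trans (∑-set _ p) (∑-cong P′ λ u _ → count-cong λ v →
      cong (r u v ∧_) (q v))

  count-∩-split : (S P Q : Sub n) → count (S ∩ P) ≡ count (S ∩ (P ∩ Q)) + count (S ∩ (P ∖ Q))
  count-∩-split S P Q = trans (count-split (S ∩ P) Q)
    (cong₂ _+_ (count-cong λ v → ∧-assoc′ (S v)) (count-cong λ v → ∧-assoc′ (S v)))
    where
    ∧-assoc′ : ∀ x {y z} → (x ∧ y) ∧ z ≡ x ∧ (y ∧ z)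
    ∧-assoc′ true  = refl
    ∧-assoc′ false = refl

  count-∩-∪ : (S P Q : Sub n) → (P # Q) → count (S ∩ (P ∪ Q)) ≡ count (S ∩ P) + count (S ∩ Q)
  count-∩-∪ S P Q d = trans (count-cong λ v → ∧-∨ (S v))
    (count-∪ (S ∩ P) (S ∩ Q) λ v p → refute λ q → clash (∧⁻ʳ {S v} q) (d v (∧⁻ʳ {S v} p)))
    where
    ∧-∨ : ∀ x {y z} → x ∧ (y ∨ z) ≡ (x ∧ y) ∨ (x ∧ z)
    ∧-∨ true  = refl
    ∧-∨ false = refl

  E-∪ʳ : (r : Fin n → Sub n) (S P Q : Sub n) → (P # Q) → E r S (P ∪ Q) ≡ E r S P + E r S Q
  E-∪ʳ r S P Q d = trans (∑-cong S λ u _ → count-∩-∪ (r u) P Q d) (∑-+ S _ _)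

  opaque
    unfolding ⁅_⁆

    restore : (P : Sub n) {v : Fin n} → v ∈ P → ∀ u → P u ≡ ((P ∖ ⁅ v ⁆) ∪ ⁅ v ⁆) u
    restore P {v} p u with u ≟ v
    ... | yes refl = trans p (sym (∨⁺ʳ {P u ∧ false} refl))
    ... | no _ with P u
    ...   | true  = refl
    ...   | false = refl

  deleted : (P : Sub n) {v : Fin n} → v ∉ P ∖ ⁅ v ⁆
  deleted P {v} = ∖-no {P v} (⁅⁆-refl v)

  module Relation {n} (adj : Fin n → Sub n) (adj-sym : ∀ u v → adj u v ≡ adj v u) (loopless : ∀ u →
      u ∉ adj u) where

    d : Sub n → Fin n → ℕ
    d P u = count (adj u ∩ P)

    e : Sub n → ℕ
    e P = E adj P P

    adj⁻¹ : ∀ {u v} → v ∈ adj u → u ∈ adj v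
    adj⁻¹ {u} {v} p = trans (adj-sym v u) p

    adj⇒≢ : ∀ {u v} → v ∈ adj u → u ≢ v
    adj⇒≢ {u} p refl = clash p (loopless u)

    d-full : ∀ u → d full u ≡ count (adj u)
    d-full u = count-cong λ v → ∧-true (adj u v)
      where
      ∧-true : ∀ x → x ∧ true ≡ x
      ∧-true true  = refl
      ∧-true false = refl

    d-split : ∀ P Q u → d P u ≡ d (P ∩ Q) u + d (P ∖ Q) u
    d-split P Q u = count-∩-split (adj u) P Q

    d-∪ : ∀ P Q u → (P # Q) → d (P ∪ Q) u ≡ d P u + d Q u
    d-∪ P Q u = count-∩-∪ (adj u) P Q

    d-⊆ : ∀ {P Q} u → (P ⊆ Q) → d P u ≤ d Q u
    d-⊆ {P} {Q} u s = count-⊆ {P = adj u ∩ P} {adj u ∩ Q} λ v p → ∧⁺ (∧⁻ˡ p) (s v (∧⁻ʳ {adj u v} p))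

    d-cong : ∀ {P Q} u → (∀ v → P v ≡ Q v) → d P u ≡ d Q u
    d-cong u p = count-cong λ v → cong (adj u v ∧_) (p v)

    d-⁅⁆ : ∀ v u → d ⁅ v ⁆ u ≡ ind (adj u v)
    d-⁅⁆ v u = count-⁅⁆∩ v (adj u)

    d-insert : ∀ P {v} u → v ∉ P → d (P ∪ ⁅ v ⁆) u ≡ d P u + ind (adj u v)
    d-insert P {v} u p = trans (d-∪ P ⁅ v ⁆ u λ w q → ≢⇒∉⁅⁆ (∈∉⇒≢ P q p)) (cong (d P u +_) (d-⁅⁆ v u))

    d-delete : ∀ P {v} u → v ∈ P → d P u ≡ d (P ∖ ⁅ v ⁆) u + ind (adj u v)
    d-delete P {v} u p = trans (d-cong u (restore P p)) (d-insert (P ∖ ⁅ v ⁆) u (deleted P))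

    d-delete-self : ∀ P {v} → v ∈ P → d (P ∖ ⁅ v ⁆) v ≡ d P v
    d-delete-self P {v} p = sym (trans (d-delete P v p)
      (trans (cong (λ b → d (P ∖ ⁅ v ⁆) v + ind b) (loopless v)) (+-identityʳ _)))

    d≤count : ∀ P u → d P u ≤ count P
    d≤count P u = count-⊆ {P = adj u ∩ P} λ v → ∧⁻ʳ {adj u v}

    d<count : ∀ P {u} → u ∈ P → suc (d P u) ≤ count P
    d<count P {u} p = ≤-trans (s≤s (≤-trans (≤-reflexive (sym (d-delete-self P p))) (d≤count _ u)))
      (≤-reflexive (sym (count-delete P p)))

    nbr : ∀ P u → 1 ≤ d P u → ∃[ v ] v ∈ adj u × v ∈ P
    nbr P u p with inhabited (adj u ∩ P) p
    ... | v , q = v , ∧⁻ˡ q , ∧⁻ʳ {adj u v} q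

    d-pos : ∀ P {u v} → v ∈ adj u → v ∈ P → 1 ≤ d P u
    d-pos P p q = positive _ (∧⁺ p q)

    d-zero : ∀ P {u v} → d P u ≡ 0 → v ∈ adj u → v ∉ P
    d-zero P {u} {v} z p = refute λ q → 1≰0 (subst (1 ≤_) z (d-pos P p q))

    E-symᵃ : ∀ P Q → E adj P Q ≡ E adj Q P
    E-symᵃ = E-sym adj adj-sym

    e-∪ : ∀ P Q → (P # Q) → e (P ∪ Q) ≡ e P + e Q + 2 * E adj P Q
    e-∪ P Q s = linear (e (P ∪ Q) ∷ E adj P (P ∪ Q) ∷ E adj Q (P ∪ Q) ∷ e P ∷ e Q ∷ E adj P Q ∷ E adj Q
        P ∷ [])
        (x0 ≐ x3 ⊕ x4 ⊕ 2 ⊗ x5) 0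
        ( 1 · x0 ≐ x1 ⊕ x2 ∵ ∑-∪ P Q _ s
        ⨾ 1 · x1 ≐ x3 ⊕ x5 ∵ E-∪ʳ adj P P Q s
        ⨾ 1 · x2 ≐ x6 ⊕ x4 ∵ E-∪ʳ adj Q P Q s
        ⨾ 1 ·⁻ x5 ≐ x6 ∵ E-symᵃ P Q)

    e-insert : ∀ P {v} → v ∉ P → e (P ∪ ⁅ v ⁆) ≡ e P + 2 * d P v
    e-insert P {v} p = linear (e (P ∪ ⁅ v ⁆) ∷ e P ∷ e ⁅ v ⁆ ∷ E adj P ⁅ v ⁆ ∷ E adj ⁅ v ⁆ P ∷ d P v ∷ [])
        (x0 ≐ x1 ⊕ 2 ⊗ x5) 0
        ( 1 · x0 ≐ x1 ⊕ x2 ⊕ 2 ⊗ x3 ∵ e-∪ P ⁅ v ⁆ (λ u q → ≢⇒∉⁅⁆ (∈∉⇒≢ P q p))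
        ⨾ 2 · x3 ≐ x4 ∵ E-symᵃ P ⁅ v ⁆
        ⨾ 2 · x4 ≐ x5 ∵ ∑-⁅⁆ v (d P)
        ⨾ 1 · x2 ≐ con 0 ∵ trans (∑-⁅⁆ v (d ⁅ v ⁆)) (trans (d-⁅⁆ v v) (cong ind (loopless v))))

    e-delete : ∀ P {v} → v ∈ P → e P ≡ e (P ∖ ⁅ v ⁆) + 2 * d P v
    e-delete P {v} p = trans (E-cong adj (restore P p) (restore P p))
      (trans (e-insert (P ∖ ⁅ v ⁆) (deleted P)) (cong (λ k → e (P ∖ ⁅ v ⁆) + 2 * k) (d-delete-self P p)))

    -- The handshake lemma, by deleting vertices one at a time: each takes `2 * d P v` away.
    e-even : ∀ P → ∃[ k ] e P ≡ 2 * k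
    e-even P = go (count P) P refl
      where
      go : ∀ c P → count P ≡ c → ∃[ k ] e P ≡ 2 * k
      go zero P |P| = 0 , n≤0⇒n≡0 (≤-trans (∑-mono P λ v p → clash p (absent P |P| v))
          (≤-reflexive (∑-const P 0)))
      go (suc c) P |P| with v , p ← inhabited P (≤-trans (s≤s z≤n) (≤-reflexive (sym |P|)))
        with k , eq ← go c (P ∖ ⁅ v ⁆) (suc-injective (trans (sym (count-delete P p)) |P|)) =
        k + d P v , trans (e-delete P p) (trans (cong (_+ 2 * d P v) eq) (sym (*-distribˡ-+ 2 k (d P v))))

  module Edge {n} {u w : Fin n} (u≢w : u ≢ w) where

    edge : Fin n → Sub n
    edge x y = (⁅ u ⁆ x ∧ ⁅ w ⁆ y) ∨ (⁅ w ⁆ x ∧ ⁅ u ⁆ y)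

    edge-sym : ∀ x y → edge x y ≡ edge y x
    edge-sym x y = trans (Bool.∨-comm (⁅ u ⁆ x ∧ ⁅ w ⁆ y) (⁅ w ⁆ x ∧ ⁅ u ⁆ y))
      (cong₂ _∨_ (Bool.∧-comm (⁅ w ⁆ x) (⁅ u ⁆ y)) (Bool.∧-comm (⁅ u ⁆ x) (⁅ w ⁆ y)))

    edge⁻ : ∀ {x y} → y ∈ edge x → (x ≡ u × y ≡ w) ⊎ (x ≡ w × y ≡ u)
    edge⁻ {x} {y} p with ∨⁻ {⁅ u ⁆ x ∧ ⁅ w ⁆ y} p
    ... | inj₁ q = inj₁ (⁅⁆⇒≡ (∧⁻ˡ {⁅ u ⁆ x} q) , ⁅⁆⇒≡ (∧⁻ʳ {⁅ u ⁆ x} q))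
    ... | inj₂ q = inj₂ (⁅⁆⇒≡ (∧⁻ˡ {⁅ w ⁆ x} q) , ⁅⁆⇒≡ (∧⁻ʳ {⁅ w ⁆ x} q))

    edge-uw : w ∈ edge u
    edge-uw = ∨⁺ˡ (∧⁺ (⁅⁆-refl u) (⁅⁆-refl w))

    row-u : ∀ y → edge u y ≡ ⁅ w ⁆ y
    row-u y rewrite ⁅⁆-refl u | ≢⇒∉⁅⁆ u≢w with ⁅ w ⁆ y
    ... | true  = refl
    ... | false = refl

    row-w : ∀ y → edge w y ≡ ⁅ u ⁆ y
    row-w y rewrite ⁅⁆-refl w | ≢⇒∉⁅⁆ (u≢w ∘ sym) = refl

    row-other : ∀ {x} → x ≢ u → x ≢ w → ∀ y → y ∉ edge x
    row-other p q y rewrite ≢⇒∉⁅⁆ p | ≢⇒∉⁅⁆ q = refl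

  record CubicGraph (n : ℕ) : Set where
    field
      adj     : Fin n → Sub n
      adj-sym : ∀ u v → adj u v ≡ adj v u
      loopless : ∀ u → u ∉ adj u
      cubic   : ∀ u → count (adj u) ≡ 3

  module Degrees {n} (G : CubicGraph n) where
    open CubicGraph G public
    open Relation adj adj-sym loopless public

    d-∁ : ∀ P u → d P u + d (∁ P) u ≡ 3
    d-∁ P u = trans (sym (d-split full P u)) (trans (d-full u) (cubic u))

    -- As all degrees are 3, such a set is a union of components.
    Closed : Sub n → Set
    Closed P = ∀ u → u ∈ P → d P u ≡ 3

    d≤3 : ∀ P u → d P u ≤ 3
    d≤3 P u = ≤-trans (m≤m+n _ _) (≤-reflexive (d-∁ P u))

    d-disjoint : ∀ P Q u → (P # Q) → d P u + d Q u ≤ 3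
    d-disjoint P Q u s = ≤-trans (≤-reflexive (sym (d-∪ P Q u s))) (d≤3 _ u)

    d-all : ∀ P {u v} → d P u ≡ 3 → v ∈ adj u → v ∈ P
    d-all P {u} {v} z p with v ∈? P
    ... | inj₁ q = q
    ... | inj₂ q = 1≰0 (linear (d P u ∷ d (∁ P) u ∷ []) (con 1 ≼ con 0) 0
        ( 1 · x0 ⊕ x1 ≐ con 3 ∵ d-∁ P u
        ⨾ 1 ·⁻ x0 ≐ con 3 ∵ z
        ⨾ 1 · con 1 ≼ x1 ∵ d-pos (∁ P) p (not⁺ q)))

    -- The vertices of P have three edge ends each; inner edges absorb two ends, boundary edges one.
    -- This turns lower bounds on `e` into upper bounds on the boundary.
    boundary : ∀ P → e P + E adj P (∁ P) ≡ 3 * count P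
    boundary P = trans (sym (∑-+ P (d P) (d (∁ P)))) (trans (∑-cong P λ u _ → d-∁ P u) (∑-const P 3))

  -- Growing sets with many inner edges

  module Grow {n} (G : CubicGraph n) where
    open Degrees G public

    min-degree⇒e : ∀ {k} M → (∀ u → u ∈ M → k ≤ d M u) → k * count M ≤ e M
    min-degree⇒e {k} M p = ≤-trans (≤-reflexive (sym (∑-const M k))) (∑-mono M p)

    -- When X is a union of cycles, one of its vertices is exchanged for two adjacent vertices outside.
    two-regular-subset : ∀ N → (∀ u → u ∈ N → d N u ≡ 2) → ∀ k → 2 + k ≤ count N →
      ∃[ X ] (X ⊆ N) × count X ≡ 2 + k × (∀ u → u ∈ X → 1 ≤ d X u)
    two-regular-subset N reg zero m≤N
      with u , u∈N ← inhabited N (≤-trans (s≤s z≤n) m≤N)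
      with v , uv , v∈N ← nbr N u (≤-trans (s≤s z≤n) (≤-reflexive (sym (reg u u∈N)))) =
        X , sub , trans (count-insert ⁅ u ⁆ v∉u) (cong suc (count-⁅⁆ u)) , deg
      where
      X = ⁅ u ⁆ ∪ ⁅ v ⁆
      v∉u : v ∉ ⁅ u ⁆
      v∉u = ≢⇒∉⁅⁆ (adj⇒≢ uv ∘ sym)
      sub : X ⊆ N
      sub w p with ∨⁻ {⁅ u ⁆ w} p
      ... | inj₁ q rewrite ⁅⁆⇒≡ q = u∈N
      ... | inj₂ q rewrite ⁅⁆⇒≡ q = v∈N
      deg : ∀ w → w ∈ X → 1 ≤ d X w
      deg w p with ∨⁻ {⁅ u ⁆ w} p
      ... | inj₁ q rewrite ⁅⁆⇒≡ q = d-pos X uv (∨⁺ʳ {⁅ u ⁆ v} (⁅⁆-refl v))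
      ... | inj₂ q rewrite ⁅⁆⇒≡ q = d-pos X (adj⁻¹ uv) (∨⁺ˡ (⁅⁆-refl u))
    two-regular-subset N reg (suc k) m≤N
      with X , X⊆N , |X| , deg ← two-regular-subset N reg k (≤-trans (n≤1+n _) m≤N)
      with search (N ∖ X) (λ u → 1 ≤? d X u)
    ... | inj₁ (u , u∈ , 1≤dXu) = X′ , sub , trans (count-insert X (∖⁻ {N u} u∈)) (cong suc |X|) , deg′
      where
      X′ = X ∪ ⁅ u ⁆
      sub : X′ ⊆ N
      sub w p with ∨⁻ {X w} p
      ... | inj₁ q = X⊆N w q
      ... | inj₂ q rewrite ⁅⁆⇒≡ q = ∧⁻ˡ u∈
      deg′ : ∀ w → w ∈ X′ → 1 ≤ d X′ w
      deg′ w p with ∨⁻ {X w} p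
      ... | inj₁ q = ≤-trans (deg w q) (d-⊆ {X} {X′} w λ v → ∨⁺ˡ)
      ... | inj₂ q rewrite ⁅⁆⇒≡ q = ≤-trans 1≤dXu (d-⊆ {X} {X′} u λ v → ∨⁺ˡ)
    ... | inj₂ closed
      with u , u∈ ← inhabited (N ∖ X)
          ((linear (count N ∷ count X ∷ count (N ∩ X) ∷ count (N ∖ X) ∷ k ∷ []) (con 1 ≼ x3) 0
          ( 1 · x0 ≐ x2 ⊕ x3 ∵ count-split N X
          ⨾ 1 · x2 ≼ x1 ∵ count-⊆ {P = N ∩ X} (λ v → ∧⁻ʳ {N v})
          ⨾ 1 · x1 ≐ con 2 ⊕ x4 ∵ |X|
          ⨾ 1 · con 3 ⊕ x4 ≼ x0 ∵ m≤N)))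
      with v , uv , v∈N ← nbr N u (≤-trans (s≤s z≤n) (≤-reflexive (sym (reg u (∧⁻ˡ u∈)))))
      with x , x∈X ← inhabited X (≤-trans (s≤s z≤n) (≤-reflexive (sym |X|))) = X″ , sub , size , deg″
      where
      v∉X : v ∉ X
      v∉X = refute λ v∈X → closed u u∈ (d-pos X uv v∈X)
      X⁻ = X ∖ ⁅ x ⁆
      X′ = X⁻ ∪ ⁅ u ⁆
      X″ = X′ ∪ ⁅ v ⁆
      no⁻ : ∀ {w} → w ∉ X → w ∉ X⁻
      no⁻ {w} p = refute λ q → clash (∧⁻ˡ {X w} q) p
      u∉ : u ∉ X⁻
      u∉ = no⁻ (∖⁻ {N u} u∈)
      v∉ : v ∉ X′
      v∉ = ∪-no (no⁻ v∉X) (≢⇒∉⁅⁆ (adj⇒≢ uv ∘ sym))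
      sub : ∀ w → w ∈ X″ → w ∈ N
      sub w p with ∨⁻ {X′ w} p
      ... | inj₂ q rewrite ⁅⁆⇒≡ q = v∈N
      ... | inj₁ q with ∨⁻ {X⁻ w} q
      ...   | inj₁ r = X⊆N w (∧⁻ˡ r)
      ...   | inj₂ r rewrite ⁅⁆⇒≡ r = ∧⁻ˡ u∈
      size : count X″ ≡ 3 + k
      size = linear (count X ∷ count X⁻ ∷ count X′ ∷ count X″ ∷ k ∷ []) (x3 ≐ con 3 ⊕ x4) 0
          ( 1 ·⁻ x0 ≐ con 1 ⊕ x1 ∵ count-delete X x∈X
          ⨾ 1 · x2 ≐ con 1 ⊕ x1 ∵ count-insert X⁻ u∉
          ⨾ 1 · x3 ≐ con 1 ⊕ x2 ∵ count-insert X′ v∉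
          ⨾ 1 · x0 ≐ con 2 ⊕ x4 ∵ |X|)
      deg″ : ∀ w → w ∈ X″ → 1 ≤ d X″ w
      deg″ w p with ∨⁻ {X′ w} p
      ... | inj₂ q rewrite ⁅⁆⇒≡ q = d-pos X″ (adj⁻¹ uv) (∨⁺ˡ (∨⁺ʳ {X⁻ u} (⁅⁆-refl u)))
      ... | inj₁ q with ∨⁻ {X⁻ w} q
      ...   | inj₂ r rewrite ⁅⁆⇒≡ r = d-pos X″ uv (∨⁺ʳ {X′ v} (⁅⁆-refl v))
      -- X has no neighbour in the rest of N, so both neighbours of w in N lie in X, and at most one
      -- of them is the dropped x.
      ...   | inj₁ r = linear (d N w ∷ d X w ∷ d X⁻ w ∷ d X″ w ∷ d (N ∩ X) w ∷ d (N ∖ X) w ∷ ind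
          (adj w x) ∷ [])
          (con 1 ≼ x3) 0
          ( 1 ·⁻ x0 ≐ con 2 ∵ reg w (X⊆N w (∧⁻ˡ r))
          ⨾ 1 · x0 ≐ x4 ⊕ x5 ∵ d-split N X w
          ⨾ 1 · x4 ≼ x1 ∵ d-⊆ {N ∩ X} {X} w (λ y → ∧⁻ʳ {N y})
          ⨾ 1 · x5 ≐ con 0 ∵ count-∅ (λ y → refute λ s → closed y (∧⁻ʳ {adj w y} s)
              (d-pos X (adj⁻¹ (∧⁻ˡ s)) (∧⁻ˡ r)))
          ⨾ 1 · x1 ≐ x2 ⊕ x6 ∵ d-delete X w x∈X
          ⨾ 1 · x6 ≼ con 1 ∵ ind≤1 (adj w x)
          ⨾ 1 · x2 ≼ x3 ∵ d-⊆ {X⁻} {X″} w (λ y → ∨⁺ˡ ∘ ∨⁺ˡ))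

    -- A pending vertex, one with two neighbours in D, keeps a single free edge once the edges at D
    -- are coloured. The colouring can afford one such vertex, and none with three neighbours in D.
    record Tame (W D : Sub n) : Set where
      field
        pending≤2      : ∀ u → u ∈ W → u ∉ D → d D u ≤ 2
        pending-unique : ∀ u v → u ∈ W → u ∉ D → v ∈ W → v ∉ D → 2 ≤ d D u → 2 ≤ d D v → u ≡ v

    calm⇒tame : ∀ {W D} → (∀ u → u ∈ W → u ∉ D → d D u ≤ 1) → Tame W D
    calm⇒tame calm = record
      { pending≤2      = λ u p q → ≤-trans (calm u p q) (s≤s z≤n)
      ; pending-unique = λ u v p q _ _ r _ → ⊥-elim (<⇒≱ r (calm u p q))
      }

    -- `2 * q ≤ e D + 2` asks for as many edges as a tree on q vertices has. In `cycles` every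
    -- vertex of X has edges to D and to X and no others, so giving the edges within X the colour
    -- opposite to that of D satisfies it. In `closed` a union of components is one vertex too
    -- large.
    data Grown (W : Sub n) (q : ℕ) : Set where
      tame   : ∀ D → (D ⊆ W) → count D ≡ q → 2 * q ≤ e D + 2 → Tame W D → Grown W q
      cycles : ∀ D X → (D ⊆ W) → (X ⊆ W) → (X # D) →
               count D ≡ q → 2 * q ≤ e D + 2 → (∀ u → u ∈ X → d D u + d X u ≡ 3) →
               (∀ u → u ∈ X → 1 ≤ d X u) → (∀ u → u ∈ X → 1 ≤ d D u) →
               (∀ u → u ∈ W → u ∉ D → u ∉ X → d D u ≡ 0) → Grown W q
      closed : ∀ M → (M ⊆ W) → count M ≡ suc q → Closed M → Grown W q

    module _ (W : Sub n) (q : ℕ) (core : ∀ u → u ∈ W → 2 ≤ d W u) (large : suc q ≤ count W) where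

      module Step (D : Sub n) (D⊆W : D ⊆ W) (dense : 2 * count D ≤ e D + 2)
                  (small : suc (count D) ≤ q) where

        insert-⊆ : ∀ {v} → v ∈ W → ∀ u → u ∈ D ∪ ⁅ v ⁆ → u ∈ W
        insert-⊆ v∈W u p with ∨⁻ {D u} p
        ... | inj₁ r = D⊆W u r
        ... | inj₂ r rewrite ⁅⁆⇒≡ r = v∈W

        insert-dense : ∀ {v} → v ∉ D → 1 ≤ d D v → 2 * count (D ∪ ⁅ v ⁆) ≤ e (D ∪ ⁅ v ⁆) + 2
        insert-dense {v} p 1≤d = linear (count D ∷ count (D ∪ ⁅ v ⁆) ∷ e D ∷ e (D ∪ ⁅ v ⁆) ∷ d D v ∷ [])
            (2 ⊗ x1 ≼ x3 ⊕ con 2) 0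
            ( 1 · 2 ⊗ x0 ≼ x2 ⊕ con 2 ∵ dense
            ⨾ 2 · x1 ≐ con 1 ⊕ x0 ∵ count-insert D p
            ⨾ 1 ·⁻ x3 ≐ x2 ⊕ 2 ⊗ x4 ∵ e-insert D p
            ⨾ 2 · con 1 ≼ x4 ∵ 1≤d)

        insert-pending : ∀ {r u} → u ∉ D → r ∉ D → d D u ≤ 1 → 2 ≤ d (D ∪ ⁅ r ⁆) u → u ∈ adj r × 1 ≤ d D u
        insert-pending {r} {u} u∉ r∉ dDu big =
          adj⁻¹ (ind-pos (linear (d D u ∷ d (D ∪ ⁅ r ⁆) u ∷ ind (adj u r) ∷ []) (con 1 ≼ x2) 0
              ( 1 · x1 ≐ x0 ⊕ x2 ∵ d-insert D u r∉
              ⨾ 1 · x0 ≼ con 1 ∵ dDu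
              ⨾ 1 · con 2 ≼ x1 ∵ big))) ,
          (linear (d D u ∷ d (D ∪ ⁅ r ⁆) u ∷ ind (adj u r) ∷ []) (con 1 ≼ x0) 0
              ( 1 · x1 ≐ x0 ⊕ x2 ∵ d-insert D u r∉
              ⨾ 1 · x2 ≼ con 1 ∵ ind≤1 (adj u r)
              ⨾ 1 · con 2 ≼ x1 ∵ big))

        insert≤2 : ∀ {r u} → r ∉ D → d D u ≤ 1 → d (D ∪ ⁅ r ⁆) u ≤ 2
        insert≤2 {r} {u} r∉ dDu = linear (d D u ∷ d (D ∪ ⁅ r ⁆) u ∷ ind (adj u r) ∷ []) (x1 ≼ con 2) 0
            ( 1 · x1 ≐ x0 ⊕ x2 ∵ d-insert D u r∉
            ⨾ 1 · x0 ≼ con 1 ∵ dDu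
            ⨾ 1 · x2 ≼ con 1 ∵ ind≤1 (adj u r))

        module Pending (t : Tame W D) {r} (r∈W : r ∈ W) (r∉D : r ∉ D) (2≤r : 2 ≤ d D r) where
          others-calm : ∀ u → u ∈ W → u ∉ D ∪ ⁅ r ⁆ → d D u ≤ 1
          others-calm u p q′ with 2 ≤? d D u
          ... | no ¬2≤ = ≤-pred (≰⇒> ¬2≤)
          ... | yes 2≤ with refl ← Tame.pending-unique t u r p (∪-noˡ q′) r∈W r∉D 2≤ 2≤r =
            clash (⁅⁆-refl r) (∪-noʳ {D r} q′)

          -- With two neighbours in D, r has at most one outside, and only that one can become
          -- pending.
          insert-tame : Tame W (D ∪ ⁅ r ⁆)
          insert-tame = record
            { pending≤2      = λ u p q′ → insert≤2 r∉D (others-calm u p q′)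
            ; pending-unique = λ u v p q′ p′ q″ 2≤u 2≤v →
                unique (adj r ∩ ∁ D)
                  (∧⁺ (proj₁ (insert-pending (∪-noˡ q′) r∉D (others-calm u p q′) 2≤u)) (not⁺ (∪-noˡ q′)))
                  (∧⁺ (proj₁ (insert-pending (∪-noˡ q″) r∉D (others-calm v p′ q″) 2≤v)) (not⁺ (∪-noˡ q″)))
                  (linear (d D r ∷ d (∁ D) r ∷ []) (x1 ≼ con 1) 0
                      ( 1 · x0 ⊕ x1 ≐ con 3 ∵ d-∁ D r
                      ⨾ 1 · con 2 ≼ x0 ∵ 2≤r))
            }

        N : Sub n
        N = (W ∖ D) where? (λ u → 1 ≤? d D u)

        N⁺ : ∀ {u} → u ∈ W → u ∉ D → 1 ≤ d D u → u ∈ N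
        N⁺ p q′ = where⁺ (W ∖ D) (λ u → 1 ≤? d D u) (∖⁺ p q′)

        N⇒∉D : ∀ {u} → u ∈ N → u ∉ D
        N⇒∉D {u} p = ∖⁻ {W u} (∧⁻ˡ p)

        N⇒∈W : ∀ {u} → u ∈ N → u ∈ W
        N⇒∈W {u} p = ∧⁻ˡ {W u} (∧⁻ˡ p)

        N⇒1≤ : ∀ {u} → u ∈ N → 1 ≤ d D u
        N⇒1≤ p = where⁻ (W ∖ D) (λ u → 1 ≤? d D u) p

        module Calm (calm : ∀ u → u ∈ W → u ∉ D → d D u ≤ 1) where

          -- Only a neighbour of v that already has a neighbour in D becomes pending, and `dNv`
          -- allows one of these.
          insert-tame : ∀ {v} → v ∈ N → d N v ≤ 1 → Tame W (D ∪ ⁅ v ⁆)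
          insert-tame {v} v∈N dNv = record
            { pending≤2      = λ u p q′ → insert≤2 (N⇒∉D v∈N) (calm u p (∪-noˡ q′))
            ; pending-unique = λ u w p q′ p′ q″ 2≤u 2≤w → unique (adj v ∩ N) (hit u p q′ 2≤u)
                (hit w p′ q″ 2≤w) dNv
            }
            where
            hit : ∀ u → u ∈ W → u ∉ D ∪ ⁅ v ⁆ → 2 ≤ d (D ∪ ⁅ v ⁆) u → u ∈ adj v ∩ N
            hit u p q′ 2≤u with a , b ← insert-pending (∪-noˡ q′) (N⇒∉D v∈N) (calm u p (∪-noˡ q′)) 2≤u =
              ∧⁺ a (N⁺ p (∪-noˡ q′) b)

          -- Every neighbour of D would create two pending vertices. Then N is 2-regular and
          -- D ∪ N is closed in W.
          module Stuck (stuck : ∀ v → v ∈ N → 2 ≤ d N v) where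
            M : Sub n
            M = D ∪ N

            D∩N : D # N
            D∩N v p = refute λ q′ → clash p (N⇒∉D q′)

            N-total : ∀ {v} → v ∈ N → d D v + d N v ≤ 3
            N-total {v} _ = d-disjoint D N v D∩N

            N-deg : ∀ v → v ∈ N → d N v ≡ 2
            N-deg v p = ≤-antisym (linear (d D v ∷ d N v ∷ []) (x1 ≼ con 2) 0
                ( 1 · x0 ⊕ x1 ≼ con 3 ∵ N-total p
                ⨾ 1 · con 1 ≼ x0 ∵ N⇒1≤ p)) (linear (d N v ∷ []) (con 2 ≼ x0) 0
                    (1 · con 2 ≼ x0 ∵ stuck v p))

            N-back : ∀ v → v ∈ N → d D v ≡ 1
            N-back v p = ≤-antisym (linear (d D v ∷ d N v ∷ []) (x0 ≼ con 1) 0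
                ( 1 · x0 ⊕ x1 ≼ con 3 ∵ N-total p
                ⨾ 1 · con 2 ≼ x1 ∵ stuck v p)) (linear (d D v ∷ []) (con 1 ≼ x0) 0
                    (1 · con 1 ≼ x0 ∵ N⇒1≤ p))

            dM : ∀ u → d M u ≡ d D u + d N u
            dM u = d-∪ D N u D∩N

            N-inside : ∀ v → v ∈ N → d M v ≡ 3
            N-inside v p = trans (dM v) (cong₂ _+_ (N-back v p) (N-deg v p))

            M⊆W : M ⊆ W
            M⊆W u p with ∨⁻ {D u} p
            ... | inj₁ r = D⊆W u r
            ... | inj₂ r = N⇒∈W r

            -- A neighbour of D in W would belong to N, and a vertex of N already has its three
            -- neighbours in M.
            outside : ∀ u → u ∈ W → u ∉ M → d M u ≡ 0
            outside u p q′ = trans (dM u) (cong₂ _+_ noD noN)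
              where
              noD : d D u ≡ 0
              noD with 1 ≤? d D u
              ... | yes r = clash (N⁺ p (∪-noˡ q′) r) (∪-noʳ {D u} q′)
              ... | no  r = n<1⇒n≡0 (≰⇒> r)
              noN : d N u ≡ 0
              noN = count-∅ λ v → refute λ r → clash
                (d-all M (N-inside v (∧⁻ʳ {adj u v} r)) (adj⁻¹ (∧⁻ˡ r))) q′

            M-deg : ∀ u → u ∈ M → d W u ≤ d M u
            M-deg u p = linear (d W u ∷ d M u ∷ d (W ∩ M) u ∷ d (W ∖ M) u ∷ []) (x0 ≼ x1) 0
                ( 1 · x0 ≐ x2 ⊕ x3 ∵ d-split W M u
                ⨾ 1 · x2 ≼ x1 ∵ d-⊆ {W ∩ M} {M} u (λ v → ∧⁻ʳ {W v})
                ⨾ 1 · x3 ≐ con 0 ∵ count-∅ (λ v → refute λ r →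
                    clash p (d-zero M (outside v (∧⁻ˡ (∧⁻ʳ {adj u v} r)) (∖⁻ {W v} (∧⁻ʳ {adj u v} r)))
                    (adj⁻¹ (∧⁻ˡ r)))))

            M-dense : 2 * count M ≤ e M
            M-dense = min-degree⇒e M λ u p → ≤-trans (core u (M⊆W u p)) (M-deg u p)

            |M| : count M ≡ count D + count N
            |M| = count-∪ D N D∩N

            -- The surplus of M over q is `2 + k`. That many vertices of N form X, none isolated
            -- among them, and the rest Y joins D; every vertex of Y brings its one edge to D, which
            -- preserves the density.
            finish-cycles : 2 + q ≤ count M → Grown W q
            finish-cycles big with k , q+k ← m≤n⇒∃[o]m+o≡n big
              with X , X⊆N , |X| , X-deg ← two-regular-subset N N-deg k
                (linear (q ∷ k ∷ count M ∷ count D ∷ count N ∷ []) (con 2 ⊕ x1 ≼ x4) 0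
                    ( 1 · con 2 ⊕ x0 ⊕ x1 ≐ x2 ∵ q+k
                    ⨾ 1 · x2 ≐ x3 ⊕ x4 ∵ |M|
                    ⨾ 1 · con 1 ⊕ x3 ≼ x0 ∵ small)) =
              cycles D′ X D′⊆W (λ u p → N⇒∈W (X⊆N u p)) X∉D′
                (linear (q ∷ k ∷ count M ∷ count D ∷ count N ∷ count X ∷ count Y ∷ count D′ ∷ count
                    (N ∩ X) ∷ [])
                    (x7 ≐ x0) 0
                    ( 1 ·⁻ con 2 ⊕ x0 ⊕ x1 ≐ x2 ∵ q+k
                    ⨾ 1 ·⁻ x2 ≐ x3 ⊕ x4 ∵ |M|
                    ⨾ 1 · x7 ≐ x3 ⊕ x6 ∵ |D′|
                    ⨾ 1 ·⁻ x4 ≐ x8 ⊕ x6 ∵ count-split N X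
                    ⨾ 1 ·⁻ x8 ≐ x5 ∵ N∩X
                    ⨾ 1 ·⁻ x5 ≐ con 2 ⊕ x1 ∵ |X|))
                (linear (q ∷ k ∷ count M ∷ count D ∷ count N ∷ count X ∷ count Y ∷ count (N ∩ X) ∷ e D ∷ e
                    Y ∷ e D′ ∷ E adj D Y ∷ E adj Y D ∷ [])
                    (2 ⊗ x0 ≼ x10 ⊕ con 2) 0
                    ( 2 · con 2 ⊕ x0 ⊕ x1 ≐ x2 ∵ q+k
                    ⨾ 2 · x2 ≐ x3 ⊕ x4 ∵ |M|
                    ⨾ 2 · x4 ≐ x7 ⊕ x6 ∵ count-split N X
                    ⨾ 2 · x7 ≐ x5 ∵ N∩X
                    ⨾ 2 · x5 ≐ con 2 ⊕ x1 ∵ |X|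
                    ⨾ 1 ·⁻ x10 ≐ x8 ⊕ x9 ⊕ 2 ⊗ x11 ∵ e-∪ D Y D∩Y
                    ⨾ 2 ·⁻ x11 ≐ x12 ∵ E-symᵃ D Y
                    ⨾ 2 ·⁻ x12 ≐ 1 ⊗ x6 ∵ trans (∑-cong Y λ u p → N-back u (∧⁻ˡ p)) (∑-const Y 1)
                    ⨾ 1 · 2 ⊗ x3 ≼ x8 ⊕ con 2 ∵ dense))
                (λ u p → (linear (d D′ u ∷ d X u ∷ d D u ∷ d Y u ∷ d N u ∷ d (N ∩ X) u ∷ [])
                    (x0 ⊕ x1 ≐ con 3) 0
                    ( 1 · x0 ≐ x2 ⊕ x3 ∵ d-∪ D Y u D∩Y
                    ⨾ 1 ·⁻ x4 ≐ x5 ⊕ x3 ∵ d-split N X u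
                    ⨾ 1 ·⁻ x5 ≐ x1 ∵ d-cong u (∩-⊆ u)
                    ⨾ 1 · x2 ≐ con 1 ∵ N-back u (X⊆N u p)
                    ⨾ 1 · x4 ≐ con 2 ∵ N-deg u (X⊆N u p))))
                X-deg
                (λ u p → ≤-trans (N⇒1≤ (X⊆N u p)) (d-⊆ {D} {D′} u λ v → ∨⁺ˡ))
                (λ u p r s → n≤0⇒n≡0 (≤-trans (d-⊆ {D′} {M} u D′⊆M)
                    (≤-reflexive (outside u p (away u r s)))))
              where
              Y = N ∖ X
              D′ = D ∪ Y
              ∩-⊆ : ∀ u v → (N ∩ X) v ≡ X v
              ∩-⊆ _ v with v ∈? X
              ... | inj₁ p rewrite p | X⊆N v p = refl
              ... | inj₂ p rewrite p with N v
              ...   | true  = refl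
              ...   | false = refl
              N∩X : count (N ∩ X) ≡ count X
              N∩X = count-cong λ v → ∩-⊆ v v
              D∩Y : D # Y
              D∩Y v p = refute λ r → clash p (N⇒∉D (∧⁻ˡ r))
              |D′| : count D′ ≡ count D + count Y
              |D′| = count-∪ D Y D∩Y
              D′⊆M : D′ ⊆ M
              D′⊆M u p with ∨⁻ {D u} p
              ... | inj₁ r = ∨⁺ˡ r
              ... | inj₂ r = ∨⁺ʳ {D u} (∧⁻ˡ r)
              D′⊆W : D′ ⊆ W
              D′⊆W u p = M⊆W u (D′⊆M u p)
              X∉D′ : X # D′
              X∉D′ u p = ∪-no (N⇒∉D (X⊆N u p)) (∖-no {N u} p)
              away : ∀ u → u ∉ D′ → u ∉ X → u ∉ M
              away u p r = refute λ s → aux (∨⁻ {D u} s)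
                where
                aux : u ∈ D ⊎ u ∈ N → ⊥
                aux (inj₁ s) = clash s (∪-noˡ p)
                aux (inj₂ s) = clash (∖⁺ s r) (∪-noʳ {D u} p)

            -- A single vertex cannot serve as X, so a vertex u is dropped instead. M has at least q
            -- + 1 edges and u takes at most two of them; afterwards only u itself can be pending.
            -- If all vertices of M have degree 3 in W, then M is closed in G.
            finish-one-more : count M ≡ suc q → Grown W q
            finish-one-more |M|≡ with search M (λ u → d W u ≤? 2)
            ... | inj₂ all3 = closed M M⊆W |M|≡ λ u p → ≤-antisym (d≤3 M u)
                (≤-trans (≰⇒> (all3 u p)) (M-deg u p))
            ... | inj₁ (u , u∈M , dWu) = tame D′ (λ v p → M⊆W v (∧⁻ˡ p))
                (linear (q ∷ count M ∷ count D′ ∷ []) (x2 ≐ x0) 0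
                    ( 1 · x1 ≐ con 1 ⊕ x0 ∵ |M|≡
                    ⨾ 1 ·⁻ x1 ≐ con 1 ⊕ x2 ∵ count-delete M u∈M))
                (linear (q ∷ count M ∷ e M ∷ e D′ ∷ d M u ∷ []) (2 ⊗ x0 ≼ x3 ⊕ con 2) 0
                    ( 2 ·⁻ x1 ≐ con 1 ⊕ x0 ∵ |M|≡
                    ⨾ 1 · 2 ⊗ x1 ≼ x2 ∵ M-dense
                    ⨾ 1 · x2 ≐ x3 ⊕ 2 ⊗ x4 ∵ e-delete M u∈M
                    ⨾ 2 · x4 ≼ con 2 ∵ dMu))
                record
                  { pending≤2      = λ v p r → bound v p (v ∈? M) r
                  ; pending-unique = λ v w p r p′ r′ 2≤v 2≤w → trans (only v p r 2≤v)
                      (sym (only w p′ r′ 2≤w))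
                  }
              where
              D′ = M ∖ ⁅ u ⁆
              dMu : d M u ≤ 2
              dMu = ≤-trans (d-⊆ {M} {W} u M⊆W) dWu
              D′≤M : ∀ v → d D′ v ≤ d M v
              D′≤M v = d-⊆ {D′} {M} v λ w → ∧⁻ˡ
              is-u : ∀ v → v ∈ M → v ∉ D′ → v ≡ u
              is-u v p r with v ≟ u
              ... | yes v≡u = v≡u
              ... | no  v≢u = clash (∖⁺ p (≢⇒∉⁅⁆ v≢u)) r
              bound : ∀ v → v ∈ W → v ∈ M ⊎ v ∉ M → v ∉ D′ → d D′ v ≤ 2
              bound v p (inj₁ r) s rewrite is-u v r s = ≤-trans (D′≤M u) dMu
              bound v p (inj₂ r) s = ≤-trans (D′≤M v) (≤-trans (≤-reflexive (outside v p r)) z≤n)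
              only : ∀ v → v ∈ W → v ∉ D′ → 2 ≤ d D′ v → v ≡ u
              only v p r 2≤v with v ∈? M
              ... | inj₁ s = is-u v s r
              ... | inj₂ s with () ← ≤-trans 2≤v (≤-trans (D′≤M v) (≤-reflexive (outside v p s)))

            finish-exact : count M ≡ q → Grown W q
            finish-exact |M|≡ = tame M M⊆W |M|≡ (≤-trans (≤-reflexive (cong (2 *_) (sym |M|≡)))
                (≤-trans M-dense (m≤m+n (e M) 2)))
              (calm⇒tame λ u p r → ≤-trans (≤-reflexive (outside u p r)) z≤n)

            fresh : suc (count M) ≤ q → ∃[ u ] u ∈ W × u ∉ M
            fresh |M|<q with u , p ← inhabited (W ∖ M)
                (linear (count W ∷ count M ∷ count (W ∩ M) ∷ count (W ∖ M) ∷ q ∷ []) (con 1 ≼ x3) 1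
                ( 1 · x0 ≐ x2 ⊕ x3 ∵ count-split W M
                ⨾ 1 · x2 ≼ x1 ∵ count-⊆ {P = W ∩ M} (λ v → ∧⁻ʳ {W v})
                ⨾ 1 · con 1 ⊕ x1 ≼ x4 ∵ |M|<q
                ⨾ 1 · con 1 ⊕ x4 ≼ x0 ∵ large)) =
              u , ∧⁻ˡ p , ∖⁻ {W u} p

            fresh-tame : ∀ {u} → u ∉ M → Tame W (M ∪ ⁅ u ⁆)
            fresh-tame {u} u∉M = calm⇒tame λ v p r →
                (linear (d (M ∪ ⁅ u ⁆) v ∷ d M v ∷ ind (adj v u) ∷ []) (x0 ≼ con 1) 0
                ( 1 · x0 ≐ x1 ⊕ x2 ∵ d-insert M v u∉M
                ⨾ 1 · x1 ≐ con 0 ∵ outside v p (∪-noˡ r)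
                ⨾ 1 · x2 ≼ con 1 ∵ ind≤1 (adj v u)))

            -- By `core`, M has at least as many edges as vertices, one more than the density asks;
            -- this pays for u even though it brings no edge.
            fresh-dense : ∀ {u} → u ∉ M → 2 * count (M ∪ ⁅ u ⁆) ≤ e (M ∪ ⁅ u ⁆) + 2
            fresh-dense {u} u∉M = linear (count M ∷ count (M ∪ ⁅ u ⁆) ∷ e M ∷ e (M ∪ ⁅ u ⁆) ∷ d M u ∷ [])
                (2 ⊗ x1 ≼ x3 ⊕ con 2) 0
                ( 1 · 2 ⊗ x0 ≼ x2 ∵ M-dense
                ⨾ 2 · x1 ≐ con 1 ⊕ x0 ∵ count-insert M u∉M
                ⨾ 1 ·⁻ x3 ≐ x2 ⊕ 2 ⊗ x4 ∵ e-insert M u∉M)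

      -- The recursion runs on `k`, a bound for the number of missing vertices; a jump to a fresh
      -- vertex may add many at once.
      grow-from : ∀ k D → (D ⊆ W) → 2 * count D ≤ e D + 2 → count D ≤ q → q ≤ count D + k → Tame W D →
          Grown W q
      grow-from k D D⊆W dense D≤q q≤ t with count D ℕ.≟ q
      ... | yes |D|≡q = tame D D⊆W |D|≡q (subst (λ c → 2 * c ≤ e D + 2) |D|≡q dense) t
      grow-from zero D D⊆W dense D≤q q≤ t | no |D|≢q =
          ⊥-elim (|D|≢q (≤-antisym D≤q (subst (q ≤_) (+-identityʳ _) q≤)))
      grow-from (suc k) D D⊆W dense D≤q q≤ t | no |D|≢q = case₁ (search (W ∖ D) (λ u → 2 ≤? d D u))
        where
        small = ≤∧≢⇒< D≤q |D|≢q
        open Step D D⊆W dense small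
        one-more : ∀ {v} → v ∈ W → v ∉ D → 1 ≤ d D v → Tame W (D ∪ ⁅ v ⁆) → Grown W q
        one-more {v} v∈W v∉D 1≤ t′ = grow-from k (D ∪ ⁅ v ⁆) (insert-⊆ v∈W) (insert-dense v∉D 1≤)
          (≤-trans (≤-reflexive (count-insert D v∉D)) small)
          (linear (count D ∷ count (D ∪ ⁅ v ⁆) ∷ q ∷ k ∷ []) (x2 ≼ x1 ⊕ x3) 0
              ( 1 ·⁻ x1 ≐ con 1 ⊕ x0 ∵ count-insert D v∉D
              ⨾ 1 · x2 ≼ x0 ⊕ con 1 ⊕ x3 ∵ subst (q ≤_) (sym (+-assoc (count D) 1 k)) q≤)) t′
        case₃ : (calm : ∀ u → u ∈ W → u ∉ D → d D u ≤ 1) → (∃[ v ] v ∈ N × d N v ≤ 1) ⊎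
            (∀ v → v ∈ N → ¬ d N v ≤ 1) → Grown W q
        case₃ calm (inj₁ (v , v∈N , dNv)) = one-more (N⇒∈W v∈N) (N⇒∉D v∈N) (N⇒1≤ v∈N)
            (Calm.insert-tame calm v∈N dNv)
        case₃ calm (inj₂ none) = compare-size (<-cmp (count M) (suc q))
          where
          open Calm calm
          open Stuck (λ v p → ≰⇒> (none v p))
          small-M : suc (count M) ≤ q → Grown W q
          small-M |M|<q with u , u∈W , u∉M ← fresh |M|<q =
            grow-from k (M ∪ ⁅ u ⁆) sub (fresh-dense u∉M) (≤-trans (≤-reflexive (count-insert M u∉M))
                |M|<q)
              (linear (count D ∷ count M ∷ count N ∷ count (M ∪ ⁅ u ⁆) ∷ q ∷ k ∷ []) (x4 ≼ x3 ⊕ x5) 0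
                  ( 1 ·⁻ x3 ≐ con 1 ⊕ x1 ∵ count-insert M u∉M
                  ⨾ 1 ·⁻ x1 ≐ x0 ⊕ x2 ∵ |M|
                  ⨾ 1 · x4 ≼ x0 ⊕ con 1 ⊕ x5 ∵ subst (q ≤_) (sym (+-assoc (count D) 1 k)) q≤))
                      (fresh-tame u∉M)
            where
            sub : M ∪ ⁅ u ⁆ ⊆ W
            sub v p with ∨⁻ {M v} p
            ... | inj₁ r = M⊆W v r
            ... | inj₂ r rewrite ⁅⁆⇒≡ r = u∈W
          compare-size : Tri (count M < suc q) (count M ≡ suc q) (suc q < count M) → Grown W q
          compare-size (tri> _ _ big)  = finish-cycles big
          compare-size (tri≈ _ same _) = finish-one-more same
          compare-size (tri< below _ _) with count M ℕ.≟ q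
          ... | yes same = finish-exact same
          ... | no  diff = small-M (≤∧≢⇒< (≤-pred below) diff)
        case₁ : (∃[ r ] r ∈ W ∖ D × 2 ≤ d D r) ⊎ (∀ r → r ∈ W ∖ D → ¬ 2 ≤ d D r) → Grown W q
        case₁ (inj₁ (r , p , 2≤r)) = one-more (∧⁻ˡ p) (∖⁻ {W r} p) (≤-trans (s≤s z≤n) 2≤r)
          (Pending.insert-tame t (∧⁻ˡ p) (∖⁻ {W r} p) 2≤r)
        case₁ (inj₂ none) = case₃ (λ u p r → ≤-pred (≰⇒> (none u (∖⁺ p r)))) (search N (λ v → d N v ≤? 1))

      grow : Grown W q
      grow = grow-from q ∅ (λ u ()) (subst (λ c → 2 * c ≤ e ∅ + 2) (sym |∅|) z≤n)
          (≤-trans (≤-reflexive |∅|) z≤n)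
        (m≤n+m q (count ∅)) (calm⇒tame λ u _ _ → ≤-trans
            (≤-reflexive (count-∅ λ v → refute λ p → clash (∧⁻ʳ {adj u v} p) refl)) z≤n)
        where
        |∅| : count {n} ∅ ≡ 0
        |∅| = count-∅ λ _ → refl

  -- Peeling off vertices with at most one neighbour in the remaining set

  module Peeling {n} (G : CubicGraph n) where
    open Grow G public

    record Peeled (Z : Sub n) (q k : ℕ) : Set where
      field
        core    : Sub n
        core⊆   : core ⊆ Z
        sparse  : ∀ u → u ∈ Z → u ∉ core → d core u ≤ 1
        dense   : 2 * count core ≤ e core + k
        stopped : count core ≡ q ⊎ (suc q ≤ count core × (∀ u → u ∈ core → 2 ≤ d core u))

    -- A removed vertex takes at most one edge along, so the excess `k` of twice the vertices over
    -- `e` is kept. Its number of neighbours in the shrinking set can only decrease later, which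
    -- keeps `sparse`.
    peel-from : ∀ {Z q k} f W → (W ⊆ Z) → (∀ u → u ∈ Z → u ∉ W → d W u ≤ 1) →
      2 * count W ≤ e W + k → q + f ≡ count W → Peeled Z q k
    peel-from zero W W⊆Z sparse dense |W| = record
      { core = W ; core⊆ = W⊆Z ; sparse = sparse ; dense = dense ; stopped =
          inj₁ (trans (sym |W|) (+-identityʳ _)) }
    peel-from {Z} {q} {k} (suc f) W W⊆Z sparse dense |W| with search W (λ u → d W u ≤? 1)
    ... | inj₂ none = record
      { core = W ; core⊆ = W⊆Z ; sparse = sparse ; dense = dense
      ; stopped = inj₂ ((linear (q ∷ f ∷ count W ∷ []) (con 1 ⊕ x0 ≼ x2) 0
          ( 1 · x0 ⊕ con 1 ⊕ x1 ≐ x2 ∵ trans (+-assoc q 1 f) |W|)) , λ u p → ≰⇒> (none u p)) }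
    ... | inj₁ (u , u∈W , low) = peel-from f W′ (λ v p → W⊆Z v (∧⁻ˡ p)) sparse′
        (linear (count W ∷ count W′ ∷ e W ∷ e W′ ∷ d W u ∷ k ∷ []) (2 ⊗ x1 ≼ x3 ⊕ x5) 0
            ( 1 · 2 ⊗ x0 ≼ x2 ⊕ x5 ∵ dense
            ⨾ 2 ·⁻ x0 ≐ con 1 ⊕ x1 ∵ count-delete W u∈W
            ⨾ 1 · x2 ≐ x3 ⊕ 2 ⊗ x4 ∵ e-delete W u∈W
            ⨾ 2 · x4 ≼ con 1 ∵ low))
        (linear (q ∷ f ∷ count W ∷ count W′ ∷ []) (x0 ⊕ x1 ≐ x3) 0
            ( 1 · x0 ⊕ con 1 ⊕ x1 ≐ x2 ∵ trans (+-assoc q 1 f) |W|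
            ⨾ 1 · x2 ≐ con 1 ⊕ x3 ∵ count-delete W u∈W))
      where
      W′ = W ∖ ⁅ u ⁆
      W′≤W : ∀ v → d W′ v ≤ d W v
      W′≤W v = d-⊆ {W′} {W} v λ w → ∧⁻ˡ
      sparse′ : ∀ v → v ∈ Z → v ∉ W′ → d W′ v ≤ 1
      sparse′ v p r with v ∈? W
      ... | inj₂ v∉W = ≤-trans (W′≤W v) (sparse v p v∉W)
      ... | inj₁ v∈W with v ≟ u
      ...   | yes refl = ≤-trans (W′≤W v) low
      ...   | no  v≢u  = clash (∖⁺ v∈W (≢⇒∉⁅⁆ v≢u)) r

    peel : ∀ {Z q k} → q ≤ count Z → 2 * count Z ≤ e Z + k → Peeled Z q k
    peel {Z} q≤ dense with f , eq ← m≤n⇒∃[o]m+o≡n q≤ = peel-from f Z (λ _ p → p) (λ u p r → clash p r)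
        dense eq

  -- Two-colourings in which a vertex sees both colours

  module Coloring {n} (G : CubicGraph n) where
    open Degrees G public

    -- A partial 2-colouring of the edges: In and Out are only meaningful on adjacent pairs.
    record Partial : Set where
      field
        In Out   : Fin n → Sub n
        In-sym   : ∀ u v → In u v ≡ In v u
        Out-sym  : ∀ u v → Out u v ≡ Out v u
        disjoint : ∀ u v → v ∈ adj u → v ∈ In u → v ∉ Out u

      Free : Fin n → Sub n
      Free u = ∁ (In u ∪ Out u)

      i o f : Fin n → ℕ
      i u = count (adj u ∩ In u)
      o u = count (adj u ∩ Out u)
      f u = count (adj u ∩ Free u)

      total : ∀ u → i u + o u + f u ≡ 3
      total u = linear (i u ∷ o u ∷ f u ∷ d (In u ∪ Out u) u ∷ d (∁ (In u ∪ Out u)) u ∷ [])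
          (x0 ⊕ x1 ⊕ x2 ≐ con 3) 0
          ( 1 · x3 ⊕ x4 ≐ con 3 ∵ d-∁ (In u ∪ Out u) u
          ⨾ 1 · x2 ≐ x4 ∵ refl
          ⨾ 1 ·⁻ x3 ≐ x0 ⊕ x1 ∵ io)
        where
        io : d (In u ∪ Out u) u ≡ i u + o u
        io = trans (count-cong λ v → aux (adj u v) (In u v) (Out u v))
          (count-∪ (adj u ∩ In u) (adj u ∩ Out u) λ v p → refute λ q →
            clash (∧⁻ʳ {adj u v} q) (disjoint u v (∧⁻ˡ p) (∧⁻ʳ {adj u v} p)))
          where
          aux : ∀ a x y → a ∧ (x ∨ y) ≡ (a ∧ x) ∨ (a ∧ y)
          aux true  x y = refl
          aux false x y = refl

      Sat : Fin n → Set
      Sat u = 1 ≤ i u × 1 ≤ o u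

      Sat? : ∀ u → Dec (Sat u)
      Sat? u = (1 ≤? i u) ×-dec (1 ≤? o u)

      freedom : ℕ
      freedom = ∑∈ full f

    open Partial

    swap : Partial → Partial
    swap S = record
      { In = Out S ; Out = In S ; In-sym = Out-sym S ; Out-sym = In-sym S
      ; disjoint = λ u v a p → refute λ q → clash p (disjoint S u v a q)
      }

    f-swap : ∀ S u → f (swap S) u ≡ f S u
    f-swap S u = count-cong λ v → cong (λ b → adj u v ∧ not b) (Bool.∨-comm (Out S u v) (In S u v))

    module Paint (S : Partial) {u w : Fin n} (uw : w ∈ adj u) (fr : w ∈ Free S u) where

      open Edge (adj⇒≢ uw)

      wu-free : u ∈ Free S w
      wu-free = trans (cong₂ (λ a b → not (a ∨ b)) (In-sym S w u) (Out-sym S w u)) fr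

      paint : Partial
      paint = record
        { In       = λ x → In S x ∪ edge x
        ; Out      = Out S
        ; In-sym   = λ x y → cong₂ _∨_ (In-sym S x y) (edge-sym x y)
        ; Out-sym  = Out-sym S
        ; disjoint = λ x y a p → dis x y a (∨⁻ {In S x y} p)
        }
        where
        dis : ∀ x y → y ∈ adj x → y ∈ In S x ⊎ y ∈ edge x → y ∉ Out S x
        dis x y a (inj₁ p) = disjoint S x y a p
        dis x y a (inj₂ p) with edge⁻ p
        ... | inj₁ (refl , refl) = ∪-noʳ {In S x y} (not⁻ fr)
        ... | inj₂ (refl , refl) = ∪-noʳ {In S x y} (not⁻ wu-free)

      i-grows : ∀ x → i S x ≤ i paint x
      i-grows x = count-⊆ {P = adj x ∩ In S x} λ y p → ∧⁺ (∧⁻ˡ {adj x y} p) (∨⁺ˡ (∧⁻ʳ {adj x y} p))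

      i-u : 1 ≤ i paint u
      i-u = positive _ (∧⁺ uw (∨⁺ʳ {In S u w} edge-uw))

      sat-kept : ∀ x → Sat S x → Sat paint x
      sat-kept x (a , b) = ≤-trans a (i-grows x) , b

      f-other : ∀ x → x ≢ u → x ≢ w → f paint x ≡ f S x
      f-other x p q = count-cong λ y → aux (adj x y) (In S x y) (Out S x y) (row-other p q y)
        where
        aux : ∀ a b c {z} → z ≡ false → a ∧ not ((b ∨ z) ∨ c) ≡ a ∧ not (b ∨ c)
        aux a true  c refl = refl
        aux a false c refl = refl

      f-row : ∀ x z → z ∈ adj x → z ∈ Free S x → (∀ y → edge x y ≡ ⁅ z ⁆ y) → f S x ≡ suc (f paint x)
      f-row x z xz free-z row = trans (count-delete (adj x ∩ Free S x) (∧⁺ xz free-z))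
        (cong suc (count-cong λ y → trans (aux (adj x y) (In S x y) (Out S x y) (⁅ z ⁆ y))
          (cong (λ b → adj x y ∧ not ((In S x y ∨ b) ∨ Out S x y)) (sym (row y)))))
        where
        aux : ∀ a b c z → (a ∧ not (b ∨ c)) ∧ not z ≡ a ∧ not ((b ∨ z) ∨ c)
        aux false b     c     z     = refl
        aux true  true  c     z     = refl
        aux true  false true  true  = refl
        aux true  false true  false = refl
        aux true  false false true  = refl
        aux true  false false false = refl

      f-u : f S u ≡ suc (f paint u)
      f-u = f-row u w uw fr row-u

      f-w : f S w ≡ suc (f paint w)
      f-w = f-row w u (adj⁻¹ uw) wu-free row-w

      f-shrinks : ∀ x → f paint x ≤ f S x
      f-shrinks x with x ≟ u | x ≟ w
      ... | yes refl | _        = ≤-trans (n≤1+n _) (≤-reflexive (sym f-u))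
      ... | no _     | yes refl = ≤-trans (n≤1+n _) (≤-reflexive (sym f-w))
      ... | no p     | no q     = ≤-reflexive (f-other x p q)

      freedom-drops : suc (freedom paint) ≤ freedom S
      freedom-drops = ∑-strict u f-shrinks (≤-reflexive (sym f-u))

      still-free : ∀ {x y} → y ∈ Free paint x → y ∈ Free S x
      still-free {x} {y} p = not⁺ (∪-no (∪-noˡ (∪-noˡ (not⁻ p))) (∪-noʳ {In S x y ∨ edge x y} (not⁻ p)))

    record Extends (S T : Partial) : Set where
      field
        In⁺  : ∀ u v → v ∈ In S u → v ∈ In T u
        Out⁺ : ∀ u v → v ∈ Out S u → v ∈ Out T u

    open Extends

    extends-trans : ∀ {S T U} → Extends S T → Extends T U → Extends S U
    extends-trans a b = record { In⁺ = λ u v → In⁺ b u v ∘ In⁺ a u v ; Out⁺ = λ u v →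
        Out⁺ b u v ∘ Out⁺ a u v }

    module _ (R : Sub n) where

      -- The invariant of the greedy colouring: ℓ is served first, and only the far end
      -- of the edge used for that can be left with a single free edge.
      record Flexible (ℓ : Fin n) (S : Partial) : Set where
        field
          spare  : ∀ u → u ∈ R → ¬ Sat S u → u ≢ ℓ → 2 ≤ f S u
          spareℓ : ℓ ∈ R → ¬ Sat S ℓ → 1 ≤ f S ℓ
          inside : ∀ u v → v ∈ adj u → v ∈ Free S u → u ∈ R

      Solution : Partial → Set
      Solution S = ∃[ T ] Extends S T × (∀ u → u ∈ R → Sat T u)

      record Progress (S : Partial) : Set where
        field
          T       : Partial
          ext     : Extends S T
          ℓ       : Fin n
          flex    : Flexible ℓ T
          smaller : suc (freedom T) ≤ freedom S

      -- u gets its first in-edge, to w. If u has an out-edge, it is satisfied; otherwise its three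
      -- edges were all free and two remain. Only w may be down to one free edge, so w is the new ℓ.
      advance : ∀ S ℓ → Flexible ℓ S → ∀ u → u ∈ R → ¬ Sat S u → 1 ≤ f S u →
                (∀ x → x ∈ R → ¬ Sat S x → x ≢ u → 2 ≤ f S x) → i S u ≡ 0 → Progress S
      advance S ℓ flex u u∈R unsat 1≤f rest i≡0 with inhabited _ 1≤f
      ... | w , p = record
        { T = paint ; ext = record { In⁺ = λ x y → ∨⁺ˡ ; Out⁺ = λ x y q → q } ; ℓ = w
        ; flex = record
          { spare  = spare′
          ; spareℓ = λ w∈R un → ≤-pred (≤-trans (rest w w∈R (λ s → un (sat-kept w s)) (adj⇒≢ uw ∘ sym))
              (≤-reflexive f-w))
          ; inside = λ x y a q → Flexible.inside flex x y a (still-free q)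
          }
        ; smaller = freedom-drops
        }
        where
        uw = ∧⁻ˡ {adj u w} p
        open Paint S uw (∧⁻ʳ {adj u w} p)
        spare′ : ∀ x → x ∈ R → ¬ Sat paint x → x ≢ w → 2 ≤ f paint x
        spare′ x x∈R un x≢w with x ≟ u
        ... | no x≢u = ≤-trans (rest x x∈R (λ s → un (sat-kept x s)) x≢u)
            (≤-reflexive (sym (f-other x x≢u x≢w)))
        ... | yes refl with 1 ≤? o S u
        ...   | yes 1≤o = ⊥-elim (un (i-u , 1≤o))
        ...   | no  o≱1 = linear (i S u ∷ o S u ∷ f S u ∷ f paint u ∷ []) (con 2 ≼ x3) 0
            ( 1 ·⁻ x0 ⊕ x1 ⊕ x2 ≐ con 3 ∵ total S u
            ⨾ 1 · x0 ≐ con 0 ∵ i≡0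
            ⨾ 1 · x1 ≼ con 0 ∵ ≤-pred (≰⇒> o≱1)
            ⨾ 1 · x2 ≐ con 1 ⊕ x3 ∵ f-u)

      swap-flex : ∀ {ℓ S} → Flexible ℓ S → Flexible ℓ (swap S)
      swap-flex {S = S} flex = record
        { spare  = λ u p un q → ≤-trans (Flexible.spare flex u p (λ (a , b) → un (b , a)) q)
            (≤-reflexive (sym (f-swap S u)))
        ; spareℓ = λ p un → ≤-trans (Flexible.spareℓ flex p (λ (a , b) → un (b , a)))
            (≤-reflexive (sym (f-swap S _)))
        ; inside = λ u v a p → Flexible.inside flex u v a
            (trans (cong not (Bool.∨-comm (In S u v) (Out S u v))) p)
        }

      freedom-swap : ∀ S → freedom (swap S) ≡ freedom S
      freedom-swap S = ∑-cong full λ u _ → f-swap S u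

      swap-progress : ∀ {S} → Progress (swap S) → Progress S
      swap-progress {S} p = record
        { T = swap T ; ext = record { In⁺ = Out⁺ ext ; Out⁺ = In⁺ ext } ; ℓ = ℓ ; flex = swap-flex flex
        ; smaller = subst₂ (λ a b → suc a ≤ b) (sym (freedom-swap T)) (freedom-swap S) smaller
        }
        where open Progress p

      -- An unsatisfied vertex misses one of the colours; exchanging the colours covers the case
      -- that it misses `Out`.
      advance-any : ∀ S ℓ → Flexible ℓ S → ∀ u → u ∈ R → ¬ Sat S u → 1 ≤ f S u →
                    (∀ x → x ∈ R → ¬ Sat S x → x ≢ u → 2 ≤ f S x) → Progress S
      advance-any S ℓ flex u p un 1≤f rest with 1 ≤? i S u
      ... | no  i≱1 = advance S ℓ flex u p un 1≤f rest (n<1⇒n≡0 (≰⇒> i≱1))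
      ... | yes 1≤i = swap-progress (advance (swap S) ℓ (swap-flex flex) u p (λ (a , b) → un (b , a))
        (subst (1 ≤_) (sym (f-swap S u)) 1≤f)
        (λ x q un′ x≢u → subst (2 ≤_) (sym (f-swap S x)) (rest x q (λ (a , b) → un′ (b , a)) x≢u))
        (n<1⇒n≡0 (≰⇒> λ 1≤o → un (1≤i , 1≤o))))

      -- Every coloured edge lowers `freedom`. An unsatisfied ℓ goes first, since colouring
      -- elsewhere could use up its last free edge; once ℓ is fine, all unsatisfied vertices have
      -- two free edges and any of them may be next.
      solve-within : ∀ k S ℓ → Flexible ℓ S → freedom S ≤ k → Solution S
      solve-within k S ℓ flex bound = choose (R∋ℓ-unsat)
        where
        open Flexible flex
        R∋ℓ-unsat : (ℓ ∈ R × ¬ Sat S ℓ) ⊎ (ℓ ∈ R → ¬ ¬ Sat S ℓ)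
        R∋ℓ-unsat with ℓ ∈? R | Sat? S ℓ
        ... | inj₁ p | no un  = inj₁ (p , un)
        ... | inj₁ p | yes s  = inj₂ λ _ un → un s
        ... | inj₂ p | _      = inj₂ λ q → clash q p
        continue : ∀ j → j ≡ k → Progress S → Solution S
        continue zero    refl P with () ← ≤-trans (Progress.smaller P) bound
        continue (suc j) refl P with T , ext′ , sat ← solve-within j (Progress.T P) (Progress.ℓ P)
            (Progress.flex P)
                                       (≤-pred (≤-trans (Progress.smaller P) bound)) =
          T , extends-trans (Progress.ext P) ext′ , sat
        choose : (ℓ ∈ R × ¬ Sat S ℓ) ⊎ (ℓ ∈ R → ¬ ¬ Sat S ℓ) → Solution S
        choose (inj₁ (p , un)) = continue k refl (advance-any S ℓ flex ℓ p un (spareℓ p un) λ x q un′ x≢ →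
            spare x q un′ x≢)
        choose (inj₂ fine) with search R (λ u → ¬? (Sat? S u))
        ... | inj₁ (u , p , un) = continue k refl (advance-any S ℓ flex u p un
                (≤-trans (s≤s z≤n) (spare u p un (≢ℓ u p un))) λ x q un′ _ → spare x q un′ (≢ℓ x q un′))
          where
          ≢ℓ : ∀ x → x ∈ R → ¬ Sat S x → x ≢ ℓ
          ≢ℓ x q un′ refl = fine q un′
        ... | inj₂ none = S , record { In⁺ = λ _ _ p → p ; Out⁺ = λ _ _ p → p } , λ u p → sat u (none u p)
          where
          sat : ∀ u → ¬ ¬ Sat S u → Sat S u
          sat u nn with Sat? S u
          ... | yes s = s
          ... | no un = ⊥-elim (nn un)

      solve : ∀ S ℓ → Flexible ℓ S → Solution S
      solve S ℓ flex = solve-within (freedom S) S ℓ flex ≤-refl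

  -- Balancing degrees 1 and 2

  module Balancing {n} (G : CubicGraph n) where
    open Degrees G public

    -- `edges` matters only on adjacent pairs, `rel` being its restriction to G; so the complement
    -- inside G is plain negation.
    record Subgraph : Set where
      field
        edges     : Fin n → Sub n
        edges-sym : ∀ u v → edges u v ≡ edges v u

      rel : Fin n → Sub n
      rel u = adj u ∩ edges u

      rel-sym : ∀ u v → rel u v ≡ rel v u
      rel-sym u v = cong₂ _∧_ (adj-sym u v) (edges-sym u v)

      rel-loopless : ∀ u → u ∉ rel u
      rel-loopless u = refute λ p → clash (∧⁻ˡ p) (loopless u)

      deg : Fin n → ℕ
      deg u = count (rel u)

      size : ℕ
      size = ∑∈ full deg

      deg≤3 : ∀ u → deg u ≤ 3
      deg≤3 u = ≤-trans (count-⊆ {P = rel u} {adj u} λ v → ∧⁻ˡ) (≤-reflexive (cubic u))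

      size-even : ∃[ k ] size ≡ 2 * k
      size-even with k , eq ← Relation.e-even rel rel-sym rel-loopless full =
        k , trans (∑-cong full λ u _ → sym (Relation.d-full rel rel-sym rel-loopless u)) eq

      level : ℕ → Sub n
      level k u = does (deg u ℕ.≟ k)

      level⁺ : ∀ {k u} → deg u ≡ k → u ∈ level k
      level⁺ {k} {u} p = dec-true (deg u ℕ.≟ k) p

      level⁻ : ∀ {k u} → u ∈ level k → deg u ≡ k
      level⁻ {k} {u} p = from-does (deg u ℕ.≟ k) p

      private
        c : ℕ → ℕ
        c k = ∑∈ full (ind ∘ level k)

      levels : count (level 0) + count (level 1) + count (level 2) + count (level 3) ≡ n
      levels = linear (count (level 0) ∷ count (level 1) ∷ count (level 2) ∷ count (level 3) ∷ n ∷ c 0 ∷ c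
          1 ∷ c 2 ∷ c 3 ∷ ∑∈ full (λ u → ind (level 0 u) + ind (level 1 u)) ∷ ∑∈ full
          (λ u → ind (level 0 u) + ind (level 1 u) + ind (level 2 u)) ∷ ∑∈ full
          (λ u → ind (level 0 u) + ind (level 1 u) + ind (level 2 u) + ind (level 3 u)) ∷ ∑∈ full
          (λ _ → 1) ∷ count {n} full ∷ [])
          (x0 ⊕ x1 ⊕ x2 ⊕ x3 ≐ x4) 0
          ( 1 ·⁻ x5 ≐ x0 ∵ ∑-ind (level 0)
          ⨾ 1 ·⁻ x6 ≐ x1 ∵ ∑-ind (level 1)
          ⨾ 1 ·⁻ x7 ≐ x2 ∵ ∑-ind (level 2)
          ⨾ 1 ·⁻ x8 ≐ x3 ∵ ∑-ind (level 3)
          ⨾ 1 ·⁻ x9 ≐ x5 ⊕ x6 ∵ ∑-+ full _ _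
          ⨾ 1 ·⁻ x10 ≐ x9 ⊕ x7 ∵ ∑-+ full _ _
          ⨾ 1 ·⁻ x11 ≐ x10 ⊕ x8 ∵ ∑-+ full _ _
          ⨾ 1 · x11 ≐ x12 ∵ ∑-cong full (λ u _ → point (deg u) (deg≤3 u))
          ⨾ 1 · x12 ≐ 1 ⊗ x13 ∵ ∑-const full 1
          ⨾ 1 · x13 ≐ x4 ∵ count-full)
        where
        point : ∀ m → m ≤ 3 → ind (does (m ℕ.≟ 0)) + ind (does (m ℕ.≟ 1)) + ind (does (m ℕ.≟ 2)) + ind
            (does (m ℕ.≟ 3)) ≡ 1
        point 0 _ = refl
        point 1 _ = refl
        point 2 _ = refl
        point 3 _ = refl
        point (suc (suc (suc (suc m)))) (s≤s (s≤s (s≤s ())))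

      size-levels : size ≡ count (level 1) + 2 * count (level 2) + 3 * count (level 3)
      size-levels = linear (size ∷ count (level 1) ∷ count (level 2) ∷ count (level 3) ∷ c 1 ∷ c 2 ∷ c
          3 ∷ ∑∈ full (λ u → 2 * ind (level 2 u)) ∷ ∑∈ full (λ u → 3 * ind (level 3 u)) ∷ ∑∈ full
          (λ u → ind (level 1 u) + 2 * ind (level 2 u)) ∷ ∑∈ full
          (λ u → ind (level 1 u) + 2 * ind (level 2 u) + 3 * ind (level 3 u)) ∷ [])
          (x0 ≐ x1 ⊕ 2 ⊗ x2 ⊕ 3 ⊗ x3) 0
          ( 1 · x4 ≐ x1 ∵ ∑-ind (level 1)
          ⨾ 2 · x5 ≐ x2 ∵ ∑-ind (level 2)
          ⨾ 3 · x6 ≐ x3 ∵ ∑-ind (level 3)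
          ⨾ 1 · x7 ≐ 2 ⊗ x5 ∵ ∑-* full 2 _
          ⨾ 1 · x8 ≐ 3 ⊗ x6 ∵ ∑-* full 3 _
          ⨾ 1 · x9 ≐ x4 ⊕ x7 ∵ ∑-+ full _ _
          ⨾ 1 · x10 ≐ x9 ⊕ x8 ∵ ∑-+ full _ _
          ⨾ 1 · x0 ≐ x10 ∵ ∑-cong full (λ u _ → point (deg u) (deg≤3 u)))
        where
        point : ∀ m → m ≤ 3 → m ≡ ind (does (m ℕ.≟ 1)) + 2 * ind (does (m ℕ.≟ 2)) + 3 * ind
            (does (m ℕ.≟ 3))
        point 0 _ = refl
        point 1 _ = refl
        point 2 _ = refl
        point 3 _ = refl
        point (suc (suc (suc (suc m)))) (s≤s (s≤s (s≤s ())))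

    open Subgraph

    complement : Subgraph → Subgraph
    complement H = record { edges = λ u → ∁ (edges H u) ; edges-sym = λ u v → cong not (edges-sym H u v) }

    deg-complement : ∀ H u → deg H u + deg (complement H) u ≡ 3
    deg-complement H u = d-∁ (edges H u) u

    deg-complement′ : ∀ H {u k} → deg H u ≡ k → deg (complement H) u ≡ 3 ∸ k
    deg-complement′ H {u} refl = sym (trans (cong (_∸ deg H u) (sym (deg-complement H u)))
        (m+n∸m≡n (deg H u) _))

    size-complement : ∀ H → size H + size (complement H) ≡ 3 * n
    size-complement H = trans (sym (∑-+ full (deg H) _)) (trans (∑-cong full λ u _ → deg-complement H u)
      (trans (∑-const full 3) (cong (3 *_) count-full)))

    module Add (H : Subgraph) {u w} (uw : w ∈ adj u) (absent : w ∉ edges H u) where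
      open Edge (adj⇒≢ uw)

      add : Subgraph
      add = record { edges = λ x → edges H x ∪ edge x ; edges-sym = λ x y → cong₂ _∨_ (edges-sym H x y)
          (edge-sym x y) }

      private
        row : ∀ x z → z ∈ adj x → z ∉ edges H x → (∀ y → edge x y ≡ ⁅ z ⁆ y) → deg add x ≡ suc (deg H x)
        row x z xz fresh eq = trans (count-cong λ y → cong (λ b → adj x y ∧ (edges H x y ∨ b)) (eq y))
          (trans (count-∩-∪ (adj x) (edges H x) ⁅ z ⁆ λ v p → ≢⇒∉⁅⁆ (∈∉⇒≢ (edges H x) p fresh))
          (trans (cong (deg H x +_) (trans (d-⁅⁆ z x) (cong ind xz))) (+-comm _ 1)))

      deg-u : deg add u ≡ suc (deg H u)
      deg-u = row u w uw absent row-u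

      deg-w : deg add w ≡ suc (deg H w)
      deg-w = row w u (adj⁻¹ uw) (trans (edges-sym H w u) absent) row-w

      deg-same : ∀ x → x ≢ u → x ≢ w → deg add x ≡ deg H x
      deg-same x p q = count-cong λ y → cong (adj x y ∧_) (aux (edges H x y) (row-other p q y))
        where
        aux : ∀ a {b} → b ≡ false → a ∨ b ≡ a
        aux true  refl = refl
        aux false refl = refl

      size-add : size add ≡ 2 + size H
      size-add = ∑-bump (adj⇒≢ uw) deg-u deg-w deg-same

      kept : ∀ {x y} → x ≢ u → x ≢ w → edges add x y ≡ edges H x y
      kept {x} {y} p q = trans (cong (edges H x y ∨_) (row-other p q y)) (aux (edges H x y))
        where
        aux : ∀ a → a ∨ false ≡ a
        aux true  = refl
        aux false = refl

    -- Removing an edge is adding it to the complement.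
    module Remove (H : Subgraph) {u w} (uw : w ∈ adj u) (present : w ∈ edges H u) where
      private
        module A = Add (complement H) uw (cong not present)

      remove : Subgraph
      remove = complement A.add

      private
        drop : ∀ x → deg A.add x ≡ suc (deg (complement H) x) → deg H x ≡ suc (deg remove x)
        drop x p = linear (deg H x ∷ deg (complement H) x ∷ deg A.add x ∷ deg remove x ∷ [])
            (x0 ≐ con 1 ⊕ x3) 0
            ( 1 · x0 ⊕ x1 ≐ con 3 ∵ deg-complement H x
            ⨾ 1 ·⁻ x2 ⊕ x3 ≐ con 3 ∵ deg-complement A.add x
            ⨾ 1 · x2 ≐ con 1 ⊕ x1 ∵ p)

      deg-u : deg H u ≡ suc (deg remove u)
      deg-u = drop u A.deg-u

      deg-w : deg H w ≡ suc (deg remove w)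
      deg-w = drop w A.deg-w

      deg-same : ∀ x → x ≢ u → x ≢ w → deg remove x ≡ deg H x
      deg-same x p q = linear (deg H x ∷ deg (complement H) x ∷ deg A.add x ∷ deg remove x ∷ []) (x3 ≐ x0)
          0
          ( 1 ·⁻ x0 ⊕ x1 ≐ con 3 ∵ deg-complement H x
          ⨾ 1 · x2 ⊕ x3 ≐ con 3 ∵ deg-complement A.add x
          ⨾ 1 ·⁻ x2 ≐ x1 ∵ A.deg-same x p q)

      size-remove : size H ≡ 2 + size remove
      size-remove = linear (size H ∷ size (complement H) ∷ size A.add ∷ size remove ∷ n ∷ [])
          (x0 ≐ con 2 ⊕ x3) 0
          ( 1 · x0 ⊕ x1 ≐ 3 ⊗ x4 ∵ size-complement H
          ⨾ 1 ·⁻ x2 ⊕ x3 ≐ 3 ⊗ x4 ∵ size-complement A.add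
          ⨾ 1 · x2 ≐ con 2 ⊕ x1 ∵ A.size-add)

      kept : ∀ {x y} → x ≢ u → x ≢ w → edges remove x y ≡ edges H x y
      kept {x} {y} p q = trans (cong not (A.kept {x} {y} p q)) (aux (edges H x y))
        where
        aux : ∀ a → not (not a) ≡ a
        aux true  = refl
        aux false = refl

    record Valid (A D : Sub n) (H : Subgraph) : Set where
      field
        on-A : ∀ u → u ∈ A → deg H u ≡ 0
        on-D : ∀ u → u ∈ D → deg H u ≡ 3
        low  : ∀ u → u ∉ A → u ∉ D → 1 ≤ deg H u
        high : ∀ u → u ∉ A → u ∉ D → deg H u ≤ 2

      A≡ : ∀ u → level H 0 u ≡ A u
      A≡ u with u ∈? A | u ∈? D
      ... | inj₁ p | _      = trans (level⁺ H (on-A u p)) (sym p)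
      ... | inj₂ p | inj₁ q = trans (refute λ r → 0≢3 (trans (sym (level⁻ H r)) (on-D u q))) (sym p)
        where
        0≢3 : 0 ≢ 3
        0≢3 ()
      ... | inj₂ p | inj₂ q = trans (refute λ r → 1≰0 (subst (1 ≤_) (level⁻ H r) (low u p q))) (sym p)

      D≡ : ∀ u → level H 3 u ≡ D u
      D≡ u with u ∈? D | u ∈? A
      ... | inj₁ p | _      = trans (level⁺ H (on-D u p)) (sym p)
      ... | inj₂ p | inj₁ q = trans (refute λ r → 3≢0 (trans (sym (level⁻ H r)) (on-A u q))) (sym p)
        where
        3≢0 : 3 ≢ 0
        3≢0 ()
      ... | inj₂ p | inj₂ q = trans (refute λ r → 3≰2 (subst (_≤ 2) (level⁻ H r) (high u q p))) (sym p)
        where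
        3≰2 : ¬ 3 ≤ 2
        3≰2 (s≤s (s≤s ()))

      middle : ∀ u → u ∉ A → u ∉ D → deg H u ≡ 1 ⊎ deg H u ≡ 2
      middle u p q = aux (deg H u) (low u p q) (high u p q)
        where
        aux : ∀ m → 1 ≤ m → m ≤ 2 → m ≡ 1 ⊎ m ≡ 2
        aux 1 _ _ = inj₁ refl
        aux 2 _ _ = inj₂ refl
        aux (suc (suc (suc m))) _ (s≤s (s≤s ()))

    open Valid

    valid-complement : ∀ {A D H} → Valid A D H → Valid D A (complement H)
    valid-complement {H = H} V = record
      { on-A = λ u p → (linear (deg H u ∷ deg (complement H) u ∷ []) (x1 ≐ con 0) 0
          ( 1 · x0 ⊕ x1 ≐ con 3 ∵ deg-complement H u
          ⨾ 1 ·⁻ x0 ≐ con 3 ∵ on-D V u p))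
      ; on-D = λ u p → (linear (deg H u ∷ deg (complement H) u ∷ []) (x1 ≐ con 3) 0
          ( 1 · x0 ⊕ x1 ≐ con 3 ∵ deg-complement H u
          ⨾ 1 ·⁻ x0 ≐ con 0 ∵ on-A V u p))
      ; low  = λ u p q → (linear (deg H u ∷ deg (complement H) u ∷ []) (con 1 ≼ x1) 0
          ( 1 ·⁻ x0 ⊕ x1 ≐ con 3 ∵ deg-complement H u
          ⨾ 1 · x0 ≼ con 2 ∵ high V u q p))
      ; high = λ u p q → (linear (deg H u ∷ deg (complement H) u ∷ []) (x1 ≼ con 2) 0
          ( 1 · x0 ⊕ x1 ≐ con 3 ∵ deg-complement H u
          ⨾ 1 · con 1 ≼ x0 ∵ low V u q p))
      }

    -- For `complement H` this reads: no edge of H joins two vertices of degree 2.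
    Stuck : Subgraph → Set
    Stuck H = ∀ u v → deg H u ≡ 1 → deg H v ≡ 1 → v ∈ adj u → v ∉ edges H u → ⊥

    raise : ∀ {A D H} → Valid A D H → (∃[ H′ ] Valid A D H′ × size H′ ≡ 2 + size H) ⊎ Stuck H
    raise {A} {D} {H} V with search (level H 1) (λ u → 1 ≤? count ((adj u ∩ ∁ (edges H u)) ∩ level H 1))
    ... | inj₂ none = inj₂ λ u v p q uv no →
        none u (level⁺ H p) (positive _ (∧⁺ (∧⁺ uv (not⁺ no)) (level⁺ H q)))
    ... | inj₁ (u , p , 1≤) with w , q ← inhabited _ 1≤ = inj₁ (add , record
        { on-A = λ x r → trans (deg-same x (off-A r u du) (off-A r w dw)) (on-A V x r)
        ; on-D = λ x r → trans (deg-same x (off-D r u du) (off-D r w dw)) (on-D V x r)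
        ; low  = λ x r s → ≤-trans (low V x r s) (grows x)
        ; high = λ x r s → bound x r s
        } , size-add)
      where
      du : deg H u ≡ 1
      du = level⁻ H p
      dw : deg H w ≡ 1
      dw = level⁻ H (∧⁻ʳ {(adj u ∩ ∁ (edges H u)) w} q)
      open Add H (∧⁻ˡ {adj u w} (∧⁻ˡ q)) (∖⁻ {adj u w} (∧⁻ˡ q))
      off-A : ∀ {x} → x ∈ A → ∀ y → deg H y ≡ 1 → x ≢ y
      off-A r y dy refl with () ← trans (sym (on-A V y r)) dy
      off-D : ∀ {x} → x ∈ D → ∀ y → deg H y ≡ 1 → x ≢ y
      off-D r y dy refl with () ← trans (sym (on-D V y r)) dy
      grows : ∀ x → deg H x ≤ deg add x
      grows x with x ≟ u | x ≟ w
      ... | yes refl | _        = ≤-trans (n≤1+n _) (≤-reflexive (sym deg-u))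
      ... | no _     | yes refl = ≤-trans (n≤1+n _) (≤-reflexive (sym deg-w))
      ... | no a     | no b     = ≤-reflexive (sym (deg-same x a b))
      bound : ∀ x → x ∉ A → x ∉ D → deg add x ≤ 2
      bound x r s with x ≟ u | x ≟ w
      ... | yes refl | _        = ≤-reflexive (trans deg-u (cong suc du))
      ... | no _     | yes refl = ≤-reflexive (trans deg-w (cong suc dw))
      ... | no a     | no b     = ≤-trans (≤-reflexive (deg-same x a b)) (high V x r s)

    lower : ∀ {A D H} → Valid A D H → (∃[ H′ ] Valid A D H′ × size H ≡ 2 + size H′) ⊎ Stuck (complement H)
    lower {H = H} V with raise (valid-complement V)
    ... | inj₂ stuck = inj₂ stuck
    ... | inj₁ (H′ , V′ , eq) = inj₁ (complement H′ , valid-complement V′ ,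
      (linear (size H ∷ size (complement H) ∷ size H′ ∷ size (complement H′) ∷ n ∷ [])
          (x0 ≐ con 2 ⊕ x3) 0
          ( 1 · x0 ⊕ x1 ≐ 3 ⊗ x4 ∵ size-complement H
          ⨾ 1 ·⁻ x2 ⊕ x3 ≐ 3 ⊗ x4 ∵ size-complement H′
          ⨾ 1 · x2 ≐ con 2 ⊕ x1 ∵ eq)))

    -- Count the unused edges at vertices of degree 1: none joins two of them or meets D.
    stuck-bound : ∀ {A D H} → Valid A D H → Stuck H →
                  2 * count (level H 1) ≤ E adj A (∁ A) + count (level H 2)
    stuck-bound {A} {D} {H} V stuck =
      (linear (count B ∷ count C ∷ E adj A (∁ A) ∷ ∑∈ B (λ u → count (out u ∩ A) + count (out u ∩ C)) ∷ E
          out B A ∷ E out B C ∷ E out A B ∷ E out C B ∷ ∑∈ B (λ _ → 2) ∷ ∑∈ C (λ _ → 1) ∷ [])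
          (2 ⊗ x0 ≼ x2 ⊕ x1) 0
          ( 1 ·⁻ x8 ≐ 2 ⊗ x0 ∵ ∑-const B 2
          ⨾ 1 · x8 ≼ x3 ∵ ∑-mono B cover
          ⨾ 1 · x3 ≐ x4 ⊕ x5 ∵ ∑-+ B _ _
          ⨾ 1 · x4 ≐ x6 ∵ E-sym out out-sym B A
          ⨾ 1 · x5 ≐ x7 ∵ E-sym out out-sym B C
          ⨾ 1 · x6 ≼ x2 ∵ ∑-mono A (λ u p → count-⊆ {P = out u ∩ B} (λ v q → ∧⁺ (∧⁻ˡ {adj u v} (∧⁻ˡ q))
              (not⁺ (B∉A (∧⁻ʳ {out u v} q)))))
          ⨾ 1 · x7 ≼ x9 ∵ ∑-mono C (λ u p → ≤-trans (count-⊆ {P = out u ∩ B} {out u} λ v → ∧⁻ˡ)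
              (≤-reflexive (deg-complement′ H (level⁻ H p))))
          ⨾ 1 · x9 ≐ 1 ⊗ x1 ∵ ∑-const C 1))
      where
      B = level H 1
      C = level H 2
      out : Fin n → Sub n
      out = rel (complement H)
      out-sym : ∀ u v → out u v ≡ out v u
      out-sym = rel-sym (complement H)
      B∉A : ∀ {v} → v ∈ B → v ∉ A
      B∉A {v} p = refute λ q → 0≢1 (trans (sym (on-A V v q)) (level⁻ H p))
        where
        0≢1 : 0 ≢ 1
        0≢1 ()
      split : ∀ u v → u ∈ B → v ∈ out u → v ∈ A ⊎ v ∈ C
      split u v p q with v ∈? A | v ∈? D
      ... | inj₁ r | _      = inj₁ r
      ... | inj₂ r | inj₁ s = ⊥-elim (n≮0 (subst (1 ≤_) (deg-complement′ H (on-D V v s))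
              (positive (out v) (trans (out-sym v u) q))))
      ... | inj₂ r | inj₂ s with middle V v r s
      ...   | inj₂ dv = inj₂ (level⁺ H dv)
      ...   | inj₁ dv = ⊥-elim (stuck u v (level⁻ H p) dv (∧⁻ˡ q) (∖⁻ {adj u v} q))
      cover : ∀ u → u ∈ B → 2 ≤ count (out u ∩ A) + count (out u ∩ C)
      cover u p = linear (deg H u ∷ deg (complement H) u ∷ count ((out u ∩ A) ∪ (out u ∩ C)) ∷ count
          (out u ∩ A) ∷ count (out u ∩ C) ∷ [])
          (con 2 ≼ x3 ⊕ x4) 0
          ( 1 ·⁻ x0 ⊕ x1 ≐ con 3 ∵ deg-complement H u
          ⨾ 1 · x0 ≐ con 1 ∵ level⁻ H p
          ⨾ 1 · x1 ≼ x2 ∵ count-⊆ (λ v q → both v q (split u v p q))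
          ⨾ 1 · x2 ≐ x3 ⊕ x4 ∵ count-∪ (out u ∩ A) (out u ∩ C) (λ v q → refute λ r →
              0≢2 (trans (sym (on-A V v (∧⁻ʳ {out u v} q))) (level⁻ H (∧⁻ʳ {out u v} r)))))
        where
        0≢2 : 0 ≢ 2
        0≢2 ()
        both : ∀ v → v ∈ out u → v ∈ A ⊎ v ∈ C → v ∈ (out u ∩ A) ∪ (out u ∩ C)
        both v q (inj₁ r) = ∨⁺ˡ (∧⁺ q r)
        both v q (inj₂ r) = ∨⁺ʳ {(out u ∩ A) v} (∧⁺ q r)

    -- Before the switches x, y, z, a, b, δ have degrees 2, 2, 2, 0, 1, 3. Removing xδ and zb and
    -- adding ya lets b replace a at degree 0 and y replace δ at degree 3.
    record Switched (H : Subgraph) (x y z a b δ : Fin n) : Set where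
      field
        H′   : Subgraph
        dx   : deg H′ x ≡ 1
        dy   : deg H′ y ≡ 3
        dz   : deg H′ z ≡ 1
        da   : deg H′ a ≡ 1
        db   : deg H′ b ≡ 0
        dδ   : deg H′ δ ≡ 2
        same : ∀ v → v ≢ x → v ≢ y → v ≢ z → v ≢ a → v ≢ b → v ≢ δ → deg H′ v ≡ deg H v
        smaller : size H ≡ 2 + size H′

    ≢-by-deg : ∀ H {u v j k} → deg H u ≡ j → deg H v ≡ k → j ≢ k → u ≢ v
    ≢-by-deg H p q j≢k refl = j≢k (trans (sym p) q)

    switch : ∀ H {x y z a b δ} → deg H x ≡ 2 → deg H y ≡ 2 → deg H z ≡ 2 → deg H a ≡ 0 → deg H b ≡ 1 →
        deg H δ ≡ 3 →
      x ≢ y → z ≢ x → z ≢ y → δ ∈ rel H x → a ∈ adj y → a ∉ edges H y → b ∈ rel H z →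
          Switched H x y z a b δ
    switch H {x} {y} {z} {a} {b} {δ} dx dy dz da db dδ x≢y z≢x z≢y xδ ya ¬ya zb = record
      { H′ = S₃.remove
      ; dx = trans (S₃.deg-same x (z≢x ∘ sym) x≢b)
          (trans (S₂.deg-same x x≢y x≢a) (suc-injective (trans (sym S₁.deg-u) dx)))
      ; dδ = trans (S₃.deg-same δ (z≢δ ∘ sym) δ≢b) (trans (S₂.deg-same δ (y≢δ ∘ sym) δ≢a)
          (suc-injective (trans (sym S₁.deg-w) dδ)))
      ; dy = trans (S₃.deg-same y (z≢y ∘ sym) y≢b)
          (trans S₂.deg-u (cong suc (trans (S₁.deg-same y (x≢y ∘ sym) y≢δ) dy)))
      ; da = trans (S₃.deg-same a (z≢a ∘ sym) a≢b)
          (trans S₂.deg-w (cong suc (trans (S₁.deg-same a (x≢a ∘ sym) (δ≢a ∘ sym)) da)))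
      ; dz = suc-injective (trans (sym S₃.deg-u)
          (trans (S₂.deg-same z z≢y z≢a) (trans (S₁.deg-same z z≢x z≢δ) dz)))
      ; db = suc-injective (trans (sym S₃.deg-w) (trans (S₂.deg-same b (y≢b ∘ sym) (a≢b ∘ sym))
          (trans (S₁.deg-same b (x≢b ∘ sym) (δ≢b ∘ sym)) db)))
      ; same = λ v v≢x v≢y v≢z v≢a v≢b v≢δ →
          trans (S₃.deg-same v v≢z v≢b) (trans (S₂.deg-same v v≢y v≢a) (S₁.deg-same v v≢x v≢δ))
      ; smaller = linear (size H ∷ size S₁.remove ∷ size S₂.add ∷ size S₃.remove ∷ []) (x0 ≐ con 2 ⊕ x3) 0
          ( 1 · x0 ≐ con 2 ⊕ x1 ∵ S₁.size-remove
          ⨾ 1 ·⁻ x2 ≐ con 2 ⊕ x1 ∵ S₂.size-add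
          ⨾ 1 · x2 ≐ con 2 ⊕ x3 ∵ S₃.size-remove)
      }
      where
      y≢δ : y ≢ δ
      y≢δ = ≢-by-deg H dy dδ λ ()
      z≢a : z ≢ a
      z≢a = ≢-by-deg H dz da λ ()
      z≢δ : z ≢ δ
      z≢δ = ≢-by-deg H dz dδ λ ()
      x≢a : x ≢ a
      x≢a = ≢-by-deg H dx da λ ()
      x≢b : x ≢ b
      x≢b = ≢-by-deg H dx db λ ()
      y≢b : y ≢ b
      y≢b = ≢-by-deg H dy db λ ()
      δ≢a : δ ≢ a
      δ≢a = ≢-by-deg H dδ da λ ()
      δ≢b : δ ≢ b
      δ≢b = ≢-by-deg H dδ db λ ()
      a≢b : a ≢ b
      a≢b = ≢-by-deg H da db λ ()
      module S₁ = Remove H (∧⁻ˡ {adj x δ} xδ) (∧⁻ʳ {adj x δ} xδ)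
      module S₂ = Add S₁.remove ya (trans (S₁.kept {y} {a} (x≢y ∘ sym) y≢δ) ¬ya)
      module S₃ = Remove S₂.add (∧⁻ˡ {adj z b} zb)
          (trans (S₂.kept {z} {b} z≢y z≢a) (trans (S₁.kept {z} {b} z≢x z≢δ) (∧⁻ʳ {adj z b} zb)))

    data Place (x y z a b δ v : Fin n) : Set where
      at-x : v ≡ x → Place x y z a b δ v
      at-y : v ≡ y → Place x y z a b δ v
      at-z : v ≡ z → Place x y z a b δ v
      at-a : v ≡ a → Place x y z a b δ v
      at-b : v ≡ b → Place x y z a b δ v
      at-δ : v ≡ δ → Place x y z a b δ v
      away : v ≢ x → v ≢ y → v ≢ z → v ≢ a → v ≢ b → v ≢ δ → Place x y z a b δ v

    place : ∀ x y z a b δ v → Place x y z a b δ v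
    place x y z a b δ v with v ≟ x
    ... | yes p = at-x p
    ... | no v≢x with v ≟ y
    ... | yes p = at-y p
    ... | no v≢y with v ≟ z
    ... | yes p = at-z p
    ... | no v≢z with v ≟ a
    ... | yes p = at-a p
    ... | no v≢a with v ≟ b
    ... | yes p = at-b p
    ... | no v≢b with v ≟ δ
    ... | yes p = at-δ p
    ... | no v≢δ = away v≢x v≢y v≢z v≢a v≢b v≢δ

    -- Level k of the new subgraph is P with `out` replaced by `inn`: by `to` and `from` no other
    -- vertex enters or leaves it.
    switched-level : ∀ {H x y z a b δ} (S : Switched H x y z a b δ) {k} (P : Sub n) (out inn : Fin n) →
      (∀ v → level H k v ≡ P v) → out ∈ P → deg (Switched.H′ S) inn ≡ k → deg H inn ≢ k →
      (∀ v → Place x y z a b δ v → v ≢ out → v ≢ inn → deg (Switched.H′ S) v ≡ k → deg H v ≡ k) →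
      (∀ v → Place x y z a b δ v → v ≢ out → v ≢ inn → deg H v ≡ k → deg (Switched.H′ S) v ≡ k) →
      deg (Switched.H′ S) out ≢ k → count (level (Switched.H′ S) k) ≡ count P
    switched-level {H} {x} {y} {z} {a} {b} {δ} S {k} P out inn P≡ out∈P inn-in inn-new to from out-gone =
      trans (count-cong λ v → ⇔⇒≡ (λ p → forward v (level⁻ H′ p))
          (λ p → level⁺ H′ (backward v (∨⁻ {(P ∖ ⁅ out ⁆) v} p))))
        (count-exchange P out∈P (refute λ p → inn-new (level⁻ H (trans (P≡ inn) p))))
      where
      open Switched S using (H′)
      forward : ∀ v → deg H′ v ≡ k → v ∈ (P ∖ ⁅ out ⁆) ∪ ⁅ inn ⁆
      forward v p with v ≟ inn
      ... | yes refl = ∨⁺ʳ {(P ∖ ⁅ out ⁆) v} (⁅⁆-refl v)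
      ... | no v≢inn with v ≟ out
      ...   | yes refl  = ⊥-elim (out-gone p)
      ...   | no v≢out = ∨⁺ˡ
          (∖⁺ (trans (sym (P≡ v)) (level⁺ H (to v (place x y z a b δ v) v≢out v≢inn p))) (≢⇒∉⁅⁆ v≢out))
      backward : ∀ v → v ∈ P ∖ ⁅ out ⁆ ⊎ v ∈ ⁅ inn ⁆ → deg H′ v ≡ k
      backward v (inj₂ p) = trans (cong (deg H′) (⁅⁆⇒≡ p)) inn-in
      backward v (inj₁ p) = from v (place x y z a b δ v) (λ { refl → clash (⁅⁆-refl v) (∖⁻ {P v} p) })
        (λ { refl → inn-new (level⁻ H (trans (P≡ v) (∧⁻ˡ p))) }) (level⁻ H (trans (P≡ v) (∧⁻ˡ p)))

    module SwitchCount {H x y z a b δ} (S : Switched H x y z a b δ) (dx : deg H x ≡ 2) (dy : deg H y ≡ 2)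
        (dz : deg H z ≡ 2)
      (da : deg H a ≡ 0) (db : deg H b ≡ 1) (dδ : deg H δ ≡ 3) where
      private module S = Switched S

      never : ∀ {j k v w} {A : Set} (f : Fin n → ℕ) → f w ≡ j → v ≡ w → f v ≡ k → j ≢ k → A
      never f p refl q j≢k = ⊥-elim (j≢k (trans (sym p) q))

      zeros : ∀ A → (∀ v → level H 0 v ≡ A v) → a ∈ A → count (level S.H′ 0) ≡ count A
      zeros A A≡ a∈A = switched-level S A a b A≡ a∈A S.db (λ p → 1≢0 (trans (sym db) p)) to from
          (λ p → 1≢0 (trans (sym S.da) p))
        where
        1≢0 : 1 ≢ 0
        1≢0 ()
        to : ∀ v → Place x y z a b δ v → v ≢ a → v ≢ b → deg S.H′ v ≡ 0 → deg H v ≡ 0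
        to v (at-x p) _ _ q = never (deg S.H′) S.dx p q λ ()
        to v (at-y p) _ _ q = never (deg S.H′) S.dy p q λ ()
        to v (at-z p) _ _ q = never (deg S.H′) S.dz p q λ ()
        to v (at-a p) r _ _ = ⊥-elim (r p)
        to v (at-b p) _ r _ = ⊥-elim (r p)
        to v (at-δ p) _ _ q = never (deg S.H′) S.dδ p q λ ()
        to v (away p₁ p₂ p₃ p₄ p₅ p₆) _ _ q = trans (sym (S.same v p₁ p₂ p₃ p₄ p₅ p₆)) q
        from : ∀ v → Place x y z a b δ v → v ≢ a → v ≢ b → deg H v ≡ 0 → deg S.H′ v ≡ 0
        from v (at-x p) _ _ q = never (deg H) dx p q λ ()
        from v (at-y p) _ _ q = never (deg H) dy p q λ ()
        from v (at-z p) _ _ q = never (deg H) dz p q λ ()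
        from v (at-a p) r _ _ = ⊥-elim (r p)
        from v (at-b p) _ r _ = ⊥-elim (r p)
        from v (at-δ p) _ _ q = never (deg H) dδ p q λ ()
        from v (away p₁ p₂ p₃ p₄ p₅ p₆) _ _ q = trans (S.same v p₁ p₂ p₃ p₄ p₅ p₆) q

      threes : ∀ D → (∀ v → level H 3 v ≡ D v) → δ ∈ D → count (level S.H′ 3) ≡ count D
      threes D D≡ δ∈D = switched-level S D δ y D≡ δ∈D S.dy (λ p → 2≢3 (trans (sym dy) p)) to from
          (λ p → 2≢3 (trans (sym S.dδ) p))
        where
        2≢3 : 2 ≢ 3
        2≢3 ()
        to : ∀ v → Place x y z a b δ v → v ≢ δ → v ≢ y → deg S.H′ v ≡ 3 → deg H v ≡ 3
        to v (at-x p) _ _ q = never (deg S.H′) S.dx p q λ ()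
        to v (at-y p) _ r _ = ⊥-elim (r p)
        to v (at-z p) _ _ q = never (deg S.H′) S.dz p q λ ()
        to v (at-a p) _ _ q = never (deg S.H′) S.da p q λ ()
        to v (at-b p) _ _ q = never (deg S.H′) S.db p q λ ()
        to v (at-δ p) r _ _ = ⊥-elim (r p)
        to v (away p₁ p₂ p₃ p₄ p₅ p₆) _ _ q = trans (sym (S.same v p₁ p₂ p₃ p₄ p₅ p₆)) q
        from : ∀ v → Place x y z a b δ v → v ≢ δ → v ≢ y → deg H v ≡ 3 → deg S.H′ v ≡ 3
        from v (at-x p) _ _ q = never (deg H) dx p q λ ()
        from v (at-y p) _ r _ = ⊥-elim (r p)
        from v (at-z p) _ _ q = never (deg H) dz p q λ ()
        from v (at-a p) _ _ q = never (deg H) da p q λ ()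
        from v (at-b p) _ _ q = never (deg H) db p q λ ()
        from v (at-δ p) r _ _ = ⊥-elim (r p)
        from v (away p₁ p₂ p₃ p₄ p₅ p₆) _ _ q = trans (S.same v p₁ p₂ p₃ p₄ p₅ p₆) q

    -- Three disjoint edge switches that turn two more vertices of degree 2 into
    -- vertices of degree 1: x drops an edge to D, y gains an edge to A, and an
    -- edge between degrees 2 and 1 is dropped. This changes A and D but not their sizes.
    module Exchange {A D : Sub n} {H : Subgraph} (V : Valid A D H) (stuck : Stuck (complement H))
      (room : suc (E adj D (∁ D)) ≤ 2 * count (level H 2))
      (excess : count (level H 1) + 3 ≤ count (level H 2))
      (uniq : ∀ u v → u ∉ A → u ∉ D → v ∉ A → v ∉ D → d A u ≡ 0 → d A v ≡ 0 → 2 ≤ d D u → 2 ≤ d D v →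
          u ≡ v) where

      private
        B = level H 1
        C = level H 2
        r = rel H

      edge-to-D : ∀ {u v} → v ∈ adj u → v ∈ D → v ∈ edges H u
      edge-to-D {u} {v} uv v∈D = trans (edges-sym H u v) (∧⁻ʳ {adj v u}
        (⊆-count⇒⊇ (r v) (adj v) (λ w → ∧⁻ˡ) (≤-reflexive (trans (cubic v) (sym (on-D V v v∈D)))) u
            (adj⁻¹ uv)))

      A-isolated : ∀ {u v} → v ∈ adj u → v ∈ A → v ∉ edges H u
      A-isolated {u} {v} uv v∈A = refute λ p → clash (∧⁺ (adj⁻¹ uv) (trans (edges-sym H v u) p))
          (absent (r v) (on-A V v v∈A) u)

      C∉A : ∀ {u} → u ∈ C → u ∉ A
      C∉A {u} p = refute λ q → ≢-by-deg H (on-A V u q) (level⁻ H p) (λ ()) refl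

      C∉D : ∀ {u} → u ∈ C → u ∉ D
      C∉D {u} p = refute λ q → ≢-by-deg H (on-D V u q) (level⁻ H p) (λ ()) refl

      -- An edge of H at u cannot end in A, whose vertices are isolated in H, nor, by `stuck`, at
      -- another vertex of degree 2.
      cover : ∀ u → u ∈ C → 2 ≤ count (r u ∩ D) + count (r u ∩ B)
      cover u p = ≤-trans (≤-reflexive (sym (level⁻ H p)))
          (≤-trans (count-⊆ {P = r u} {(r u ∩ D) ∪ (r u ∩ B)} split)
        (≤-reflexive (count-∪ (r u ∩ D) (r u ∩ B) λ v q → refute λ s →
          ≢-by-deg H (on-D V v (∧⁻ʳ {r u v} q)) (level⁻ H (∧⁻ʳ {r u v} s)) (λ ()) refl)))
        where
        split : ∀ v → v ∈ r u → v ∈ (r u ∩ D) ∪ (r u ∩ B)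
        split v q with v ∈? A | v ∈? D
        ... | _      | inj₁ s = ∨⁺ˡ (∧⁺ q s)
        ... | inj₁ s | inj₂ _ = clash (∧⁻ʳ {adj u v} q) (A-isolated (∧⁻ˡ q) s)
        ... | inj₂ s | inj₂ t with middle V v s t
        ...   | inj₁ dv = ∨⁺ʳ {(r u ∩ D) v} (∧⁺ q (level⁺ H dv))
        ...   | inj₂ dv = ⊥-elim (stuck u v (deg-complement′ H (level⁻ H p)) (deg-complement′ H dv)
            (∧⁻ˡ q)
                  (cong not (∧⁻ʳ {adj u v} q)))

      E-CD : E r C D ≤ E adj D (∁ D)
      E-CD = ≤-trans (≤-reflexive (E-sym r (rel-sym H) C D)) (∑-mono D λ u _ → count-⊆ {P = r u ∩ C}
        λ v q → ∧⁺ (∧⁻ˡ {adj u v} (∧⁻ˡ q)) (not⁺ (C∉D (∧⁻ʳ {r u v} q))))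

      C₂ : Sub n
      C₂ = C where? (λ u → 2 ≤? d D u)

      C₂⇒2≤ : ∀ {u} → u ∈ C₂ → 2 ≤ d D u
      C₂⇒2≤ p = where⁻ C (λ u → 2 ≤? d D u) p

      -- A vertex of C outside `C₂` sends an edge of H to B, and each vertex of B receives only one;
      -- hence `C₂` has at least |C| - |B| elements.
      three-C₂ : 3 ≤ count C₂
      three-C₂ = linear (count B ∷ count C ∷ count C₂ ∷ E r C B ∷ E r B C ∷ ∑∈ C
          (λ u → count (r u ∩ B) + ind (C₂ u)) ∷ ∑∈ C (ind ∘ C₂) ∷ ∑∈ full (ind ∘ C₂) ∷ ∑∈ C
          (λ _ → 1) ∷ ∑∈ B (λ _ → 1) ∷ [])
          (con 3 ≼ x2) 0
          ( 1 · x0 ⊕ con 3 ≼ x1 ∵ excess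
          ⨾ 1 ·⁻ x8 ≐ 1 ⊗ x1 ∵ ∑-const C 1
          ⨾ 1 · x8 ≼ x5 ∵ ∑-mono C (λ u p → aux u p (C₂ u) refl)
          ⨾ 1 · x5 ≐ x3 ⊕ x6 ∵ ∑-+ C _ _
          ⨾ 1 · x3 ≐ x4 ∵ E-sym r (rel-sym H) C B
          ⨾ 1 · x4 ≼ x9 ∵ ∑-mono B (λ u p → ≤-trans (count-⊆ {P = r u ∩ C} {r u} λ v → ∧⁻ˡ)
              (≤-reflexive (level⁻ H p)))
          ⨾ 1 · x9 ≐ 1 ⊗ x0 ∵ ∑-const B 1
          ⨾ 1 · x6 ≼ x7 ∵ ∑-⊆ C full _ (λ _ _ → refl)
          ⨾ 1 · x7 ≐ x2 ∵ ∑-ind C₂)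
        where
        aux : ∀ u → u ∈ C → ∀ t → C₂ u ≡ t → 1 ≤ count (r u ∩ B) + ind t
        aux u p true  _ = m≤n+m 1 _
        aux u p false q = linear (count (r u ∩ D) ∷ count (r u ∩ B) ∷ d D u ∷ []) (con 1 ≼ x1 ⊕ con 0) 0
            ( 1 · con 2 ≼ x0 ⊕ x1 ∵ cover u p
            ⨾ 1 · x0 ≼ x2 ∵ count-⊆ {P = r u ∩ D} (λ v s → ∧⁺ (∧⁻ˡ {adj u v} (∧⁻ˡ s)) (∧⁻ʳ {r u v} s))
            ⨾ 1 · x2 ≼ con 1 ∵ few)
          where
          few : d D u ≤ 1
          few = ≤-pred (≰⇒> λ 2≤ → clash (where⁺ C (λ w → 2 ≤? d D w) p 2≤) q)

      good : Sub n
      good = C₂ where? (λ u → 1 ≤? d A u)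

      -- By `uniq`, at most one of the three vertices of `C₂` has no neighbour in A.
      two-good : 2 ≤ count good
      two-good = linear (count C₂ ∷ count (C₂ ∩ good) ∷ count (C₂ ∖ good) ∷ count good ∷ []) (con 2 ≼ x3)
          0
          ( 1 · con 3 ≼ x0 ∵ three-C₂
          ⨾ 1 · x0 ≐ x1 ⊕ x2 ∵ count-split C₂ good
          ⨾ 1 · x1 ≼ x3 ∵ count-⊆ {P = C₂ ∩ good} (λ v → ∧⁻ʳ {C₂ v})
          ⨾ 1 · x2 ≼ con 1 ∵ count≤1 (C₂ ∖ good) (λ u v p q → uniq u v (C∉A (inC p)) (C∉D (inC p))
              (C∉A (inC q)) (C∉D (inC q)) (lone p) (lone q) (C₂⇒2≤ (∧⁻ˡ p)) (C₂⇒2≤ (∧⁻ˡ q))))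
        where
        inC : ∀ {u} → u ∈ C₂ ∖ good → u ∈ C
        inC {u} p = ∧⁻ˡ {C u} (∧⁻ˡ p)
        lone : ∀ {u} → u ∈ C₂ ∖ good → d A u ≡ 0
        lone {u} p = n<1⇒n≡0 (≰⇒> λ 1≤ → clash (where⁺ C₂ (λ w → 1 ≤? d A w) (∧⁻ˡ p) 1≤) (∖⁻ {C₂ u} p))

      -- H contains every edge at D, so both edges of H at u end there. This later keeps z apart
      -- from x and y.
      C₂-no-B : ∀ {u} → u ∈ C₂ → count (r u ∩ B) ≡ 0
      C₂-no-B {u} p = n≤0⇒n≡0
          (linear (count (r u ∩ D) ∷ count (r u ∩ B) ∷ count ((r u ∩ D) ∪ (r u ∩ B)) ∷ d D u ∷ deg H
          u ∷ [])
          (x1 ≼ con 0) 0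
          ( 1 ·⁻ x2 ≐ x0 ⊕ x1 ∵ count-∪ (r u ∩ D) (r u ∩ B)
              (λ v q → refute λ s → ≢-by-deg H (on-D V v (∧⁻ʳ {r u v} q)) (level⁻ H (∧⁻ʳ {r u v} s))
              (λ ()) refl)
          ⨾ 1 · x2 ≼ x4 ∵ count-⊆ {P = (r u ∩ D) ∪ (r u ∩ B)} {r u} (λ v q → back v (∨⁻ {(r u ∩ D) v} q))
          ⨾ 1 · x4 ≐ con 2 ∵ level⁻ H (∧⁻ˡ {C u} p)
          ⨾ 1 · x3 ≼ x0 ∵ count-⊆ {P = adj u ∩ D}
              (λ v q → ∧⁺ (∧⁺ (∧⁻ˡ {adj u v} q) (edge-to-D (∧⁻ˡ q) (∧⁻ʳ {adj u v} q))) (∧⁻ʳ {adj u v} q))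
          ⨾ 1 · con 2 ≼ x3 ∵ C₂⇒2≤ p))
        where
        back : ∀ v → v ∈ r u ∩ D ⊎ v ∈ r u ∩ B → v ∈ r u
        back v (inj₁ q) = ∧⁻ˡ q
        back v (inj₂ q) = ∧⁻ˡ q

      -- Otherwise every vertex of C sends both its edges of H to D, more edges than `room` leaves
      -- at the boundary of D.
      mixed-edge : ∃[ z ] z ∈ C × 1 ≤ count (r z ∩ B)
      mixed-edge with search C (λ u → 1 ≤? count (r u ∩ B))
      ... | inj₁ p = p
      ... | inj₂ none = 1≰0 (linear (count C ∷ ∑∈ C (λ _ → 2) ∷ E r C D ∷ E adj D (∁ D) ∷ [])
          (con 1 ≼ con 0) 0
          ( 1 · con 1 ⊕ x3 ≼ 2 ⊗ x0 ∵ room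
          ⨾ 1 ·⁻ x1 ≐ 2 ⊗ x0 ∵ ∑-const C 2
          ⨾ 1 · x1 ≼ x2 ∵ ∑-mono C (λ u p → bound u p)
          ⨾ 1 · x2 ≼ x3 ∵ E-CD))
        where
        bound : ∀ u → u ∈ C → 2 ≤ count (r u ∩ D)
        bound u p = linear (count (r u ∩ D) ∷ count (r u ∩ B) ∷ []) (con 2 ≼ x0) 0
            ( 1 · con 2 ≼ x0 ⊕ x1 ∵ cover u p
            ⨾ 1 · x1 ≼ con 0 ∵ ≤-pred (≰⇒> (none u p)))

      Exchanged : Set
      Exchanged = ∃[ H′ ] count (level H′ 0) ≡ count A × count (level H′ 3) ≡ count D ×
          size H ≡ 2 + size H′

      exchange-at : ∀ {x y z a b δ} → x ∈ good → y ∈ good → y ≢ x → z ∈ C → z ≢ x → z ≢ y →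
        δ ∈ adj x → δ ∈ D → a ∈ adj y → a ∈ A → b ∈ r z → b ∈ B → Exchanged
      exchange-at {x} {y} {z} {a} {b} {δ} px py y≢x z∈C z≢x z≢y xδ δ∈D ya a∈A zb b∈B =
        Switched.H′ S , SwitchCount.zeros S dx dy dz da db dδ A (A≡ V) a∈A , SwitchCount.threes S dx dy dz
            da db dδ D (D≡ V) δ∈D , Switched.smaller S
        where
        in-C : ∀ {w} → w ∈ good → w ∈ C
        in-C {w} p = ∧⁻ˡ {C w} (∧⁻ˡ p)
        dx = level⁻ H (in-C px)
        dy = level⁻ H (in-C py)
        dz = level⁻ H z∈C
        da = on-A V a a∈A
        db = level⁻ H b∈B
        dδ = on-D V δ δ∈D
        S : Switched H x y z a b δ
        S = switch H dx dy dz da db dδ (y≢x ∘ sym) z≢x z≢y (∧⁺ xδ (edge-to-D xδ δ∈D)) ya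
            (A-isolated ya a∈A) zb

      exchange : Exchanged
      exchange = pick-x (inhabited good (≤-trans (s≤s z≤n) two-good))
        where
        avoid : ∀ {z w} → 1 ≤ count (r z ∩ B) → w ∈ C₂ → z ≢ w
        avoid 1≤z p refl = 1≰0 (subst (1 ≤_) (C₂-no-B p) 1≤z)
        pick-z : ∀ {x y} → x ∈ good → y ∈ good → y ≢ x → (∃[ z ] z ∈ C × 1 ≤ count (r z ∩ B)) →
                 (∃[ δ ] δ ∈ adj x × δ ∈ D) → (∃[ a ] a ∈ adj y × a ∈ A) → Exchanged
        pick-z px py y≢x (z , z∈C , 1≤z) (δ , xδ , δ∈D) (a , ya , a∈A) with inhabited (r z ∩ B) 1≤z
        ... | b , pb = exchange-at px py y≢x z∈C (avoid 1≤z (∧⁻ˡ px)) (avoid 1≤z (∧⁻ˡ py)) xδ δ∈D ya a∈A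
            (∧⁻ˡ pb) (∧⁻ʳ {r z b} pb)
        pick-y : ∀ {x} → x ∈ good → (∃[ y ] y ∈ good × y ≢ x) → Exchanged
        pick-y {x} px (y , py , y≢x) = pick-z px py y≢x mixed-edge
          (nbr D x (≤-trans (s≤s z≤n) (C₂⇒2≤ (∧⁻ˡ px)))) (nbr A y (where⁻ C₂ (λ u → 1 ≤? d A u) py))
        pick-x : (∃[ x ] x ∈ good) → Exchanged
        pick-x (x , px) = pick-y px (other good x two-good)

    -- Reaching the prescribed degree sum

    Balanced : ℕ → ℕ → Set
    Balanced q q′ = ∃[ H ] count (level H 0) ≡ q × count (level H 3) ≡ q′ × size H ≡ 2 * q + 4 * q′

    -- The number of vertices and the degree sum are two linear equations for the two remaining
    -- counts.
    balanced-levels : ∀ {q q′} → n ≡ 2 * q + 2 * q′ → (B : Balanced q q′) →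
      count (level (proj₁ B) 1) ≡ q′ × count (level (proj₁ B) 2) ≡ q
    balanced-levels {q} {q′} n≡ (H , zs , ts , sz) =
      (linear (n ∷ q ∷ q′ ∷ count (level H 0) ∷ count (level H 1) ∷ count (level H 2) ∷ count
          (level H 3) ∷ size H ∷ [])
          (x4 ≐ x2) 0
          ( 2 · x3 ⊕ x4 ⊕ x5 ⊕ x6 ≐ x0 ∵ levels H
          ⨾ 1 · x7 ≐ x4 ⊕ 2 ⊗ x5 ⊕ 3 ⊗ x6 ∵ size-levels H
          ⨾ 2 · x0 ≐ 2 ⊗ x1 ⊕ 2 ⊗ x2 ∵ n≡
          ⨾ 2 ·⁻ x3 ≐ x1 ∵ zs
          ⨾ 1 · x6 ≐ x2 ∵ ts
          ⨾ 1 ·⁻ x7 ≐ 2 ⊗ x1 ⊕ 4 ⊗ x2 ∵ sz)) ,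
      (linear (n ∷ q ∷ q′ ∷ count (level H 0) ∷ count (level H 1) ∷ count (level H 2) ∷ count
          (level H 3) ∷ size H ∷ [])
          (x5 ≐ x1) 0
          ( 1 ·⁻ x3 ⊕ x4 ⊕ x5 ⊕ x6 ≐ x0 ∵ levels H
          ⨾ 1 ·⁻ x7 ≐ x4 ⊕ 2 ⊗ x5 ⊕ 3 ⊗ x6 ∵ size-levels H
          ⨾ 1 ·⁻ x0 ≐ 2 ⊗ x1 ⊕ 2 ⊗ x2 ∵ n≡
          ⨾ 1 · x3 ≐ x1 ∵ zs
          ⨾ 2 ·⁻ x6 ≐ x2 ∵ ts
          ⨾ 1 · x7 ≐ 2 ⊗ x1 ⊕ 4 ⊗ x2 ∵ sz))

    module _ {A D : Sub n} {q q′ : ℕ} (|A| : count A ≡ q) (|D| : count D ≡ q′) (n≡ : n ≡ 2 * q + 2 * q′)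
        (q≤q′ : q ≤ q′) (q′≤1+q : q′ ≤ 1 + q)
      (∂A : E adj A (∁ A) ≤ q + 4) where

      module _ {H} (V : Valid A D H) where
        middle-levels : count (level H 1) + count (level H 2) ≡ q + q′
        middle-levels = linear (n ∷ q ∷ q′ ∷ count (level H 0) ∷ count (level H 1) ∷ count
            (level H 2) ∷ count (level H 3) ∷ count A ∷ count D ∷ [])
            (x4 ⊕ x5 ≐ x1 ⊕ x2) 0
            ( 1 · x3 ⊕ x4 ⊕ x5 ⊕ x6 ≐ x0 ∵ levels H
            ⨾ 1 · x0 ≐ 2 ⊗ x1 ⊕ 2 ⊗ x2 ∵ n≡
            ⨾ 1 ·⁻ x3 ≐ x7 ∵ count-cong (A≡ V)
            ⨾ 1 ·⁻ x6 ≐ x8 ∵ count-cong (D≡ V)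
            ⨾ 1 ·⁻ x7 ≐ x1 ∵ |A|
            ⨾ 1 ·⁻ x8 ≐ x2 ∵ |D|)

        size-by-twos : size H ≡ count (level H 2) + q + 4 * q′
        size-by-twos = linear (size H ∷ q ∷ q′ ∷ count (level H 1) ∷ count (level H 2) ∷ count
            (level H 3) ∷ count D ∷ [])
            (x0 ≐ x4 ⊕ x1 ⊕ 4 ⊗ x2) 0
            ( 1 · x0 ≐ x3 ⊕ 2 ⊗ x4 ⊕ 3 ⊗ x5 ∵ size-levels H
            ⨾ 1 · x3 ⊕ x4 ≐ x1 ⊕ x2 ∵ middle-levels
            ⨾ 3 · x5 ≐ x6 ∵ count-cong (D≡ V)
            ⨾ 3 · x6 ≐ x2 ∵ |D|)

      up : ∀ k H → Valid A D H → size H + 2 * k ≡ 2 * q + 4 * q′ → Balanced q q′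
      up zero H V sz = H , trans (count-cong (A≡ V)) |A| , trans (count-cong (D≡ V)) |D| ,
          trans (sym (+-identityʳ _)) sz
      up (suc k) H V sz = step (raise V)
        where
        step : (∃[ H′ ] Valid A D H′ × size H′ ≡ 2 + size H) ⊎ Stuck H → Balanced q q′
        step (inj₁ (H′ , V′ , eq)) = up k H′ V′ (linear (size H ∷ size H′ ∷ k ∷ q ∷ q′ ∷ 2 * suc k ∷ [])
            (x1 ⊕ 2 ⊗ x2 ≐ 2 ⊗ x3 ⊕ 4 ⊗ x4) 0
            ( 1 · x0 ⊕ x5 ≐ 2 ⊗ x3 ⊕ 4 ⊗ x4 ∵ sz
            ⨾ 1 · x1 ≐ con 2 ⊕ x0 ∵ eq
            ⨾ 1 ·⁻ x5 ≐ con 2 ⊕ 2 ⊗ x2 ∵ *-suc 2 k))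
        -- Let t = `suc k`. The degree sum leaves q - 2t vertices of degree 2 and q′ + 2t of degree
        -- 1, so that `stuck-bound` and `∂A` give 6t ≤ 2q - 2q′ + 4 ≤ 4.
        step (inj₂ stuck) = 1≰0 (linear (q ∷ q′ ∷ count (level H 1) ∷ count (level H 2) ∷ size H ∷ 2 * suc
            k ∷ k ∷ E adj A (∁ A) ∷ [])
            (con 1 ≼ con 0) 1
            ( 3 · x4 ⊕ x5 ≐ 2 ⊗ x0 ⊕ 4 ⊗ x1 ∵ sz
            ⨾ 3 ·⁻ x5 ≐ con 2 ⊕ 2 ⊗ x6 ∵ *-suc 2 k
            ⨾ 2 ·⁻ x2 ⊕ x3 ≐ x0 ⊕ x1 ∵ middle-levels V
            ⨾ 3 ·⁻ x4 ≐ x3 ⊕ x0 ⊕ 4 ⊗ x1 ∵ size-by-twos V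
            ⨾ 1 · 2 ⊗ x2 ≼ x7 ⊕ x3 ∵ stuck-bound V stuck
            ⨾ 1 · x7 ≼ x0 ⊕ con 4 ∵ ∂A
            ⨾ 2 · x0 ≼ x1 ∵ q≤q′))

      -- Either the boundary of D is small enough for removals alone, or it is only moderately small
      -- and the last surplus of 2 is left to `Exchange`, whose hypotheses the other two bounds
      -- provide.
      Compact Exchangeable : Set
      Compact = E adj D (∁ D) ≤ q′ + 2
      Exchangeable = E adj D (∁ D) ≤ 2 * q + 3 × E adj D (∁ D) + q′ ≤ 6 + 2 * q ×
        (∀ u v → u ∉ A → u ∉ D → v ∉ A → v ∉ D → d A u ≡ 0 → d A v ≡ 0 → 2 ≤ d D u → 2 ≤ d D v → u ≡ v)

      down : Compact ⊎ Exchangeable → ∀ k H → Valid A D H → size H ≡ 2 * q + 4 * q′ + 2 * k →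
          Balanced q q′
      down ∂D zero H V sz = H , trans (count-cong (A≡ V)) |A| , trans (count-cong (D≡ V)) |D| ,
          trans sz (+-identityʳ _)
      down ∂D (suc k) H V sz = step (lower V)
        where
        step : (∃[ H′ ] Valid A D H′ × size H ≡ 2 + size H′) ⊎ Stuck (complement H) → Balanced q q′
        step (inj₁ (H′ , V′ , eq)) =
            down ∂D k H′ V′ (linear (size H ∷ size H′ ∷ k ∷ q ∷ q′ ∷ 2 * suc k ∷ [])
            (x1 ≐ 2 ⊗ x3 ⊕ 4 ⊗ x4 ⊕ 2 ⊗ x2) 0
            ( 1 · x0 ≐ 2 ⊗ x3 ⊕ 4 ⊗ x4 ⊕ x5 ∵ sz
            ⨾ 1 ·⁻ x0 ≐ con 2 ⊕ x1 ∵ eq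
            ⨾ 1 · x5 ≐ con 2 ⊕ 2 ⊗ x2 ∵ *-suc 2 k))
        step (inj₂ stuck) = stuck-down ∂D k sz
          where
          dual : ∀ j i → (∀ m → m ≤ 3 → 3 ∸ m ≡ j → m ≡ i) → 3 ∸ i ≡ j → ∀ u → level (complement H) j
              u ≡ level H i u
          dual j i f g u = ⇔⇒≡
            (λ p → level⁺ H (f (deg H u) (deg≤3 H u) (trans (sym (deg-complement′ H refl))
                (level⁻ (complement H) p))))
            (λ p → level⁺ (complement H) (trans (deg-complement′ H (level⁻ H p)) g))
          |C| : count (level (complement H) 1) ≡ count (level H 2)
          |C| = count-cong (dual 1 2
              (λ { 2 _ _ → refl ; (suc (suc (suc zero))) _ () ; (suc (suc (suc (suc _))))
              (s≤s (s≤s (s≤s ()))) _ }) refl)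
          |B| : count (level (complement H) 2) ≡ count (level H 1)
          |B| = count-cong (dual 2 1
              (λ { 1 _ _ → refl ; (suc (suc (suc zero))) _ () ; (suc (suc (suc (suc _))))
              (s≤s (s≤s (s≤s ()))) _ }) refl)
          bound : 2 * count (level H 2) ≤ E adj D (∁ D) + count (level H 1)
          bound = subst₂ (λ x y → 2 * x ≤ E adj D (∁ D) + y) |C| |B|
              (stuck-bound (valid-complement V) stuck)
          stuck-down : Compact ⊎ Exchangeable → ∀ k → size H ≡ 2 * q + 4 * q′ + 2 * suc k → Balanced q q′
          -- With t = `suc k` there are now q + 2t vertices of degree 2 and q′ - 2t of degree 1, and
          -- the dual bound gives 6t ≤ 2q′ - 2q + 2 ≤ 4.
          stuck-down (inj₁ compact) k sz =
              1≰0 (linear (q ∷ q′ ∷ count (level H 1) ∷ count (level H 2) ∷ size H ∷ 2 * suc k ∷ k ∷ E adj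
              D (∁ D) ∷ [])
              (con 1 ≼ con 0) 1
              ( 3 ·⁻ x4 ≐ 2 ⊗ x0 ⊕ 4 ⊗ x1 ⊕ x5 ∵ sz
              ⨾ 3 ·⁻ x5 ≐ con 2 ⊕ 2 ⊗ x6 ∵ *-suc 2 k
              ⨾ 1 · x2 ⊕ x3 ≐ x0 ⊕ x1 ∵ middle-levels V
              ⨾ 3 · x4 ≐ x3 ⊕ x0 ⊕ 4 ⊗ x1 ∵ size-by-twos V
              ⨾ 1 · 2 ⊗ x3 ≼ x7 ⊕ x2 ∵ bound
              ⨾ 1 · x7 ≼ x1 ⊕ con 2 ∵ compact
              ⨾ 2 · x1 ≼ con 1 ⊕ x0 ∵ q′≤1+q))
          -- The weaker bound on the boundary still gives 6t ≤ 6, where t counts the steps left, so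
          -- t ≥ 2 is impossible.
          stuck-down (inj₂ (_ , ∂D≤ , _)) (suc k) sz =
              1≰0 (linear (q ∷ q′ ∷ count (level H 1) ∷ count (level H 2) ∷ size H ∷ 2 * suc (suc k) ∷ 2 *
              suc k ∷ k ∷ E adj D (∁ D) ∷ [])
              (con 1 ≼ con 0) 5
              ( 3 ·⁻ x4 ≐ 2 ⊗ x0 ⊕ 4 ⊗ x1 ⊕ x5 ∵ sz
              ⨾ 3 ·⁻ x5 ≐ con 2 ⊕ x6 ∵ *-suc 2 (suc k)
              ⨾ 3 ·⁻ x6 ≐ con 2 ⊕ 2 ⊗ x7 ∵ *-suc 2 k
              ⨾ 1 · x2 ⊕ x3 ≐ x0 ⊕ x1 ∵ middle-levels V
              ⨾ 3 · x4 ≐ x3 ⊕ x0 ⊕ 4 ⊗ x1 ∵ size-by-twos V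
              ⨾ 1 · 2 ⊗ x3 ≼ x8 ⊕ x2 ∵ bound
              ⨾ 1 · x8 ⊕ x1 ≼ con 6 ⊕ 2 ⊗ x0 ∵ ∂D≤))
          -- One step is left: q + 2 vertices have degree 2 and q′ - 2 ≤ q - 1 have degree 1, which
          -- yields both `room` and `excess`.
          stuck-down (inj₂ (∂D< , _ , uniq)) zero sz = finish (Exchange.exchange V stuck
              (linear (q ∷ q′ ∷ count (level H 2) ∷ size H ∷ E adj D (∁ D) ∷ []) (con 1 ⊕ x4 ≼ 2 ⊗ x2) 0
                  ( 2 ·⁻ x3 ≐ 2 ⊗ x0 ⊕ 4 ⊗ x1 ⊕ con 2 ∵ sz
                  ⨾ 2 · x3 ≐ x2 ⊕ x0 ⊕ 4 ⊗ x1 ∵ size-by-twos V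
                  ⨾ 1 · x4 ≼ 2 ⊗ x0 ⊕ con 3 ∵ ∂D<))
              (linear (q ∷ q′ ∷ count (level H 1) ∷ count (level H 2) ∷ size H ∷ []) (x2 ⊕ con 3 ≼ x3) 0
                  ( 2 ·⁻ x4 ≐ 2 ⊗ x0 ⊕ 4 ⊗ x1 ⊕ con 2 ∵ sz
                  ⨾ 1 · x2 ⊕ x3 ≐ x0 ⊕ x1 ∵ middle-levels V
                  ⨾ 2 · x4 ≐ x3 ⊕ x0 ⊕ 4 ⊗ x1 ∵ size-by-twos V
                  ⨾ 1 · x1 ≼ con 1 ⊕ x0 ∵ q′≤1+q))
              uniq)
            where
            finish : (∃[ H′ ] count (level H′ 0) ≡ count A × count (level H′ 3) ≡ count D ×
                size H ≡ 2 + size H′) → Balanced q q′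
            finish (H′ , zs , ts , eq) = H′ , trans zs |A| , trans ts |D| ,
              (linear (size H ∷ size H′ ∷ q ∷ q′ ∷ []) (x1 ≐ 2 ⊗ x2 ⊕ 4 ⊗ x3) 0
                  ( 1 · x0 ≐ 2 ⊗ x2 ⊕ 4 ⊗ x3 ⊕ con 2 ∵ sz
                  ⨾ 1 ·⁻ x0 ≐ con 2 ⊕ x1 ∵ eq))

      -- The degree sum and its target are both even, so their distance is a whole number of steps
      -- of 2.
      balance : Compact ⊎ Exchangeable → ∀ H → Valid A D H → Balanced q q′
      balance ∂D H V = go (size-even H) (≤-total (size H) (2 * q + 4 * q′))
        where
        T≡ : 2 * q + 4 * q′ ≡ 2 * (q + 2 * q′)
        T≡ = sym (trans (*-distribˡ-+ 2 q (2 * q′)) (cong (2 * q +_) (sym (*-assoc 2 2 q′))))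
        go : (∃[ j ] size H ≡ 2 * j) → size H ≤ 2 * q + 4 * q′ ⊎ 2 * q + 4 * q′ ≤ size H → Balanced q q′
        go (j , eq) (inj₁ le) = below (m≤n⇒∃[o]m+o≡n (*-cancelˡ-≤ 2 (subst₂ _≤_ eq T≡ le)))
          where
          below : (∃[ k ] j + k ≡ q + 2 * q′) → Balanced q q′
          below (k , e) = up k H V
              (trans (cong (_+ 2 * k) eq)
              (trans (sym (*-distribˡ-+ 2 j k)) (trans (cong (2 *_) e) (sym T≡))))
        go (j , eq) (inj₂ ge) = above (m≤n⇒∃[o]m+o≡n (*-cancelˡ-≤ 2 (subst₂ _≤_ T≡ eq ge)))
          where
          above : (∃[ k ] q + 2 * q′ + k ≡ j) → Balanced q q′
          above (k , e) = down ∂D k H V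
              (trans eq (trans (cong (2 *_) (sym e)) (trans (*-distribˡ-+ 2 (q + 2 * q′) k)
              (cong (_+ 2 * k) (sym T≡)))))

  -- From the sets A and D to a subgraph

  module Staging {n} (G : CubicGraph n) where
    open Peeling G public
    private
      module C = Coloring G
      module B = Balancing G

    -- Reasons why u causes no trouble whatever D is chosen in Z. `settled`: both colours are forced
    -- at u already. `out-only`: one edge is forced out, and only D can force edges in; if D does, u
    -- is satisfied, otherwise two edges stay free. `in-only`: at most one edge is forced, inward,
    -- and D cannot reach u.
    data Outer (A I O Z : Sub n) (u : Fin n) : Set where
      settled  : u ∈ I → 1 ≤ d I u → 1 ≤ d A u ⊎ (u ∈ O × 1 ≤ d O u) → Outer A I O Z u
      out-only : u ∉ I → (d A u ≡ 1 × u ∉ O) ⊎ (d A u ≡ 0 × d O u ≡ 1 × u ∈ O) → Outer A I O Z u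
      in-only  : u ∉ O → d A u ≡ 0 → d I u ≡ 1 → d Z u ≡ 0 → Outer A I O Z u

    -- A is to become the set of isolated vertices. Edges inside I are forced into
    -- the subgraph, edges inside O are forced out of it, and the vertices of
    -- degree 3 will be chosen in Z, which none of these edges meets.
    record Start (q q′ : ℕ) : Set where
      field
        A I O Z : Sub n
        |A|     : count A ≡ q
        A-dense : 2 * q ≤ e A + 4
        Z∉A     : Z # A
        Z-far   : ∀ u → u ∈ Z → d A u ≡ 0
        I∉A     : I # A
        O∉A     : O # A
        I∉Z     : I # Z
        O∉Z     : O # Z
        I#O     : ∀ u v → v ∈ adj u → u ∈ I → v ∈ I → u ∈ O → v ∉ O
        outer   : ∀ u → u ∉ A → u ∉ Z → Outer A I O Z u
        lone    : ∀ u v → u ∉ A → u ∉ Z → v ∉ A → v ∉ Z → d A u ≡ 0 → d A v ≡ 0 → 2 ≤ d Z u → 2 ≤ d Z v →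
            u ≡ v
        large   : q′ ≤ count Z
        larger  : 5 ≤ q′ → 2 + q′ ≤ count Z
        Z-dense : 2 * count Z + 2 * q′ ≤ e Z + 6 + 2 * q

    -- D is to become the set of vertices of degree 3, and edges inside X are forced out.
    record Finish (Z : Sub n) (q q′ : ℕ) : Set where
      field
        D X     : Sub n
        D⊆Z     : D ⊆ Z
        X⊆Z     : X ⊆ Z
        X∉D     : X # D
        |D|     : count D ≡ q′
        X-D     : ∀ u → u ∈ X → 1 ≤ d D u
        X-X     : ∀ u → u ∈ X → 1 ≤ d X u
        ℓ       : Fin n
        calm    : ∀ u → u ∈ Z → u ∉ D → u ∉ X → u ≢ ℓ → d D u ≤ 1
        calmℓ   : ℓ ∈ Z → ℓ ∉ D → ℓ ∉ X → d D ℓ ≤ 2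
        quality : 2 * q′ ≤ e D + 2 ⊎ ((∀ u → u ∈ Z → u ∉ D → d D u ≤ 1) × 4 * q′ ≤ e D + 6 + 2 * q)

    module Combine {q q′} (S : Start q q′) (F : Finish (Start.Z S) q q′) where
      open Start S
      open Finish F

      R : Sub n
      R = ∁ (A ∪ D)

      R⇒∉A : ∀ {u} → u ∈ R → u ∉ A
      R⇒∉A p = ∪-noˡ (not⁻ p)

      R⇒∉D : ∀ {u} → u ∈ R → u ∉ D
      R⇒∉D {u} p = ∪-noʳ {A u} (not⁻ p)

      In₀ Out₀ : Fin n → Sub n
      In₀ u v = (D u ∨ D v) ∨ (I u ∧ I v)
      Out₀ u v = ((A u ∨ A v) ∨ (O u ∧ O v)) ∨ (X u ∧ X v)

      D-far : ∀ {u v} → u ∈ D → v ∈ adj u → v ∉ A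
      D-far {u} p uv = d-zero A (Z-far u (D⊆Z u p)) uv

      D-clear : ∀ {u v} → v ∈ adj u → u ∈ D → v ∉ Out₀ u
      D-clear {u} {v} uv p = ∪-no (∪-no (∪-no (Z∉A u (D⊆Z u p)) (D-far p uv))
        (refute λ q → clash (D⊆Z u p) (O∉Z u (∧⁻ˡ q)))) (refute λ q → clash p (X∉D u (∧⁻ˡ q)))

      Out₀-sym : ∀ u v → Out₀ u v ≡ Out₀ v u
      Out₀-sym u v = cong₂ _∨_ (cong₂ _∨_ (Bool.∨-comm (A u) (A v)) (Bool.∧-comm (O u) (O v)))
          (Bool.∧-comm (X u) (X v))

      forced : C.Partial
      forced = record
        { In       = In₀
        ; Out      = Out₀
        ; In-sym   = λ u v → cong₂ _∨_ (Bool.∨-comm (D u) (D v)) (Bool.∧-comm (I u) (I v))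
        ; Out-sym  = Out₀-sym
        ; disjoint = λ u v uv p → cases u v uv (∨⁻ {D u ∨ D v} p)
        }
        where
        cases : ∀ u v → v ∈ adj u → (D u ∨ D v) ≡ true ⊎ (I u ∧ I v) ≡ true → v ∉ Out₀ u
        cases u v uv (inj₂ p) = ∪-no (∪-no (∪-no (I∉A u (∧⁻ˡ p)) (I∉A v (∧⁻ʳ {I u} p)))
          (refute λ q → clash (∧⁻ʳ {O u} q) (I#O u v uv (∧⁻ˡ p) (∧⁻ʳ {I u} p) (∧⁻ˡ q))))
          (refute λ q → clash (X⊆Z u (∧⁻ˡ q)) (I∉Z u (∧⁻ˡ p)))
        cases u v uv (inj₁ p) with ∨⁻ {D u} p
        ... | inj₁ q = D-clear uv q
        ... | inj₂ q = trans (Out₀-sym u v) (D-clear (adj⁻¹ uv) q)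

      i o f : Fin n → ℕ
      i = C.Partial.i forced
      o = C.Partial.o forced
      f = C.Partial.f forced

      sum≤ : ∀ u P Q {S} → (∀ v → v ∈ S → v ∈ P ⊎ v ∈ Q) → count (adj u ∩ S) ≤ d P u + d Q u
      sum≤ u P Q {S} s = ≤-trans (d-⊆ {S} {P ∪ (Q ∖ P)} u λ v p → cover v (s v p))
        (≤-trans (≤-reflexive (d-∪ P (Q ∖ P) u λ v p → ∖-no {Q v} p))
            (+-monoʳ-≤ (d P u) (d-⊆ {Q ∖ P} {Q} u λ v → ∧⁻ˡ)))
        where
        cover : ∀ v → v ∈ P ⊎ v ∈ Q → v ∈ P ∪ (Q ∖ P)
        cover v (inj₁ p) = ∨⁺ˡ p
        cover v (inj₂ p) with v ∈? P
        ... | inj₁ q = ∨⁺ˡ q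
        ... | inj₂ q = ∨⁺ʳ {P v} (∖⁺ p q)

      i≤ : ∀ u → u ∉ D → i u ≤ d D u + d I u
      i≤ u u∉D = sum≤ u D I λ v p → aux v (∨⁻ {D u ∨ D v} p)
        where
        aux : ∀ v → (D u ∨ D v) ≡ true ⊎ (I u ∧ I v) ≡ true → v ∈ D ⊎ v ∈ I
        aux v (inj₂ p) = inj₂ (∧⁻ʳ {I u} p)
        aux v (inj₁ p) with ∨⁻ {D u} p
        ... | inj₁ q = clash q u∉D
        ... | inj₂ q = inj₁ q

      i≤D : ∀ u → u ∉ D → u ∉ I → i u ≤ d D u
      i≤D u u∉D u∉I = d-⊆ {In₀ u} {D} u λ v p → aux v (∨⁻ {D u ∨ D v} p)
        where
        aux : ∀ v → (D u ∨ D v) ≡ true ⊎ (I u ∧ I v) ≡ true → v ∈ D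
        aux v (inj₂ p) = clash (∧⁻ˡ p) u∉I
        aux v (inj₁ p) with ∨⁻ {D u} p
        ... | inj₁ q = clash q u∉D
        ... | inj₂ q = q

      o≤ : ∀ u → u ∉ A → u ∉ X → o u ≤ d A u + d O u
      o≤ u u∉A u∉X = sum≤ u A O λ v p → aux v (∨⁻ {(A u ∨ A v) ∨ (O u ∧ O v)} p)
        where
        aux : ∀ v → ((A u ∨ A v) ∨ (O u ∧ O v)) ≡ true ⊎ (X u ∧ X v) ≡ true → v ∈ A ⊎ v ∈ O
        aux v (inj₂ p) = clash (∧⁻ˡ p) u∉X
        aux v (inj₁ p) with ∨⁻ {A u ∨ A v} p
        ... | inj₂ q = inj₂ (∧⁻ʳ {O u} q)
        ... | inj₁ q with ∨⁻ {A u} q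
        ...   | inj₁ r = clash r u∉A
        ...   | inj₂ r = inj₁ r

      o≤A : ∀ u → u ∉ A → u ∉ O → u ∉ X → o u ≤ d A u
      o≤A u u∉A u∉O u∉X = d-⊆ {Out₀ u} {A} u λ v p → aux v (∨⁻ {(A u ∨ A v) ∨ (O u ∧ O v)} p)
        where
        aux : ∀ v → ((A u ∨ A v) ∨ (O u ∧ O v)) ≡ true ⊎ (X u ∧ X v) ≡ true → v ∈ A
        aux v (inj₂ p) = clash (∧⁻ˡ p) u∉X
        aux v (inj₁ p) with ∨⁻ {A u ∨ A v} p
        ... | inj₂ q = clash (∧⁻ˡ q) u∉O
        ... | inj₁ q with ∨⁻ {A u} q
        ...   | inj₁ r = clash r u∉A
        ...   | inj₂ r = r

      D≤i : ∀ u → d D u ≤ i u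
      D≤i u = d-⊆ {D} {In₀ u} u λ v p → ∨⁺ˡ (∨⁺ʳ {D u} p)

      I≤i : ∀ u → u ∈ I → d I u ≤ i u
      I≤i u p = d-⊆ {I} {In₀ u} u λ v q → ∨⁺ʳ {D u ∨ D v} (∧⁺ p q)

      A≤o : ∀ u → d A u ≤ o u
      A≤o u = d-⊆ {A} {Out₀ u} u λ v p → ∨⁺ˡ (∨⁺ˡ (∨⁺ʳ {A u} p))

      O≤o : ∀ u → u ∈ O → d O u ≤ o u
      O≤o u p = d-⊆ {O} {Out₀ u} u λ v q → ∨⁺ˡ (∨⁺ʳ {A u ∨ A v} (∧⁺ p q))

      X≤o : ∀ u → u ∈ X → d X u ≤ o u
      X≤o u p = d-⊆ {X} {Out₀ u} u λ v q → ∨⁺ʳ {(A u ∨ A v) ∨ (O u ∧ O v)} (∧⁺ p q)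

      Sat : Fin n → Set
      Sat = C.Partial.Sat forced

      two-free : ∀ u → i u + o u ≤ 1 → 2 ≤ f u
      two-free u p = linear (i u ∷ o u ∷ f u ∷ []) (con 2 ≼ x2) 0
          ( 1 ·⁻ x0 ⊕ x1 ⊕ x2 ≐ con 3 ∵ C.Partial.total forced u
          ⨾ 1 · x0 ⊕ x1 ≼ con 1 ∵ p)

      outside-Z : ∀ u → u ∉ A → u ∉ Z → Sat u ⊎ 2 ≤ f u
      outside-Z u u∉A u∉Z = go (outer u u∉A u∉Z)
        where
        u∉D : u ∉ D
        u∉D = refute λ p → clash (D⊆Z u p) u∉Z
        u∉X : u ∉ X
        u∉X = refute λ p → clash (X⊆Z u p) u∉Z
        one-out : u ∉ I → 1 ≤ o u → o u ≤ 1 → Sat u ⊎ 2 ≤ f u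
        one-out u∉I 1≤o o≤1 with 1 ≤? d D u
        ... | yes 1≤d = inj₁ (≤-trans 1≤d (D≤i u) , 1≤o)
        ... | no  d<1 = inj₂ (two-free u (linear (i u ∷ o u ∷ d D u ∷ []) (x0 ⊕ x1 ≼ con 1) 0
            ( 1 · x0 ≼ x2 ∵ i≤D u u∉D u∉I
            ⨾ 1 · x2 ≼ con 0 ∵ ≤-pred (≰⇒> d<1)
            ⨾ 1 · x1 ≼ con 1 ∵ o≤1)))
        go : Outer A I O Z u → Sat u ⊎ 2 ≤ f u
        go (settled p q (inj₁ r)) = inj₁ (≤-trans q (I≤i u p) , ≤-trans r (A≤o u))
        go (settled p q (inj₂ (r , s))) = inj₁ (≤-trans q (I≤i u p) , ≤-trans s (O≤o u r))
        go (out-only p (inj₁ (q , r))) = one-out p (≤-trans (≤-reflexive (sym q)) (A≤o u))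
            (≤-trans (o≤A u u∉A r u∉X) (≤-reflexive q))
        go (out-only p (inj₂ (q , r , s))) = one-out p (≤-trans (≤-reflexive (sym r)) (O≤o u s))
          (≤-trans (o≤ u u∉A u∉X) (≤-reflexive (cong₂ _+_ q r)))
        go (in-only p q r s) =
            inj₂ (two-free u (linear (i u ∷ o u ∷ d D u ∷ d I u ∷ d A u ∷ d Z u ∷ []) (x0 ⊕ x1 ≼ con 1) 0
            ( 1 · x0 ≼ x2 ⊕ x3 ∵ i≤ u u∉D
            ⨾ 1 · x1 ≼ x4 ∵ o≤A u u∉A p u∉X
            ⨾ 1 · x4 ≐ con 0 ∵ q
            ⨾ 1 · x3 ≐ con 1 ∵ r
            ⨾ 1 · x5 ≐ con 0 ∵ s
            ⨾ 1 · x2 ≼ x5 ∵ d-⊆ {D} {Z} u D⊆Z)))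

      -- I and O avoid Z, and A is not adjacent to it; so outside X the only forced edges at u are
      -- those to D.
      inside-Z : ∀ u → u ∈ Z → u ∉ D → Sat u ⊎ (u ∉ X × f u + d D u ≡ 3)
      inside-Z u u∈Z u∉D with u ∈? X
      ... | inj₁ p = inj₁ (≤-trans (X-D u p) (D≤i u) , ≤-trans (X-X u p) (X≤o u p))
      ... | inj₂ p = inj₂ (p , (≤-antisym (linear (i u ∷ o u ∷ f u ∷ d D u ∷ []) (x2 ⊕ x3 ≼ con 3) 0
          ( 1 · x0 ⊕ x1 ⊕ x2 ≐ con 3 ∵ C.Partial.total forced u
          ⨾ 1 · x3 ≼ x0 ∵ D≤i u)) (linear (i u ∷ o u ∷ f u ∷ d D u ∷ d A u ∷ []) (con 3 ≼ x2 ⊕ x3) 0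
          ( 1 ·⁻ x0 ⊕ x1 ⊕ x2 ≐ con 3 ∵ C.Partial.total forced u
          ⨾ 1 · x0 ≼ x3 ∵ i≤D u u∉D (refute λ q → clash u∈Z (I∉Z u q))
          ⨾ 1 · x1 ≼ x4 ∵ o≤A u (Z∉A u u∈Z) (refute λ q → clash u∈Z (O∉Z u q)) p
          ⨾ 1 · x4 ≐ con 0 ∵ Z-far u u∈Z))))

      flexible : C.Flexible R ℓ forced
      flexible = record
        { spare  = λ u p un u≢ℓ → spare u p un u≢ℓ (u ∈? Z)
        ; spareℓ = λ p un → spareℓ p un (ℓ ∈? Z)
        ; inside = λ u v _ p → free-inside u v (not⁻ p)
        }
        where
        free-inside : ∀ u v → In₀ u v ∨ Out₀ u v ≡ false → u ∈ R
        free-inside u v p = not⁺ (∪-no {A u} {D u}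
          (∪-noˡ {A u} {A v} (∪-noˡ {A u ∨ A v} {O u ∧ O v} (∪-noˡ {(A u ∨ A v) ∨ (O u ∧ O v)} {X u ∧ X v}
              (∪-noʳ {In₀ u v} p))))
          (∪-noˡ {D u} {D v} (∪-noˡ {D u ∨ D v} {I u ∧ I v} (∪-noˡ {In₀ u v} p))))
        spare : ∀ u → u ∈ R → ¬ Sat u → u ≢ ℓ → u ∈ Z ⊎ u ∉ Z → 2 ≤ f u
        spare u p un u≢ℓ (inj₂ u∉Z) with outside-Z u (R⇒∉A p) u∉Z
        ... | inj₁ s = ⊥-elim (un s)
        ... | inj₂ r = r
        spare u p un u≢ℓ (inj₁ u∈Z) with inside-Z u u∈Z (R⇒∉D p)
        ... | inj₁ s = ⊥-elim (un s)
        ... | inj₂ (u∉X , eq) = linear (f u ∷ d D u ∷ []) (con 2 ≼ x0) 0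
            ( 1 ·⁻ x0 ⊕ x1 ≐ con 3 ∵ eq
            ⨾ 1 · x1 ≼ con 1 ∵ calm u u∈Z (R⇒∉D p) u∉X u≢ℓ)
        spareℓ : ℓ ∈ R → ¬ Sat ℓ → ℓ ∈ Z ⊎ ℓ ∉ Z → 1 ≤ f ℓ
        spareℓ p un (inj₂ ℓ∉Z) with outside-Z ℓ (R⇒∉A p) ℓ∉Z
        ... | inj₁ s = ⊥-elim (un s)
        ... | inj₂ r = ≤-trans (s≤s z≤n) r
        spareℓ p un (inj₁ ℓ∈Z) with inside-Z ℓ ℓ∈Z (R⇒∉D p)
        ... | inj₁ s = ⊥-elim (un s)
        ... | inj₂ (ℓ∉X , eq) = linear (f ℓ ∷ d D ℓ ∷ []) (con 1 ≼ x0) 0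
            ( 1 ·⁻ x0 ⊕ x1 ≐ con 3 ∵ eq
            ⨾ 1 · x1 ≼ con 2 ∵ calmℓ ℓ∈Z (R⇒∉D p) ℓ∉X)

      coloured : C.Solution R forced
      coloured = C.solve R forced ℓ flexible

      T : C.Partial
      T = proj₁ coloured

      H : B.Subgraph
      H = record { edges = C.Partial.In T ; edges-sym = C.Partial.In-sym T }

      valid : B.Valid A D H
      valid = record
        { on-A = λ u p → count-∅ λ v → refute λ q → clash
            (C.Extends.Out⁺ ext u v (∨⁺ˡ (∨⁺ˡ (∨⁺ˡ p)))) (C.Partial.disjoint T u v (∧⁻ˡ {adj u v} q)
                (∧⁻ʳ {adj u v} q))
        ; on-D = λ u p → trans (≤-antisym (count-⊆ {Q = adj u} λ v → ∧⁻ˡ)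
            (count-⊆ λ v q → ∧⁺ q (C.Extends.In⁺ ext u v (∨⁺ˡ (∨⁺ˡ p))))) (cubic u)
        ; low  = λ u p q → proj₁ (sat u (not⁺ (∪-no p q)))
        ; high = λ u p q → (linear (C.Partial.i T u ∷ C.Partial.o T u ∷ C.Partial.f T u ∷ []) (x0 ≼ con 2)
            0
            ( 1 · x0 ⊕ x1 ⊕ x2 ≐ con 3 ∵ C.Partial.total T u
            ⨾ 1 · con 1 ≼ x1 ∵ proj₂ (sat u (not⁺ (∪-no p q)))))
        }
        where
        ext = proj₁ (proj₂ coloured)
        sat = proj₂ (proj₂ coloured)

      ∂A : E adj A (∁ A) ≤ q + 4
      ∂A = linear (E adj A (∁ A) ∷ e A ∷ count A ∷ q ∷ []) (x0 ≼ x3 ⊕ con 4) 0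
          ( 1 · x1 ⊕ x0 ≐ 3 ⊗ x2 ∵ boundary A
          ⨾ 3 · x2 ≐ x3 ∵ |A|
          ⨾ 1 · 2 ⊗ x3 ≼ x1 ⊕ con 4 ∵ A-dense)

      compact : 2 * q′ ≤ e D + 2 → E adj D (∁ D) ≤ q′ + 2
      compact p = linear (E adj D (∁ D) ∷ e D ∷ count D ∷ q′ ∷ []) (x0 ≼ x3 ⊕ con 2) 0
          ( 1 · x1 ⊕ x0 ≐ 3 ⊗ x2 ∵ boundary D
          ⨾ 3 · x2 ≐ x3 ∵ |D|
          ⨾ 1 · 2 ⊗ x3 ≼ x1 ⊕ con 2 ∵ p)

      -- Since Z is calm, a vertex outside A and D with two neighbours in D lies outside Z, where
      -- `lone` makes it unique. Either alternative in the last hypothesis brings the boundary of D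
      -- down to 2q + 3.
      exchangeable : (∀ u → u ∈ Z → u ∉ D → d D u ≤ 1) → 4 * q′ ≤ e D + 6 + 2 * q → 3 ≤ q′ ⊎
          3 * q′ ≤ 2 * q + 3 →
        E adj D (∁ D) ≤ 2 * q + 3 × E adj D (∁ D) + q′ ≤ 6 + 2 * q ×
        (∀ u v → u ∉ A → u ∉ D → v ∉ A → v ∉ D → d A u ≡ 0 → d A v ≡ 0 → 2 ≤ d D u → 2 ≤ d D v → u ≡ v)
      exchangeable quiet dense size = small size , bound ,
        λ u v p r p′ r′ z z′ 2≤u 2≤v → lone u v p (far u r 2≤u) p′ (far v r′ 2≤v) z z′
            (≤-trans 2≤u (D≤Z u)) (≤-trans 2≤v (D≤Z v))
        where
        D≤Z : ∀ u → d D u ≤ d Z u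
        D≤Z u = d-⊆ {D} {Z} u D⊆Z
        far : ∀ u → u ∉ D → 2 ≤ d D u → u ∉ Z
        far u p 2≤ = refute λ r → <⇒≱ 2≤ (quiet u r p)
        bound : E adj D (∁ D) + q′ ≤ 6 + 2 * q
        bound = linear (E adj D (∁ D) ∷ e D ∷ count D ∷ q ∷ q′ ∷ []) (x0 ⊕ x4 ≼ con 6 ⊕ 2 ⊗ x3) 0
            ( 1 · x1 ⊕ x0 ≐ 3 ⊗ x2 ∵ boundary D
            ⨾ 3 · x2 ≐ x4 ∵ |D|
            ⨾ 1 · 4 ⊗ x4 ≼ x1 ⊕ con 6 ⊕ 2 ⊗ x3 ∵ dense)
        small : 3 ≤ q′ ⊎ 3 * q′ ≤ 2 * q + 3 → E adj D (∁ D) ≤ 2 * q + 3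
        small (inj₁ p) = linear (E adj D (∁ D) ∷ q ∷ q′ ∷ []) (x0 ≼ 2 ⊗ x1 ⊕ con 3) 0
            ( 1 · x0 ⊕ x2 ≼ con 6 ⊕ 2 ⊗ x1 ∵ bound
            ⨾ 1 · con 3 ≼ x2 ∵ p)
        small (inj₂ p) = linear (E adj D (∁ D) ∷ e D ∷ count D ∷ q ∷ q′ ∷ []) (x0 ≼ 2 ⊗ x3 ⊕ con 3) 0
            ( 1 · x1 ⊕ x0 ≐ 3 ⊗ x2 ∵ boundary D
            ⨾ 3 · x2 ≐ x4 ∵ |D|
            ⨾ 1 · 3 ⊗ x4 ≼ 2 ⊗ x3 ⊕ con 3 ∵ p)

    combine : ∀ {q q′} → n ≡ 2 * q + 2 * q′ → q ≤ q′ → q′ ≤ 1 + q →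
        (S : Start q q′) (F : Finish (Start.Z S) q q′) →
      2 * q′ ≤ e (Finish.D F) + 2 ⊎ (3 ≤ q′ ⊎ 3 * q′ ≤ 2 * q + 3) → B.Balanced q q′
    combine {q} {q′} n≡ q≤q′ q′≤ S F size = B.balance (Start.|A| S) (Finish.|D| F) n≡ q≤q′ q′≤ ∂A
        (choose size (Finish.quality F)) H valid
      where
      open Combine S F
      D = Finish.D F
      choose : 2 * q′ ≤ e D + 2 ⊎ (3 ≤ q′ ⊎ 3 * q′ ≤ 2 * q + 3) → _ → _
      choose (inj₁ p) _ = inj₁ (compact p)
      choose (inj₂ _) (inj₁ p) = inj₁ (compact p)
      choose (inj₂ s) (inj₂ (p , r)) = inj₂ (exchangeable p r s)

  -- Choosing D

  module Finisher {n} (G : CubicGraph n) where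
    open Staging G public

    -- A union M of components of G with two adjacent vertices X split off.
    record Split (M : Sub n) : Set where
      field
        Y X    : Sub n
        |M|    : count M ≡ 2 + count Y
        |X|    : count X ≡ 2
        eM     : e M ≡ e Y + 10
        Y⊆M    : Y ⊆ M
        X⊆M    : X ⊆ M
        X∉Y    : X # Y
        M⊆     : ∀ u → u ∈ M → u ∈ Y ⊎ u ∈ X
        degree : ∀ u → d M u ≡ d Y u + d X u
        X-X    : ∀ u → u ∈ X → 1 ≤ d X u

    -- For a closed M with `suc k` vertices: two adjacent vertices X are given up and z from outside
    -- is taken instead. The 7 is 10 - 3, as `e M` is 3k + 3 and splitting off X costs 10.
    record Trimmed (M : Sub n) (z : Fin n) (k : ℕ) : Set where
      field
        D X     : Sub n
        |D|     : count D ≡ k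
        D-dense : 3 * k ≤ e D + 7
        D⊆      : ∀ u → u ∈ D → u ∈ M ⊎ u ≡ z
        z∈D     : z ∈ D
        X⊆M     : X ⊆ M
        X∉D     : X # D
        X-D     : ∀ u → u ∈ X → 1 ≤ d D u
        X-X     : ∀ u → u ∈ X → 1 ≤ d X u
        M⊆      : ∀ u → u ∈ M → u ∈ D ⊎ u ∈ X
        outside : ∀ u → u ∉ M → d D u ≡ ind (adj u z)

    cubic-outside : ∀ {M} → Closed M → ∀ {u} → u ∉ M → d M u ≡ 0
    cubic-outside {M} M3 {u} u∉M = count-∅ λ v → refute λ r →
        clash (d-all M (M3 v (∧⁻ʳ {adj u v} r)) (adj⁻¹ (∧⁻ˡ r))) u∉M

    cubic-e : ∀ {M} → Closed M → e M ≡ 3 * count M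
    cubic-e {M} M3 = trans (∑-cong M M3) (∑-const M 3)

    cubic-large : ∀ {M u} → Closed M → u ∈ M → 4 ≤ count M
    cubic-large {M} {u} M3 p = subst (λ k → suc k ≤ count M) (M3 u p) (d<count M p)

    split-edge : ∀ {M} → Closed M → ∀ {p r} → p ∈ M → r ∈ adj p → r ∈ M → Split M
    split-edge {M} M3 {p} {r} p∈M pr r∈M = record
      { Y = Y ; X = X
      ; |M| = trans (count-delete M p∈M) (cong suc (count-delete M₁ r∈M₁))
      ; |X| = trans (count-insert ⁅ p ⁆ (≢⇒∉⁅⁆ r≢p)) (cong suc (count-⁅⁆ p))
      -- Two adjacent vertices of degree 3 meet five edges, each counted twice.
      ; eM = linear (e M ∷ e M₁ ∷ e Y ∷ d M p ∷ d M r ∷ d M₁ r ∷ ind (adj r p) ∷ []) (x0 ≐ x2 ⊕ con 10) 0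
          ( 1 · x0 ≐ x1 ⊕ 2 ⊗ x3 ∵ e-delete M p∈M
          ⨾ 2 · x3 ≐ con 3 ∵ M3 p p∈M
          ⨾ 1 · x1 ≐ x2 ⊕ 2 ⊗ x5 ∵ e-delete M₁ r∈M₁
          ⨾ 2 ·⁻ x4 ≐ x5 ⊕ x6 ∵ d-delete M r p∈M
          ⨾ 2 · x4 ≐ con 3 ∵ M3 r r∈M
          ⨾ 2 ·⁻ x6 ≐ con 1 ∵ cong ind (adj⁻¹ pr))
      ; Y⊆M = λ v q → ∧⁻ˡ {M v} (∧⁻ˡ q)
      ; X⊆M = X⊆M
      ; X∉Y = λ u q → X∉Y u (∨⁻ {⁅ p ⁆ u} q)
      ; M⊆ = M⊆
      ; degree = λ u → (linear (d M u ∷ d M₁ u ∷ d Y u ∷ d X u ∷ d ⁅ p ⁆ u ∷ ind (adj u p) ∷ ind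
          (adj u r) ∷ [])
          (x0 ≐ x2 ⊕ x3) 0
          ( 1 · x0 ≐ x1 ⊕ x5 ∵ d-delete M u p∈M
          ⨾ 1 · x1 ≐ x2 ⊕ x6 ∵ d-delete M₁ u r∈M₁
          ⨾ 1 ·⁻ x3 ≐ x4 ⊕ x6 ∵ d-insert ⁅ p ⁆ u (≢⇒∉⁅⁆ r≢p)
          ⨾ 1 ·⁻ x4 ≐ x5 ∵ d-⁅⁆ p u))
      ; X-X = λ u q → X-X u (∨⁻ {⁅ p ⁆ u} q)
      }
      where
      M₁ = M ∖ ⁅ p ⁆
      Y = M₁ ∖ ⁅ r ⁆
      X = ⁅ p ⁆ ∪ ⁅ r ⁆
      r≢p : r ≢ p
      r≢p = adj⇒≢ pr ∘ sym
      r∈M₁ : r ∈ M₁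
      r∈M₁ = ∖⁺ r∈M (≢⇒∉⁅⁆ r≢p)
      X⊆M : X ⊆ M
      X⊆M u q with ∨⁻ {⁅ p ⁆ u} q
      ... | inj₁ s = subst (_∈ M) (sym (⁅⁆⇒≡ s)) p∈M
      ... | inj₂ s = subst (_∈ M) (sym (⁅⁆⇒≡ s)) r∈M
      X∉Y : ∀ u → u ∈ ⁅ p ⁆ ⊎ u ∈ ⁅ r ⁆ → u ∉ Y
      X∉Y u (inj₁ q) = refute λ s → clash q (∖⁻ {M u} (∧⁻ˡ {M₁ u} s))
      X∉Y u (inj₂ q) = refute λ s → clash q (∖⁻ {M₁ u} s)
      X-X : ∀ u → u ∈ ⁅ p ⁆ ⊎ u ∈ ⁅ r ⁆ → 1 ≤ d X u
      X-X u (inj₁ q) = subst (λ v → 1 ≤ d X v) (sym (⁅⁆⇒≡ q)) (d-pos X pr (∨⁺ʳ {⁅ p ⁆ r} (⁅⁆-refl r)))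
      X-X u (inj₂ q) = subst (λ v → 1 ≤ d X v) (sym (⁅⁆⇒≡ q)) (d-pos X (adj⁻¹ pr) (∨⁺ˡ (⁅⁆-refl p)))
      M⊆ : ∀ u → u ∈ M → u ∈ Y ⊎ u ∈ X
      M⊆ u q with u ∈? X
      ... | inj₁ s = inj₂ s
      ... | inj₂ s = inj₁ (∖⁺ (∖⁺ q (∪-noˡ s)) (∪-noʳ {⁅ p ⁆ u} s))

    split : ∀ {M} → Closed M → 1 ≤ count M → Split M
    split {M} M3 1≤ = choose (inhabited M 1≤)
      where
      choose : (∃[ p ] p ∈ M) → Split M
      choose (p , p∈M) = choose′ (nbr M p (≤-trans (s≤s z≤n) (≤-reflexive (sym (M3 p p∈M)))))
        where
        choose′ : (∃[ r ] r ∈ adj p × r ∈ M) → Split M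
        choose′ (r , pr , r∈M) = split-edge M3 p∈M pr r∈M

    split-Y : ∀ {M} → Closed M → (S : Split M) → ∀ u → u ∈ Split.X S → 1 ≤ d (Split.Y S) u
    split-Y {M} M3 S u p = linear (d M u ∷ d Y u ∷ d X u ∷ count X ∷ []) (con 1 ≼ x1) 1
        ( 1 ·⁻ x0 ≐ con 3 ∵ M3 u (X⊆M u p)
        ⨾ 1 · x0 ≐ x1 ⊕ x2 ∵ degree u
        ⨾ 1 · con 1 ⊕ x2 ≼ x3 ∵ d<count X p
        ⨾ 1 · x3 ≐ con 2 ∵ |X|)
      where open Split S

    trim : ∀ {M z k} → Closed M → count M ≡ suc k → z ∉ M → Trimmed M z k
    trim {M} {z} {k} M3 |M|≡ z∉M = record
      { D = D ; X = X
      ; |D| = linear (count M ∷ count Y ∷ count D ∷ k ∷ []) (x2 ≐ x3) 0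
          ( 1 · x0 ≐ con 1 ⊕ x3 ∵ |M|≡
          ⨾ 1 ·⁻ x0 ≐ con 2 ⊕ x1 ∵ |M|
          ⨾ 1 · x2 ≐ con 1 ⊕ x1 ∵ count-insert Y z∉Y)
      ; D-dense = linear (count M ∷ k ∷ e M ∷ e Y ∷ e D ∷ d Y z ∷ []) (3 ⊗ x1 ≼ x4 ⊕ con 7) 0
          ( 3 ·⁻ x0 ≐ con 1 ⊕ x1 ∵ |M|≡
          ⨾ 1 ·⁻ x2 ≐ 3 ⊗ x0 ∵ cubic-e M3
          ⨾ 1 · x2 ≐ x3 ⊕ con 10 ∵ eM
          ⨾ 1 ·⁻ x4 ≐ x3 ⊕ 2 ⊗ x5 ∵ e-insert Y z∉Y)
      ; D⊆ = λ u q → D⊆ u (∨⁻ {Y u} q)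
      ; z∈D = ∨⁺ʳ {Y z} (⁅⁆-refl z)
      ; X⊆M = X⊆M
      ; X∉D = λ u q → ∪-no (X∉Y u q) (≢⇒∉⁅⁆ (∈∉⇒≢ M (X⊆M u q) z∉M))
      ; X-D = λ u q → ≤-trans (split-Y M3 S u q) (d-⊆ {Y} {D} u λ v → ∨⁺ˡ)
      ; X-X = X-X
      ; M⊆ = λ u q → M⊆′ u (M⊆ u q)
      ; outside = λ u q → trans (d-insert Y u z∉Y)
          (cong (_+ ind (adj u z))
          (n≤0⇒n≡0 (≤-trans (d-⊆ {Y} {M} u Y⊆M) (≤-reflexive (cubic-outside M3 q)))))
      }
      where
      S = split M3 (≤-trans (s≤s z≤n) (≤-reflexive (sym |M|≡)))
      open Split S
      D = Y ∪ ⁅ z ⁆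
      z∉Y : z ∉ Y
      z∉Y = refute λ q → clash (Y⊆M z q) z∉M
      D⊆ : ∀ u → u ∈ Y ⊎ u ∈ ⁅ z ⁆ → u ∈ M ⊎ u ≡ z
      D⊆ u (inj₁ q) = inj₁ (Y⊆M u q)
      D⊆ u (inj₂ q) = inj₂ (⁅⁆⇒≡ q)
      M⊆′ : ∀ u → u ∈ Y ⊎ u ∈ X → u ∈ D ⊎ u ∈ X
      M⊆′ u (inj₁ q) = inj₁ (∨⁺ˡ q)
      M⊆′ u (inj₂ q) = inj₂ q

    FourClique : Sub n → Set
    FourClique Z = ∃[ M ] (M ⊆ Z) × count M ≡ 4 × Closed M

    module _ {Z : Sub n} {q q′ : ℕ} (1≤q′ : 1 ≤ q′) (q′≤ : q′ ≤ 1 + q) (large : q′ ≤ count Z)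
        (larger : 5 ≤ q′ → 2 + q′ ≤ count Z)
      (Z-dense : 2 * count Z + 2 * q′ ≤ e Z + 6 + 2 * q) where

      -- A placeholder for ℓ when no vertex needs the exception.
      some : Fin n
      some = proj₁ (inhabited Z (≤-trans 1≤q′ large))

      -- As a union of components M has at least 4 vertices, and not 5, because cubic graphs have
      -- even order. For q′ ≥ 5 trimming is dense enough: 3q′ - 7 ≥ 2q′ - 2. What remains is K₄.
      finish-closed : ∀ M → (M ⊆ Z) → count M ≡ suc q′ → Closed M →
                      Finish Z q q′ ⊎ (q′ ≡ 3 × FourClique Z)
      finish-closed M M⊆Z |M| M3 = by-size (<-cmp q′ 3)
        where
        4≤ : 4 ≤ count M
        4≤ = cubic-large M3 (proj₂ (inhabited M (≤-trans (s≤s z≤n) (≤-reflexive (sym |M|)))))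
        not-4 : q′ ≢ 4
        not-4 q′≡4 = uneven (e-even M)
          where
          uneven : (∃[ j ] e M ≡ 2 * j) → ⊥
          -- Five vertices would make `e M` equal to 15, an odd number.
          uneven (j , eq) with j ≤? 7
          ... | yes j≤7 = 1≰0 (linear (j ∷ e M ∷ count M ∷ q′ ∷ []) (con 1 ≼ con 0) 0
              ( 1 · x1 ≐ 2 ⊗ x0 ∵ eq
              ⨾ 1 ·⁻ x1 ≐ 3 ⊗ x2 ∵ cubic-e M3
              ⨾ 3 ·⁻ x2 ≐ con 1 ⊕ x3 ∵ |M|
              ⨾ 3 ·⁻ x3 ≐ con 4 ∵ q′≡4
              ⨾ 2 · x0 ≼ con 7 ∵ j≤7))
          ... | no  j≰7 = 1≰0 (linear (j ∷ e M ∷ count M ∷ q′ ∷ []) (con 1 ≼ con 0) 0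
              ( 1 ·⁻ x1 ≐ 2 ⊗ x0 ∵ eq
              ⨾ 1 · x1 ≐ 3 ⊗ x2 ∵ cubic-e M3
              ⨾ 3 · x2 ≐ con 1 ⊕ x3 ∵ |M|
              ⨾ 3 · x3 ≐ con 4 ∵ q′≡4
              ⨾ 2 · con 8 ≼ x0 ∵ ≰⇒> j≰7))
        with-trim : 5 ≤ q′ → (∃[ z ] z ∈ Z ∖ M) → Finish Z q q′
        with-trim 5≤ (z , pz) = record
          { D = T.D ; X = T.X
          ; D⊆Z = λ u p → in-Z u (T.D⊆ u p)
          ; X⊆Z = λ u p → M⊆Z u (T.X⊆M u p)
          ; X∉D = T.X∉D ; |D| = T.|D| ; X-D = T.X-D ; X-X = T.X-X
          ; ℓ = some
          ; calm = λ u _ p r _ → calm u p r (≤-trans (ind≤1 (adj u z)) ≤-refl)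
          ; calmℓ = λ _ p r → calm some p r (≤-trans (ind≤1 (adj some z)) (s≤s z≤n))
          ; quality = inj₁ (linear (q′ ∷ e T.D ∷ []) (2 ⊗ x0 ≼ x1 ⊕ con 2) 0
              ( 1 · 3 ⊗ x0 ≼ x1 ⊕ con 7 ∵ T.D-dense
              ⨾ 1 · con 5 ≼ x0 ∵ 5≤))
          }
          where
          module T = Trimmed (trim M3 |M| (∖⁻ {Z z} pz))
          in-Z : ∀ u → u ∈ M ⊎ u ≡ z → u ∈ Z
          in-Z u (inj₁ p) = M⊆Z u p
          in-Z u (inj₂ p) = subst (_∈ Z) (sym p) (∧⁻ˡ pz)
          calm : ∀ u → u ∉ T.D → u ∉ T.X → ∀ {c} → ind (adj u z) ≤ c → d T.D u ≤ c
          calm u p r b = ≤-trans (≤-reflexive (T.outside u (refute λ s → aux (T.M⊆ u s)))) b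
            where
            aux : u ∈ T.D ⊎ u ∈ T.X → ⊥
            aux (inj₁ s) = clash s p
            aux (inj₂ s) = clash s r
        by-size : Tri (q′ < 3) (q′ ≡ 3) (3 < q′) → Finish Z q q′ ⊎ (q′ ≡ 3 × FourClique Z)
        by-size (tri< q′<3 _ _) = 1≰0 (linear (q′ ∷ count M ∷ []) (con 1 ≼ con 0) 0
            ( 1 · con 1 ⊕ x0 ≼ con 3 ∵ q′<3
            ⨾ 1 · x1 ≐ con 1 ⊕ x0 ∵ |M|
            ⨾ 1 · con 4 ≼ x1 ∵ 4≤))
        by-size (tri≈ _ q′≡3 _) = inj₂ (q′≡3 , M , M⊆Z , trans |M| (cong suc q′≡3) , M3)
        by-size (tri> _ _ 3<q′) =
            inj₁ (with-trim 5≤ (inhabited (Z ∖ M)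
            (linear (count Z ∷ count M ∷ count (Z ∩ M) ∷ count (Z ∖ M) ∷ q′ ∷ []) (con 1 ≼ x3) 0
            ( 1 · x0 ≐ x2 ⊕ x3 ∵ count-split Z M
            ⨾ 1 · x2 ≼ x1 ∵ count-⊆ {P = Z ∩ M} (λ v → ∧⁻ʳ {Z v})
            ⨾ 1 · x1 ≐ con 1 ⊕ x4 ∵ |M|
            ⨾ 1 · con 2 ⊕ x4 ≼ x0 ∵ larger 5≤))))
          where
          5≤ : 5 ≤ q′
          5≤ = ≤∧≢⇒< 3<q′ (not-4 ∘ sym)

      finish-tame : ∀ W → (W ⊆ Z) → (∀ u → u ∈ Z → u ∉ W → d W u ≤ 1) →
        ∀ D → (D ⊆ W) → count D ≡ q′ → 2 * q′ ≤ e D + 2 → Tame W D → Finish Z q q′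
      finish-tame W W⊆Z sparse D D⊆W |D| dense t = choose (search (W ∖ D) (λ u → 2 ≤? d D u))
        where
        beyond : ∀ u → u ∈ Z → u ∉ W → d D u ≤ 1
        beyond u p r = ≤-trans (d-⊆ {D} {W} u D⊆W) (sparse u p r)
        make : ∀ ℓ → (∀ u → u ∈ W → u ∉ D → u ≢ ℓ → d D u ≤ 1) → Finish Z q q′
        make ℓ calm = record
          { D = D ; X = ∅ ; D⊆Z = λ u p → W⊆Z u (D⊆W u p) ; X⊆Z = λ u () ; X∉D = λ u () ; |D| =
              |D| ; X-D = λ u () ; X-X = λ u ()
          ; ℓ = ℓ
          ; calm = λ u p r _ s → calm′ u p r s (u ∈? W)
          ; calmℓ = λ p r _ → calmℓ p r (ℓ ∈? W)
          ; quality = inj₁ dense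
          }
          where
          calm′ : ∀ u → u ∈ Z → u ∉ D → u ≢ ℓ → u ∈ W ⊎ u ∉ W → d D u ≤ 1
          calm′ u p r s (inj₁ w) = calm u w r s
          calm′ u p r s (inj₂ w) = beyond u p w
          calmℓ : ℓ ∈ Z → ℓ ∉ D → ℓ ∈ W ⊎ ℓ ∉ W → d D ℓ ≤ 2
          calmℓ p r (inj₁ w) = Tame.pending≤2 t ℓ w r
          calmℓ p r (inj₂ w) = ≤-trans (beyond ℓ p w) (s≤s z≤n)
        choose : (∃[ ℓ ] ℓ ∈ W ∖ D × 2 ≤ d D ℓ) ⊎ (∀ ℓ → ℓ ∈ W ∖ D → ¬ 2 ≤ d D ℓ) → Finish Z q q′
        choose (inj₁ (ℓ , p , 2≤ℓ)) = make ℓ calm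
          where
          calm : ∀ u → u ∈ W → u ∉ D → u ≢ ℓ → d D u ≤ 1
          calm u w r u≢ℓ with 2 ≤? d D u
          ... | no ¬2≤ = ≤-pred (≰⇒> ¬2≤)
          ... | yes 2≤ = ⊥-elim (u≢ℓ (Tame.pending-unique t u ℓ w r (∧⁻ˡ p) (∖⁻ {W ℓ} p) 2≤ 2≤ℓ))
        choose (inj₂ none) = make some λ u w r _ → ≤-pred (≰⇒> (none u (∖⁺ w r)))

      finish-grown : ∀ W → (W ⊆ Z) → (∀ u → u ∈ Z → u ∉ W → d W u ≤ 1) → Grown W q′ →
                     Finish Z q q′ ⊎ (q′ ≡ 3 × FourClique Z)
      finish-grown W W⊆Z sparse (tame D D⊆W |D| dense t) =
          inj₁ (finish-tame W W⊆Z sparse D D⊆W |D| dense t)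
      finish-grown W W⊆Z sparse (closed M M⊆W |M| M3) = finish-closed M (λ u p → W⊆Z u (M⊆W u p)) |M| M3
      finish-grown W W⊆Z sparse (cycles D X D⊆W X⊆W X∉D |D| dense X3 X-X X-D away) = inj₁ record
        { D = D ; X = X ; D⊆Z = λ u p → W⊆Z u (D⊆W u p) ; X⊆Z = λ u p → W⊆Z u (X⊆W u p) ; X∉D =
            X∉D ; |D| = |D| ; X-D = X-D ; X-X = X-X
        ; ℓ = some
        ; calm = λ u p r s _ → calm u p r s (u ∈? W)
        ; calmℓ = λ p r s → ≤-trans (calm some p r s (some ∈? W)) (s≤s z≤n)
        ; quality = inj₁ dense
        }
        where
        calm : ∀ u → u ∈ Z → u ∉ D → u ∉ X → u ∈ W ⊎ u ∉ W → d D u ≤ 1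
        calm u p r s (inj₁ w) = ≤-trans (≤-reflexive (away u w r s)) z≤n
        calm u p r s (inj₂ w) = ≤-trans (d-⊆ {D} {W} u D⊆W) (sparse u p w)

      -- `k` is the slack 6 + 2q - 2q′ of `Z-dense`. If peeling stops at q′ vertices, the core is D
      -- and the rest of Z is calm. Otherwise the core has minimum degree 2 and D is grown in it;
      -- the peeled vertices have at most one neighbour there.
      finish-peeled : ∀ {k} → k + 2 * q′ ≡ 6 + 2 * q → Peeled Z q′ k → Finish Z q q′ ⊎
          (q′ ≡ 3 × FourClique Z)
      finish-peeled {k} k≡ P = choose (Peeled.stopped P)
        where
        open Peeled P using (sparse; dense) renaming (core to W; core⊆ to W⊆Z)
        choose : count W ≡ q′ ⊎ (suc q′ ≤ count W × (∀ u → u ∈ W → 2 ≤ d W u)) → _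
        choose (inj₂ (big , deg)) = finish-grown W W⊆Z sparse (grow W q′ deg big)
        choose (inj₁ |W|) = inj₁ record
          { D = W ; X = ∅ ; D⊆Z = W⊆Z ; X⊆Z = λ u () ; X∉D = λ u () ; |D| = |W| ; X-D = λ u () ; X-X =
              λ u ()
          ; ℓ = some ; calm = λ u p r _ _ → sparse u p r ; calmℓ = λ p r _ → ≤-trans (sparse some p r)
              (s≤s z≤n)
          ; quality = inj₂ (sparse ,
              (linear (count W ∷ q ∷ q′ ∷ k ∷ e W ∷ []) (4 ⊗ x2 ≼ x4 ⊕ con 6 ⊕ 2 ⊗ x1) 0
              ( 1 · 2 ⊗ x0 ≼ x4 ⊕ x3 ∵ dense
              ⨾ 2 ·⁻ x0 ≐ x2 ∵ |W|
              ⨾ 1 · x3 ⊕ 2 ⊗ x2 ≐ con 6 ⊕ 2 ⊗ x1 ∵ k≡)))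
          }

      finish : Finish Z q q′ ⊎ (q′ ≡ 3 × FourClique Z)
      finish = choose (m≤n⇒∃[o]m+o≡n {2 * q′} {6 + 2 * q} (linear (q ∷ q′ ∷ []) (2 ⊗ x1 ≼ con 6 ⊕ 2 ⊗ x0)
          0 (2 · x1 ≼ con 1 ⊕ x0 ∵ q′≤)))
        where
        choose : (∃[ k ] 2 * q′ + k ≡ 6 + 2 * q) → _
        choose (k , eq) = finish-peeled (trans (+-comm k _) eq) (peel large
          (linear (count Z ∷ e Z ∷ k ∷ q ∷ q′ ∷ []) (2 ⊗ x0 ≼ x1 ⊕ x2) 0
              ( 1 ·⁻ 2 ⊗ x4 ⊕ x2 ≐ con 6 ⊕ 2 ⊗ x3 ∵ eq
              ⨾ 1 · 2 ⊗ x0 ⊕ 2 ⊗ x4 ≼ x1 ⊕ con 6 ⊕ 2 ⊗ x3 ∵ Z-dense)))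

  -- Choosing A

  module Starter {n} (G : CubicGraph n) where
    open Finisher G public
    open Balancing G public using (Balanced)

    module Zone (A Z : Sub n) (Z∉A : Z # A) (Z-far : ∀ u → u ∈ Z → d A u ≡ 0) where
      N : Sub n
      N = ∁ A ∖ Z

      N⁺ : ∀ {u} → u ∉ A → u ∉ Z → u ∈ N
      N⁺ p q = ∖⁺ (not⁺ p) q

      N⇒∉A : ∀ {u} → u ∈ N → u ∉ A
      N⇒∉A {u} p = not⁻ (∧⁻ˡ {not (A u)} p)

      N⇒∉Z : ∀ {u} → u ∈ N → u ∉ Z
      N⇒∉Z {u} p = ∖⁻ {not (A u)} p

      sizes : n ≡ count A + count N + count Z
      sizes = linear (n ∷ count {n} full ∷ count A ∷ count (∁ A) ∷ count N ∷ count Z ∷ count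
          (∁ A ∩ Z) ∷ [])
          (x0 ≐ x2 ⊕ x4 ⊕ x5) 0
          ( 1 ·⁻ x1 ≐ x0 ∵ count-full
          ⨾ 1 · x1 ≐ x2 ⊕ x3 ∵ count-split full A
          ⨾ 1 · x3 ≐ x6 ⊕ x4 ∵ count-split (∁ A) Z
          ⨾ 1 · x6 ≐ x5 ∵ count-cong inside)
        where
        inside : ∀ v → (∁ A ∩ Z) v ≡ Z v
        inside v = ⇔⇒≡ (∧⁻ʳ {not (A v)}) (λ p → ∧⁺ (not⁺ (Z∉A v p)) p)

      -- By `Z-far`, edges leaving Z do not end in A, hence they end in N.
      from-Z : 3 * count Z ≤ e Z + E adj N Z
      from-Z = linear (count Z ∷ ∑∈ Z (λ _ → 3) ∷ ∑∈ Z (λ u → d Z u + d N u) ∷ e Z ∷ E adj Z N ∷ E adj N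
          Z ∷ [])
          (3 ⊗ x0 ≼ x3 ⊕ x5) 0
          ( 1 ·⁻ x1 ≐ 3 ⊗ x0 ∵ ∑-const Z 3
          ⨾ 1 · x1 ≼ x2 ∵ ∑-mono Z cover
          ⨾ 1 · x2 ≐ x3 ⊕ x4 ∵ ∑-+ Z (d Z) (d N)
          ⨾ 1 · x4 ≐ x5 ∵ E-symᵃ Z N)
        where
        cover : ∀ u → u ∈ Z → 3 ≤ d Z u + d N u
        cover u p = linear (d Z u ∷ d N u ∷ d (∁ Z) u ∷ []) (con 3 ≼ x0 ⊕ x1) 0
            ( 1 ·⁻ x0 ⊕ x2 ≐ con 3 ∵ d-∁ Z u
            ⨾ 1 · x2 ≼ x1 ∵ count-⊆ {P = adj u ∩ ∁ Z}
                (λ v q → ∧⁺ (∧⁻ˡ {adj u v} q) (N⁺ (d-zero A (Z-far u p) (∧⁻ˡ q))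
                (not⁻ (∧⁻ʳ {adj u v} q)))))

      from-N : E adj N Z + E adj N A ≤ 3 * count N
      from-N = ≤-trans (≤-reflexive (sym (∑-+ N (d Z) (d A))))
          (≤-trans (∑-mono N λ u _ → d-disjoint Z A u Z∉A) (≤-reflexive (∑-const N 3)))

      from-A : E adj N A + e A ≤ 3 * count A
      from-A = linear (E adj N A ∷ E adj A N ∷ E adj A (∁ A) ∷ e A ∷ count A ∷ []) (x0 ⊕ x3 ≼ 3 ⊗ x4) 0
          ( 1 · x0 ≐ x1 ∵ E-symᵃ N A
          ⨾ 1 · x1 ≼ x2 ∵ ∑-mono A (λ u _ → d-⊆ {N} {∁ A} u λ v → ∧⁻ˡ)
          ⨾ 1 · x3 ⊕ x2 ≐ 3 ⊗ x4 ∵ boundary A)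

    module _ {q q′ : ℕ} (n≡ : n ≡ 2 * q + 2 * q′) (q≤q′ : q ≤ q′) (q′≤1+q : q′ ≤ 1 + q) (2≤q′ : 2 ≤ q′)
        where

      module Sized (A Z : Sub n) (Z∉A : Z # A) (Z-far : ∀ u → u ∈ Z → d A u ≡ 0) (|A| : count A ≡ q)
          (dense : 2 * q ≤ e A + 2) where
        open Zone A Z Z∉A Z-far public

        N+Z : count N + count Z ≡ q + 2 * q′
        N+Z = linear (n ∷ q ∷ q′ ∷ count A ∷ count N ∷ count Z ∷ []) (x4 ⊕ x5 ≐ x1 ⊕ 2 ⊗ x2) 0
            ( 1 ·⁻ x0 ≐ x3 ⊕ x4 ⊕ x5 ∵ sizes
            ⨾ 1 ·⁻ x3 ≐ x1 ∵ |A|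
            ⨾ 1 · x0 ≐ 2 ⊗ x1 ⊕ 2 ⊗ x2 ∵ n≡)

        few : E adj N A ≤ q + 2
        few = linear (q ∷ count A ∷ E adj N A ∷ e A ∷ []) (x2 ≼ x0 ⊕ con 2) 0
            ( 1 · x2 ⊕ x3 ≼ 3 ⊗ x1 ∵ from-A
            ⨾ 3 · x1 ≐ x0 ∵ |A|
            ⨾ 1 · 2 ⊗ x0 ≼ x3 ⊕ con 2 ∵ dense)

      module Far (A : Sub n) (|A| : count A ≡ q) (dense : 2 * q ≤ e A + 2) where
        -- The largest zone allowed. Every vertex of the remaining layer N then has an edge to A,
        -- which bounds N by the boundary of A.
        Z : Sub n
        Z = ∁ A where? (λ u → d A u ℕ.≟ 0)

        Z⁺ : ∀ {u} → u ∉ A → d A u ≡ 0 → u ∈ Z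
        Z⁺ p r = where⁺ (∁ A) (λ u → d A u ℕ.≟ 0) (not⁺ p) r

        Z∉A : Z # A
        Z∉A u p = not⁻ (∧⁻ˡ {not (A u)} p)

        Z-far : ∀ u → u ∈ Z → d A u ≡ 0
        Z-far u p = where⁻ (∁ A) (λ u → d A u ℕ.≟ 0) p

        near : ∀ u → u ∉ A → u ∉ Z → 1 ≤ d A u
        near u p r with 1 ≤? d A u
        ... | yes s = s
        ... | no ¬s = clash (Z⁺ p (n<1⇒n≡0 (≰⇒> ¬s))) r

        open Sized A Z Z∉A Z-far |A| dense public

        N≤ : count N ≤ E adj N A
        N≤ = ≤-trans (≤-reflexive (trans (sym (*-identityˡ _)) (sym (∑-const N 1)))) (∑-mono N λ u p →
            near u (N⇒∉A p) (N⇒∉Z p))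

        -- N has at most q + 2 vertices, so Z has at least 2q′ - 2.
        Z-large : q′ ≤ count Z
        Z-large = linear (q ∷ q′ ∷ count N ∷ count Z ∷ E adj N A ∷ []) (x1 ≼ x3) 0
            ( 1 ·⁻ x2 ⊕ x3 ≐ x0 ⊕ 2 ⊗ x1 ∵ N+Z
            ⨾ 1 · x2 ≼ x4 ∵ N≤
            ⨾ 1 · x4 ≼ x0 ⊕ con 2 ∵ few
            ⨾ 1 · con 2 ≼ x1 ∵ 2≤q′)

        Z-larger : 5 ≤ q′ → 2 + q′ ≤ count Z
        Z-larger 5≤ = linear (q ∷ q′ ∷ count N ∷ count Z ∷ E adj N A ∷ []) (con 2 ⊕ x1 ≼ x3) 7
            ( 7 ·⁻ x2 ⊕ x3 ≐ x0 ⊕ 2 ⊗ x1 ∵ N+Z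
            ⨾ 7 · x2 ≼ x4 ∵ N≤
            ⨾ 7 · x4 ≼ x0 ⊕ con 2 ∵ few
            ⨾ 6 · con 5 ≼ x1 ∵ 5≤)

        -- Let x be the number of edges from N to A. Edges leaving Z end in N, so `e Z` ≥ 3|Z| -
        -- 3|N| + x. With |N| + |Z| = q + 2q′ the claim becomes 4|N| ≤ x + 3(q + 2), which follows
        -- from |N| ≤ x ≤ q + 2; this is the origin of the 6.
        Z-dense : 2 * count Z + 2 * q′ ≤ e Z + 6 + 2 * q
        Z-dense = linear (q ∷ q′ ∷ count N ∷ count Z ∷ E adj N A ∷ E adj N Z ∷ e Z ∷ [])
            (2 ⊗ x3 ⊕ 2 ⊗ x1 ≼ x6 ⊕ con 6 ⊕ 2 ⊗ x0) 0
            ( 1 ·⁻ x2 ⊕ x3 ≐ x0 ⊕ 2 ⊗ x1 ∵ N+Z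
            ⨾ 4 · x2 ≼ x4 ∵ N≤
            ⨾ 3 · x4 ≼ x0 ⊕ con 2 ∵ few
            ⨾ 1 · 3 ⊗ x3 ≼ x6 ⊕ x5 ∵ from-Z
            ⨾ 1 · x5 ⊕ x4 ≼ 3 ⊗ x2 ∵ from-N)

      start-calm : (A : Sub n) → count A ≡ q → 2 * q ≤ e A + 2 → (∀ u → u ∉ A → d A u ≤ 1) → Start q q′
      start-calm A |A| dense calm = record
        { A = A ; I = ∅ ; O = ∅ ; Z = Z ; |A| = |A| ; A-dense = ≤-trans dense
            (+-monoʳ-≤ (e A) (s≤s (s≤s z≤n)))
        ; Z∉A = Z∉A ; Z-far = Z-far ; I∉A = λ u () ; O∉A = λ u () ; I∉Z = λ u () ; O∉Z = λ u () ; I#O =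
            λ u v _ ()
        ; outer = λ u p r → out-only refl (inj₁ (≤-antisym (calm u p) (near u p r) , refl))
        ; lone = λ u v p r _ _ z → ⊥-elim (1≰0 (subst (1 ≤_) z (near u p r)))
        ; large = Z-large ; larger = Z-larger ; Z-dense = Z-dense
        }
        where open Far A |A| dense

      -- The vertex ℓ is satisfied by forcing in the edge to its third neighbour w. If w has no
      -- neighbour in A, then w and at most one further neighbour r of w are withheld from Z, so that
      -- w is not forced by D as well.
      module Pending (A : Sub n) (|A| : count A ≡ q) (dense : 2 * q ≤ e A + 2) (ℓ w : Fin n) (ℓ∉A : ℓ ∉ A)
          (dℓ : d A ℓ ≡ 2)
        (calm : ∀ u → u ∉ A → u ≢ ℓ → d A u ≤ 1) (ℓw : w ∈ adj ℓ) (w∉A : w ∉ A) where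

        open Far A |A| dense renaming (Z to Z₀)

        I : Sub n
        I = ⁅ ℓ ⁆ ∪ ⁅ w ⁆

        ℓ∈I : ℓ ∈ I
        ℓ∈I = ∨⁺ˡ (⁅⁆-refl ℓ)

        w∈I : w ∈ I
        w∈I = ∨⁺ʳ {⁅ ℓ ⁆ w} (⁅⁆-refl w)

        ℓ≢w : ℓ ≢ w
        ℓ≢w = adj⇒≢ ℓw

        I-cases : ∀ {u} → u ∈ I → u ≡ ℓ ⊎ u ≡ w
        I-cases {u} p with ∨⁻ {⁅ ℓ ⁆ u} p
        ... | inj₁ r = inj₁ (⁅⁆⇒≡ r)
        ... | inj₂ r = inj₂ (⁅⁆⇒≡ r)

        ∉I : ∀ {u} → u ≢ ℓ → u ≢ w → u ∉ I
        ∉I p r = ∪-no (≢⇒∉⁅⁆ p) (≢⇒∉⁅⁆ r)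

        I∉A : I # A
        I∉A u p with I-cases p
        ... | inj₁ refl = ℓ∉A
        ... | inj₂ refl = w∉A

        1≤dIℓ : 1 ≤ d I ℓ
        1≤dIℓ = d-pos I ℓw w∈I

        1≤dIw : 1 ≤ d I w
        1≤dIw = d-pos I (adj⁻¹ ℓw) ℓ∈I

        1≤dℓ : 1 ≤ d A ℓ
        1≤dℓ = ≤-trans (s≤s z≤n) (≤-reflexive (sym dℓ))

        near-one : ∀ u → u ∉ A → u ≢ ℓ → 1 ≤ d A u → d A u ≡ 1
        near-one u p r s = ≤-antisym (calm u p r) s

        ℓ∉Z₀ : ℓ ∉ Z₀
        ℓ∉Z₀ = refute λ p → 1≰0 (subst (1 ≤_) (Z-far ℓ p) 1≤dℓ)

        -- ℓ has two edges to A. The additional edge pays for the vertices withheld from Z below.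
        extra : suc (count N) ≤ E adj N A
        extra = linear (count N ∷ E adj N A ∷ ∑∈ N (λ u → 1 + ind (⁅ ℓ ⁆ u)) ∷ ∑∈ N (λ _ → 1) ∷ ∑∈ N
            (ind ∘ ⁅ ℓ ⁆) ∷ ∑∈ ⁅ ℓ ⁆ (ind ∘ ⁅ ℓ ⁆) ∷ [])
            (con 1 ⊕ x0 ≼ x1) 0
            ( 1 ·⁻ x2 ≐ x3 ⊕ x4 ∵ ∑-+ N (λ _ → 1) (ind ∘ ⁅ ℓ ⁆)
            ⨾ 1 ·⁻ x3 ≐ 1 ⊗ x0 ∵ ∑-const N 1
            ⨾ 1 · x5 ≼ x4 ∵ ∑-⊆ ⁅ ℓ ⁆ N (ind ∘ ⁅ ℓ ⁆) ℓ⊆N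
            ⨾ 1 ·⁻ x5 ≐ con 1 ∵ trans (∑-⁅⁆ ℓ (ind ∘ ⁅ ℓ ⁆)) (cong ind (⁅⁆-refl ℓ))
            ⨾ 1 · x2 ≼ x1 ∵ ∑-mono N (λ u p → bound u p (⁅ ℓ ⁆ u) refl))
          where
          ℓ⊆N : ∀ v → v ∈ ⁅ ℓ ⁆ → v ∈ N
          ℓ⊆N v p = subst (_∈ N) (sym (⁅⁆⇒≡ p)) (N⁺ ℓ∉A ℓ∉Z₀)
          bound : ∀ u → u ∈ N → ∀ b → ⁅ ℓ ⁆ u ≡ b → 1 + ind b ≤ d A u
          bound u p true  r = subst (λ v → 2 ≤ d A v) (sym (⁅⁆⇒≡ r)) (≤-reflexive (sym dℓ))
          bound u p false r = near u (N⇒∉A p) (N⇒∉Z p)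

        -- Both ends of ℓw have an edge to A, so forcing ℓw in satisfies them at once.
        start-a : 1 ≤ d A w → Start q q′
        start-a 1≤dw = record
          { A = A ; I = I ; O = ∅ ; Z = Z₀ ; |A| = |A| ; A-dense = ≤-trans dense
              (+-monoʳ-≤ (e A) (s≤s (s≤s z≤n)))
          ; Z∉A = Z∉A ; Z-far = Z-far ; I∉A = I∉A ; O∉A = λ u () ; I∉Z = I∉Z ; O∉Z = λ u () ; I#O =
              λ u v _ _ _ ()
          ; outer = outer
          ; lone = λ u v p r _ _ z → ⊥-elim (1≰0 (subst (1 ≤_) z (near u p r)))
          ; large = Z-large ; larger = Z-larger ; Z-dense = Z-dense
          }
          where
          I∉Z : I # Z₀
          I∉Z u p with I-cases p
          ... | inj₁ refl = ℓ∉Z₀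
          ... | inj₂ refl = refute λ s → 1≰0 (subst (1 ≤_) (Z-far w s) 1≤dw)
          outer : ∀ u → u ∉ A → u ∉ Z₀ → Outer A I ∅ Z₀ u
          outer u p r with u ≟ ℓ
          ... | yes refl = settled ℓ∈I 1≤dIℓ (inj₁ 1≤dℓ)
          ... | no u≢ℓ with u ≟ w
          ...   | yes refl = settled w∈I 1≤dIw (inj₁ 1≤dw)
          ...   | no u≢w   = out-only (∉I u≢ℓ u≢w) (inj₁ (near-one u p u≢ℓ (near u p r) , refl))

        module _ (3≤q′ : 3 ≤ q′) (dw : d A w ≡ 0) where

          w∈Z₀ : w ∈ Z₀
          w∈Z₀ = Z⁺ w∉A dw

          -- Withholding w loses no edge of the zone, and D cannot touch w, so ℓw stays the only
          -- forced edge there.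
          start-c : d Z₀ w ≡ 0 → Start q q′
          start-c dZw = record
            { A = A ; I = I ; O = ∅ ; Z = Z ; |A| = |A| ; A-dense = ≤-trans dense
                (+-monoʳ-≤ (e A) (s≤s (s≤s z≤n)))
            ; Z∉A = λ u p → Z∉A u (∧⁻ˡ p) ; Z-far = λ u p → Z-far u (∧⁻ˡ p) ; I∉A = I∉A ; O∉A =
                λ u () ; I∉Z = I∉Z ; O∉Z = λ u () ; I#O = λ u v _ _ _ ()
            ; outer = outer
            ; lone = λ u v p r _ _ z _ 2≤ _ → ⊥-elim (lone u p r z 2≤)
            ; large = linear (q ∷ q′ ∷ count N ∷ count Z₀ ∷ count Z ∷ E adj N A ∷ []) (x1 ≼ x4) 3
                ( 3 ·⁻ x2 ⊕ x3 ≐ x0 ⊕ 2 ⊗ x1 ∵ N+Z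
                ⨾ 3 · con 1 ⊕ x2 ≼ x5 ∵ extra
                ⨾ 3 · x5 ≼ x0 ⊕ con 2 ∵ few
                ⨾ 2 · con 3 ≼ x1 ∵ 3≤q′
                ⨾ 3 · x3 ≐ con 1 ⊕ x4 ∵ count-delete Z₀ w∈Z₀)
            ; larger = λ 5≤ → (linear (q ∷ q′ ∷ count N ∷ count Z₀ ∷ count Z ∷ E adj N A ∷ [])
                (con 2 ⊕ x1 ≼ x4) 7
                ( 7 ·⁻ x2 ⊕ x3 ≐ x0 ⊕ 2 ⊗ x1 ∵ N+Z
                ⨾ 7 · con 1 ⊕ x2 ≼ x5 ∵ extra
                ⨾ 7 · x5 ≼ x0 ⊕ con 2 ∵ few
                ⨾ 6 · con 5 ≼ x1 ∵ 5≤
                ⨾ 7 · x3 ≐ con 1 ⊕ x4 ∵ count-delete Z₀ w∈Z₀))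
            ; Z-dense = linear (q ∷ q′ ∷ count Z₀ ∷ count Z ∷ e Z₀ ∷ e Z ∷ d Z₀ w ∷ [])
                (2 ⊗ x3 ⊕ 2 ⊗ x1 ≼ x5 ⊕ con 6 ⊕ 2 ⊗ x0) 0
                ( 1 · 2 ⊗ x2 ⊕ 2 ⊗ x1 ≼ x4 ⊕ con 6 ⊕ 2 ⊗ x0 ∵ Z-dense
                ⨾ 2 ·⁻ x2 ≐ con 1 ⊕ x3 ∵ count-delete Z₀ w∈Z₀
                ⨾ 1 · x4 ≐ x5 ⊕ 2 ⊗ x6 ∵ e-delete Z₀ w∈Z₀
                ⨾ 2 · x6 ≐ con 0 ∵ dZw)
            }
            where
            Z = Z₀ ∖ ⁅ w ⁆
            not-Z₀ : ∀ u → u ∉ Z → u ≢ w → u ∉ Z₀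
            not-Z₀ u r u≢w = refute λ s → clash (∖⁺ s (≢⇒∉⁅⁆ u≢w)) r
            I∉Z : I # Z
            I∉Z u p with I-cases p
            ... | inj₁ refl = refute λ s → clash (∧⁻ˡ s) ℓ∉Z₀
            ... | inj₂ refl = deleted Z₀
            outer : ∀ u → u ∉ A → u ∉ Z → Outer A I ∅ Z u
            outer u p r with u ≟ ℓ
            ... | yes refl = settled ℓ∈I 1≤dIℓ (inj₁ 1≤dℓ)
            ... | no u≢ℓ with u ≟ w
            ...   | no u≢w   = out-only (∉I u≢ℓ u≢w) (inj₁ (near-one u p u≢ℓ (near u p (not-Z₀ u r u≢w)) ,
                refl))
            ...   | yes refl = in-only refl dw dI
                (n≤0⇒n≡0 (≤-trans (d-⊆ {Z} {Z₀} w λ v → ∧⁻ˡ) (≤-reflexive dZw)))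
              where
              dI : d I w ≡ 1
              dI = ≤-antisym (≤-pred
                  (≤-trans (d<count I w∈I)
                  (≤-reflexive (trans (count-insert ⁅ ℓ ⁆ (≢⇒∉⁅⁆ (ℓ≢w ∘ sym)))
                  (cong suc (count-⁅⁆ ℓ)))))) 1≤dIw
            lone : ∀ u → u ∉ A → u ∉ Z → d A u ≡ 0 → 2 ≤ d Z u → ⊥
            lone u p r z 2≤ with u ≟ w
            ... | no u≢w   = 1≰0 (subst (1 ≤_) z (near u p (not-Z₀ u r u≢w)))
            ... | yes refl = n≮0 (≤-trans 2≤ (≤-trans (d-⊆ {Z} {Z₀} w λ v → ∧⁻ˡ) (≤-reflexive dZw)))

          -- Forcing wr out satisfies w. Then r has to leave the zone too, because an edge forced
          -- out must not meet D. Of the withheld vertices only r can have two neighbours in Z: w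
          -- has ℓ and r outside.
          start-b : ∀ {r} → r ∈ adj w → r ∈ Z₀ → Start q q′
          start-b {r} wr r∈Z₀ = record
            { A = A ; I = I ; O = O ; Z = Z ; |A| = |A| ; A-dense = ≤-trans dense
                (+-monoʳ-≤ (e A) (s≤s (s≤s z≤n)))
            ; Z∉A = λ u p → Z∉A u (Z⊆ u p) ; Z-far = λ u p → Z-far u (Z⊆ u p) ; I∉A = I∉A ; O∉A = λ u p →
                Z∉A u (O⊆Z₀ u p) ; I∉Z = I∉Z ; O∉Z = O∉Z ; I#O = I#O
            ; outer = outer
            ; lone = λ u v p s p′ s′ z z′ 2≤u 2≤v → trans (lone u p s z 2≤u) (sym (lone v p′ s′ z′ 2≤v))
            ; large = linear (q ∷ q′ ∷ count N ∷ count Z₀ ∷ count Z₁ ∷ count Z ∷ E adj N A ∷ []) (x1 ≼ x5)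
                0
                ( 1 ·⁻ x2 ⊕ x3 ≐ x0 ⊕ 2 ⊗ x1 ∵ N+Z
                ⨾ 1 · con 1 ⊕ x2 ≼ x6 ∵ extra
                ⨾ 1 · x6 ≼ x0 ⊕ con 2 ∵ few
                ⨾ 1 · con 3 ≼ x1 ∵ 3≤q′
                ⨾ 1 · x3 ≐ con 1 ⊕ x4 ∵ count-delete Z₀ w∈Z₀
                ⨾ 1 · x4 ≐ con 1 ⊕ x5 ∵ count-delete Z₁ r∈Z₁)
            ; larger = λ 5≤ → (linear (q ∷ q′ ∷ count N ∷ count Z₀ ∷ count Z₁ ∷ count Z ∷ E adj N A ∷ [])
                (con 2 ⊕ x1 ≼ x5) 0
                ( 1 ·⁻ x2 ⊕ x3 ≐ x0 ⊕ 2 ⊗ x1 ∵ N+Z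
                ⨾ 1 · con 1 ⊕ x2 ≼ x6 ∵ extra
                ⨾ 1 · x6 ≼ x0 ⊕ con 2 ∵ few
                ⨾ 1 · con 5 ≼ x1 ∵ 5≤
                ⨾ 1 · x3 ≐ con 1 ⊕ x4 ∵ count-delete Z₀ w∈Z₀
                ⨾ 1 · x4 ≐ con 1 ⊕ x5 ∵ count-delete Z₁ r∈Z₁))
            -- Withholding w and r lowers `e` by at most 8 but twice the size only by 4; the missing
            -- 4 is four times the gain of `extra`.
            ; Z-dense = linear (q ∷ q′ ∷ count N ∷ count Z₀ ∷ count Z₁ ∷ count Z ∷ E adj N A ∷ E adj N
                Z₀ ∷ e Z₀ ∷ e Z₁ ∷ e Z ∷ d Z₀ w ∷ d Z₁ r ∷ [])
                (2 ⊗ x5 ⊕ 2 ⊗ x1 ≼ x10 ⊕ con 6 ⊕ 2 ⊗ x0) 0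
                ( 1 ·⁻ x2 ⊕ x3 ≐ x0 ⊕ 2 ⊗ x1 ∵ N+Z
                ⨾ 4 · con 1 ⊕ x2 ≼ x6 ∵ extra
                ⨾ 3 · x6 ≼ x0 ⊕ con 2 ∵ few
                ⨾ 1 · 3 ⊗ x3 ≼ x8 ⊕ x7 ∵ from-Z
                ⨾ 1 · x7 ⊕ x6 ≼ 3 ⊗ x2 ∵ from-N
                ⨾ 2 ·⁻ x3 ≐ con 1 ⊕ x4 ∵ count-delete Z₀ w∈Z₀
                ⨾ 2 ·⁻ x4 ≐ con 1 ⊕ x5 ∵ count-delete Z₁ r∈Z₁
                ⨾ 1 · x8 ≐ x9 ⊕ 2 ⊗ x11 ∵ e-delete Z₀ w∈Z₀
                ⨾ 1 · x9 ≐ x10 ⊕ 2 ⊗ x12 ∵ e-delete Z₁ r∈Z₁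
                ⨾ 2 · x11 ≼ con 2 ∵ k≤2
                ⨾ 2 · x12 ≼ con 2 ∵ j≤2)
            }
            where
            Z₁ = Z₀ ∖ ⁅ w ⁆
            Z = Z₁ ∖ ⁅ r ⁆
            O = ⁅ w ⁆ ∪ ⁅ r ⁆
            r≢w : r ≢ w
            r≢w = adj⇒≢ wr ∘ sym
            r≢ℓ : r ≢ ℓ
            r≢ℓ = ∈∉⇒≢ Z₀ r∈Z₀ ℓ∉Z₀
            r∈Z₁ : r ∈ Z₁
            r∈Z₁ = ∖⁺ r∈Z₀ (≢⇒∉⁅⁆ r≢w)
            Z⊆ : Z ⊆ Z₀
            Z⊆ u p = ∧⁻ˡ {Z₀ u} (∧⁻ˡ p)
            O-cases : ∀ {u} → u ∈ O → u ≡ w ⊎ u ≡ r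
            O-cases {u} p with ∨⁻ {⁅ w ⁆ u} p
            ... | inj₁ s = inj₁ (⁅⁆⇒≡ s)
            ... | inj₂ s = inj₂ (⁅⁆⇒≡ s)
            O⊆Z₀ : O ⊆ Z₀
            O⊆Z₀ u p with O-cases p
            ... | inj₁ refl = w∈Z₀
            ... | inj₂ refl = r∈Z₀
            w∉Z : w ∉ Z
            w∉Z = refute λ s → clash (∧⁻ˡ s) (deleted Z₀)
            ℓ∉Z : ℓ ∉ Z
            ℓ∉Z = refute λ s → clash (Z⊆ ℓ s) ℓ∉Z₀
            I∉Z : I # Z
            I∉Z u p with I-cases p
            ... | inj₁ refl = ℓ∉Z
            ... | inj₂ refl = w∉Z
            O∉Z : O # Z
            O∉Z u p with O-cases p
            ... | inj₁ refl = w∉Z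
            ... | inj₂ refl = deleted Z₁
            I#O : ∀ u v → v ∈ adj u → u ∈ I → v ∈ I → u ∈ O → v ∉ O
            I#O u v uv u∈I v∈I u∈O with I-cases v∈I
            ... | inj₁ refl = ∪-no (≢⇒∉⁅⁆ ℓ≢w) (≢⇒∉⁅⁆ (r≢ℓ ∘ sym))
            ... | inj₂ refl with I-cases u∈I
            ...   | inj₁ refl = clash (O⊆Z₀ u u∈O) ℓ∉Z₀
            ...   | inj₂ refl = clash uv (loopless u)
            k≤2 : d Z₀ w ≤ 2
            k≤2 = linear (d Z₀ w ∷ d ⁅ ℓ ⁆ w ∷ []) (x0 ≼ con 2) 0
                ( 1 · x0 ⊕ x1 ≼ con 3 ∵ d-disjoint Z₀ ⁅ ℓ ⁆ w (λ v p → ≢⇒∉⁅⁆ (∈∉⇒≢ Z₀ p ℓ∉Z₀))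
                ⨾ 1 · con 1 ≼ x1 ∵ d-pos ⁅ ℓ ⁆ (adj⁻¹ ℓw) (⁅⁆-refl ℓ))
            j≤2 : d Z₁ r ≤ 2
            j≤2 = linear (d Z₁ r ∷ d ⁅ w ⁆ r ∷ []) (x0 ≼ con 2) 0
                ( 1 · x0 ⊕ x1 ≼ con 3 ∵ d-disjoint Z₁ ⁅ w ⁆ r (λ v p → ∖⁻ {Z₀ v} p)
                ⨾ 1 · con 1 ≼ x1 ∵ d-pos ⁅ w ⁆ (adj⁻¹ wr) (⁅⁆-refl w))
            not-Z₀ : ∀ u → u ∉ Z → u ≢ w → u ≢ r → u ∉ Z₀
            not-Z₀ u s u≢w u≢r = refute λ t → clash (∖⁺ (∖⁺ t (≢⇒∉⁅⁆ u≢w)) (≢⇒∉⁅⁆ u≢r)) s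
            r∈O : r ∈ O
            r∈O = ∨⁺ʳ {⁅ w ⁆ r} (⁅⁆-refl r)
            dOr : d O r ≡ 1
            dOr = ≤-antisym (≤-pred
                (≤-trans (d<count O r∈O)
                (≤-reflexive (trans (count-insert ⁅ w ⁆ (≢⇒∉⁅⁆ r≢w)) (cong suc (count-⁅⁆ w))))))
              (d-pos O (adj⁻¹ wr) (∨⁺ˡ (⁅⁆-refl w)))
            outer : ∀ u → u ∉ A → u ∉ Z → Outer A I O Z u
            outer u p s with u ≟ ℓ
            ... | yes refl = settled ℓ∈I 1≤dIℓ (inj₁ 1≤dℓ)
            ... | no u≢ℓ with u ≟ w
            ...   | yes refl = settled w∈I 1≤dIw (inj₂ (∨⁺ˡ (⁅⁆-refl w) , d-pos O wr r∈O))
            ...   | no u≢w with u ≟ r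
            ...     | yes refl = out-only (∉I u≢ℓ u≢w) (inj₂ (Z-far r r∈Z₀ , dOr , r∈O))
            ...     | no u≢r   = out-only (∉I u≢ℓ u≢w)
                (inj₁ (near-one u p u≢ℓ (near u p (not-Z₀ u s u≢w u≢r)) , ∪-no (≢⇒∉⁅⁆ u≢w) (≢⇒∉⁅⁆ u≢r)))
            lone : ∀ u → u ∉ A → u ∉ Z → d A u ≡ 0 → 2 ≤ d Z u → u ≡ r
            lone u p s z 2≤ with u ≟ r
            ... | yes u≡r = u≡r
            ... | no u≢r with u ≟ w
            ...   | no u≢w   = 1≰0 (subst (1 ≤_) z (near u p (not-Z₀ u s u≢w u≢r)))
            ...   | yes refl = 1≰0 (linear (d Z w ∷ d L w ∷ []) (con 1 ≼ con 0) 0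
                ( 1 · x0 ⊕ x1 ≼ con 3 ∵ d-disjoint Z L w disj
                ⨾ 1 · con 2 ≼ x0 ∵ 2≤
                ⨾ 1 · con 2 ≼ x1 ∵ two (adj w ∩ L) (∧⁺ (adj⁻¹ ℓw) (∨⁺ˡ (⁅⁆-refl ℓ)))
                    (∧⁺ wr (∨⁺ʳ {⁅ ℓ ⁆ r} (⁅⁆-refl r))) (r≢ℓ ∘ sym)))
              where
              L = ⁅ ℓ ⁆ ∪ ⁅ r ⁆
              disj : Z # L
              disj v t = ∪-no (≢⇒∉⁅⁆ (∈∉⇒≢ Z t ℓ∉Z)) (≢⇒∉⁅⁆ (∈∉⇒≢ Z t (deleted Z₁)))

        -- Here n = 8 and Z is too small for withholding vertices.
        start-small : q′ ≡ 2 → d A w ≡ 0 → Start q q′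
        start-small q′≡2 dw = start-calm I
          (trans |I| (sym q≡2))
          (linear (q ∷ e I ∷ e ⁅ ℓ ⁆ ∷ d ⁅ ℓ ⁆ w ∷ []) (2 ⊗ x0 ≼ x1 ⊕ con 2) 0
              ( 2 · x0 ≐ con 2 ∵ q≡2
              ⨾ 1 ·⁻ x1 ≐ x2 ⊕ 2 ⊗ x3 ∵ e-insert ⁅ ℓ ⁆ (≢⇒∉⁅⁆ (ℓ≢w ∘ sym))
              ⨾ 2 · con 1 ≼ x3 ∵ d-pos ⁅ ℓ ⁆ (adj⁻¹ ℓw) (⁅⁆-refl ℓ)))
          (λ u p → at-most u (2 ≤? d I u))
          where
          |I| : count I ≡ 2
          |I| = trans (count-insert ⁅ ℓ ⁆ (≢⇒∉⁅⁆ (ℓ≢w ∘ sym))) (cong suc (count-⁅⁆ ℓ))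
          q≡2 : q ≡ 2
          q≡2 = ≤-antisym (≤-trans q≤q′ (≤-reflexive q′≡2))
              (≤-trans (≤-reflexive (sym dℓ)) (≤-trans (d≤count A ℓ) (≤-reflexive |A|)))
          at-most : ∀ u → Dec (2 ≤ d I u) → d I u ≤ 1
          at-most u (no ¬p) = ≤-pred (≰⇒> ¬p)
          -- u is adjacent to ℓ and to w. As w has no neighbour in A, u lies outside A, but w is the
          -- only neighbour of ℓ there.
          at-most u (yes 2≤) = ⊥-elim (≢w (unique (adj ℓ ∩ ∁ A) (∧⁺ ℓu (not⁺ u∉A)) (∧⁺ ℓw (not⁺ w∉A))
              (linear (d A ℓ ∷ d (∁ A) ℓ ∷ []) (x1 ≼ con 1) 0
                  ( 1 · x0 ⊕ x1 ≐ con 3 ∵ d-∁ A ℓ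
                  ⨾ 1 ·⁻ x0 ≐ con 2 ∵ dℓ))))
            where
            I⊆ : I ⊆ adj u ∩ I
            I⊆ = ⊆-count⇒⊇ (adj u ∩ I) I (λ v → ∧⁻ʳ {adj u v}) (≤-trans (≤-reflexive |I|) 2≤)
            ℓu : u ∈ adj ℓ
            ℓu = adj⁻¹ (∧⁻ˡ (I⊆ ℓ ℓ∈I))
            wu : u ∈ adj w
            wu = adj⁻¹ (∧⁻ˡ (I⊆ w w∈I))
            ≢w : u ≢ w
            ≢w = adj⇒≢ wu ∘ sym
            u∉A : u ∉ A
            u∉A = d-zero A dw wu

        start-pending : Start q q′
        start-pending = by-w (1 ≤? d A w)
          where
          by-size : d A w ≡ 0 → Dec (3 ≤ q′) → Start q q′
          by-size dw (no ¬3≤) = start-small (≤-antisym (≤-pred (≰⇒> ¬3≤)) 2≤q′) dw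
          by-size dw (yes 3≤) = by-r (1 ≤? d Z₀ w)
            where
            with-r : (∃[ r ] r ∈ adj w × r ∈ Z₀) → Start q q′
            with-r (r , wr , r∈Z₀) = start-b 3≤ dw wr r∈Z₀
            by-r : Dec (1 ≤ d Z₀ w) → Start q q′
            by-r (yes p) = with-r (nbr Z₀ w p)
            by-r (no ¬p) = start-c 3≤ dw (n<1⇒n≡0 (≰⇒> ¬p))
          by-w : Dec (1 ≤ d A w) → Start q q′
          by-w (yes p) = start-a p
          by-w (no ¬p) = by-size (n<1⇒n≡0 (≰⇒> ¬p)) (3 ≤? q′)

      -- X has all its edges within A and X, and A has no other neighbours; so Z is a union of
      -- components with `e Z` = 3|Z|, as dense as possible.
      start-cycles : (A X : Sub n) → (X # A) → count A ≡ q → 2 * q ≤ e A + 2 →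
          (∀ u → u ∈ X → d A u + d X u ≡ 3) →
                     (∀ u → u ∈ X → 1 ≤ d X u) → (∀ u → u ∈ X → 1 ≤ d A u) →
                         (∀ u → u ∉ A → u ∉ X → d A u ≡ 0) → Start q q′
      start-cycles A X X∉A |A| dense X3 X-X X-A away = record
        { A = A ; I = X ; O = ∅ ; Z = Z ; |A| = |A| ; A-dense = ≤-trans dense
            (+-monoʳ-≤ (e A) (s≤s (s≤s z≤n)))
        ; Z∉A = Z∉A ; Z-far = Z-far ; I∉A = X∉A ; O∉A = λ u () ; I∉Z = λ u p → cong not (∨⁺ʳ {A u} p) ;
            O∉Z = λ u () ; I#O = λ u v _ _ _ ()
        ; outer = λ u p r → settled (in-X p r) (X-X u (in-X p r)) (inj₁ (X-A u (in-X p r)))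
        ; lone = λ u v p r _ _ z → ⊥-elim (1≰0 (subst (1 ≤_) z (X-A u (in-X p r))))
        ; large = linear (q ∷ q′ ∷ count N ∷ count Z ∷ E adj N A ∷ []) (x1 ≼ x3) 0
            ( 1 ·⁻ x2 ⊕ x3 ≐ x0 ⊕ 2 ⊗ x1 ∵ N+Z
            ⨾ 1 · x2 ≼ x4 ∵ N≤
            ⨾ 1 · x4 ≼ x0 ⊕ con 2 ∵ few
            ⨾ 1 · con 2 ≼ x1 ∵ 2≤q′)
        ; larger = λ 5≤ → (linear (q ∷ q′ ∷ count N ∷ count Z ∷ E adj N A ∷ []) (con 2 ⊕ x1 ≼ x3) 7
            ( 7 ·⁻ x2 ⊕ x3 ≐ x0 ⊕ 2 ⊗ x1 ∵ N+Z
            ⨾ 7 · x2 ≼ x4 ∵ N≤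
            ⨾ 7 · x4 ≼ x0 ⊕ con 2 ∵ few
            ⨾ 6 · con 5 ≼ x1 ∵ 5≤))
        ; Z-dense = linear (q ∷ q′ ∷ count Z ∷ e Z ∷ []) (2 ⊗ x2 ⊕ 2 ⊗ x1 ≼ x3 ⊕ con 6 ⊕ 2 ⊗ x0) 2
            ( 2 ·⁻ x3 ≐ 3 ⊗ x2 ∵ cubic-e Z3
            ⨾ 6 · x1 ≼ con 1 ⊕ x0 ∵ q′≤1+q)
        }
        where
        Z = ∁ (A ∪ X)
        Z∉A : Z # A
        Z∉A u p = ∪-noˡ (not⁻ p)
        Z∉X : Z # X
        Z∉X u p = ∪-noʳ {A u} (not⁻ p)
        Z-far : ∀ u → u ∈ Z → d A u ≡ 0
        Z-far u p = away u (Z∉A u p) (Z∉X u p)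
        open Sized A Z Z∉A Z-far |A| dense
        in-X : ∀ {u} → u ∉ A → u ∉ Z → u ∈ X
        in-X {u} p r with u ∈? X
        ... | inj₁ s = s
        ... | inj₂ s = clash (cong not (∪-no p s)) r
        N≤ : count N ≤ E adj N A
        N≤ = ≤-trans (≤-reflexive (trans (sym (*-identityˡ _)) (sym (∑-const N 1)))) (∑-mono N λ u p →
            X-A u (in-X (N⇒∉A p) (N⇒∉Z p)))
        AX : ∀ u → d (A ∪ X) u ≡ d A u + d X u
        AX u = d-∪ A X u λ v p → refute λ r → clash p (X∉A v r)
        Z3 : Closed Z
        Z3 u p = linear (d Z u ∷ d (A ∪ X) u ∷ d A u ∷ d X u ∷ []) (x0 ≐ con 3) 0
            ( 1 · x1 ⊕ x0 ≐ con 3 ∵ d-∁ (A ∪ X) u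
            ⨾ 1 ·⁻ x1 ≐ x2 ⊕ x3 ∵ AX u
            ⨾ 1 ·⁻ x2 ≐ con 0 ∵ Z-far u p
            ⨾ 1 ·⁻ x3 ≐ con 0 ∵ count-∅ (λ v → refute λ r →
                clash (d-all (A ∪ X) (trans (AX v) (X3 v (∧⁻ʳ {adj u v} r))) (adj⁻¹ (∧⁻ˡ r))) (not⁻ p)))

      -- A is M trimmed with a vertex z from outside, and Z avoids M, z and the neighbours of z.
      -- That Z avoids M ensures that a K₄ found in Z later is a second one.
      start-closed : (M : Sub n) → count M ≡ suc q → Closed M →
                     ∃[ S ] (∀ u → u ∈ Start.Z {q} {q′} S → u ∉ M)
      start-closed M |M| M3 =
          with-z (inhabited (∁ M) (linear (n ∷ q ∷ q′ ∷ count {n} full ∷ count M ∷ count (∁ M) ∷ [])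
          (con 1 ≼ x5) 2
          ( 1 ·⁻ x3 ≐ x0 ∵ count-full
          ⨾ 1 · x3 ≐ x4 ⊕ x5 ∵ count-split full M
          ⨾ 1 · x4 ≐ con 1 ⊕ x1 ∵ |M|
          ⨾ 1 ·⁻ x0 ≐ 2 ⊗ x1 ⊕ 2 ⊗ x2 ∵ n≡
          ⨾ 2 · con 2 ≼ x2 ∵ 2≤q′)))
        where
        3≤q : 3 ≤ q
        3≤q = ≤-pred (≤-trans
            (cubic-large M3 (proj₂ (inhabited M (≤-trans (s≤s z≤n) (≤-reflexive (sym |M|))))))
            (≤-reflexive |M|))
        with-z : (∃[ z ] z ∈ ∁ M) → ∃[ S ] (∀ u → u ∈ Start.Z {q} {q′} S → u ∉ M)
        with-z (z , pz) = record
          { A = T.D ; I = T.X ; O = ∅ ; Z = Z ; |A| = T.|D|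
          -- Trimming guarantees 3q - 7, which reaches 2q - 4 because q ≥ 3; hence the weaker bound
          -- demanded of A.
          ; A-dense = linear (q ∷ e T.D ∷ []) (2 ⊗ x0 ≼ x1 ⊕ con 4) 0
              ( 1 · 3 ⊗ x0 ≼ x1 ⊕ con 7 ∵ T.D-dense
              ⨾ 1 · con 3 ≼ x0 ∵ 3≤q)
          ; Z∉A = Z∉A ; Z-far = λ u p → trans (T.outside u (Z∉M u p))
              (cong ind (refute λ s → clash (adj⁻¹ s) (Z∉zz u p)))
          ; I∉A = T.X∉D ; O∉A = λ u () ; I∉Z = λ u p → refute λ s → clash (T.X⊆M u p) (Z∉M u s) ; O∉Z =
              λ u () ; I#O = λ u v _ _ _ ()
          ; outer = outer
          ; lone = λ u v p r _ _ zero′ → ⊥-elim (1≰0 (subst (1 ≤_) zero′ (near u p r)))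
          ; large = linear (q ∷ q′ ∷ count Z ∷ []) (x1 ≼ x2) 3
              ( 3 · x0 ⊕ 2 ⊗ x1 ≼ x2 ⊕ con 5 ∵ |Z|
              ⨾ 5 · con 3 ≼ x0 ∵ 3≤q
              ⨾ 2 · x0 ≼ x1 ∵ q≤q′)
          ; larger = λ 5≤ → (linear (q ∷ q′ ∷ count Z ∷ []) (con 2 ⊕ x1 ≼ x2) 7
              ( 7 · x0 ⊕ 2 ⊗ x1 ≼ x2 ⊕ con 5 ∵ |Z|
              ⨾ 7 · con 3 ≼ x0 ∵ 3≤q
              ⨾ 6 · con 5 ≼ x1 ∵ 5≤))
          ; Z-dense = linear (q ∷ q′ ∷ count Z ∷ e Z ∷ []) (2 ⊗ x2 ⊕ 2 ⊗ x1 ≼ x3 ⊕ con 6 ⊕ 2 ⊗ x0) 2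
              ( 2 · 3 ⊗ x2 ≼ x3 ⊕ con 6 ∵ Z-dense
              ⨾ 6 · x1 ≼ con 1 ⊕ x0 ∵ q′≤1+q)
          } , Z∉M
          where
          z∉M : z ∉ M
          z∉M = not⁻ pz
          module T = Trimmed (trim M3 |M| z∉M)
          U = (M ∪ ⁅ z ⁆) ∪ adj z
          Z = ∁ U
          Z∉M : Z # M
          Z∉M u p = ∪-noˡ (∪-noˡ (not⁻ p))
          Z∉z : ∀ u → u ∈ Z → u ≢ z
          Z∉z u p refl = clash (⁅⁆-refl u) (∪-noʳ {M u} (∪-noˡ (not⁻ p)))
          Z∉zz : Z # adj z
          Z∉zz u p = ∪-noʳ {(M ∪ ⁅ z ⁆) u} (not⁻ p)
          Z∉A : Z # T.D
          Z∉A u p = refute λ s → aux (T.D⊆ u s)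
            where
            aux : u ∈ M ⊎ u ≡ z → ⊥
            aux (inj₁ s) = clash s (Z∉M u p)
            aux (inj₂ s) = Z∉z u p s
          place′ : ∀ u → u ∉ T.D → u ∉ Z → u ∈ T.X ⊎ (u ∉ M × u ∈ adj z)
          place′ u p r with u ∈? M
          ... | inj₁ s with T.M⊆ u s
          ...   | inj₁ t = clash t p
          ...   | inj₂ t = inj₁ t
          place′ u p r | inj₂ s with u ∈? adj z
          ... | inj₁ t = inj₂ (s , t)
          ... | inj₂ t = clash (cong not (∪-no (∪-no s (≢⇒∉⁅⁆ λ { refl → clash T.z∈D p })) t)) r
          next : ∀ {u} → u ∉ M → u ∈ adj z → d T.D u ≡ 1
          next {u} p r = trans (T.outside u p) (cong ind (adj⁻¹ r))
          near : ∀ u → u ∉ T.D → u ∉ Z → 1 ≤ d T.D u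
          near u p r with place′ u p r
          ... | inj₁ s       = T.X-D u s
          ... | inj₂ (s , t) = ≤-reflexive (sym (next s t))
          outer : ∀ u → u ∉ T.D → u ∉ Z → Outer T.D T.X ∅ Z u
          outer u p r with place′ u p r
          ... | inj₁ s       = settled s (T.X-X u s) (inj₁ (T.X-D u s))
          ... | inj₂ (s , t) = out-only (refute λ x → clash (T.X⊆M u x) s) (inj₁ (next s t , refl))
          |Z| : q + 2 * q′ ≤ count Z + 5
          |Z| = linear (n ∷ q ∷ q′ ∷ count {n} full ∷ count U ∷ count Z ∷ count M ∷ count
              (M ∪ ⁅ z ⁆) ∷ count (adj z) ∷ count (U ∩ (M ∪ ⁅ z ⁆)) ∷ count (U ∖ (M ∪ ⁅ z ⁆)) ∷ [])
              (x1 ⊕ 2 ⊗ x2 ≼ x5 ⊕ con 5) 0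
              ( 1 ·⁻ x3 ≐ x0 ∵ count-full
              ⨾ 1 · x3 ≐ x4 ⊕ x5 ∵ count-split full U
              ⨾ 1 · x4 ≐ x9 ⊕ x10 ∵ count-split U (M ∪ ⁅ z ⁆)
              ⨾ 1 · x9 ≼ x7 ∵ count-⊆ {P = U ∩ (M ∪ ⁅ z ⁆)} (λ v → ∧⁻ʳ {U v})
              ⨾ 1 · x10 ≼ x8 ∵ count-⊆ {P = U ∖ (M ∪ ⁅ z ⁆)}
                  (λ v p → other-part v (∨⁻ {(M ∪ ⁅ z ⁆) v} (∧⁻ˡ p)) (∖⁻ {U v} p))
              ⨾ 1 · x7 ≐ con 1 ⊕ x6 ∵ count-insert M z∉M
              ⨾ 1 · x6 ≐ con 1 ⊕ x1 ∵ |M|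
              ⨾ 1 · x8 ≐ con 3 ∵ cubic z
              ⨾ 1 ·⁻ x0 ≐ 2 ⊗ x1 ⊕ 2 ⊗ x2 ∵ n≡)
            where
            other-part : ∀ v → v ∈ M ∪ ⁅ z ⁆ ⊎ v ∈ adj z → v ∉ M ∪ ⁅ z ⁆ → v ∈ adj z
            other-part v (inj₁ p) r = clash p r
            other-part v (inj₂ p) r = p
          -- Edges leaving Z end at the three neighbours of z, and each of these has at most two,
          -- its third edge going to z.
          Z-dense : 3 * count Z ≤ e Z + 6
          Z-dense = linear (count Z ∷ ∑∈ Z (λ _ → 3) ∷ ∑∈ Z (λ u → d Z u + d (adj z) u) ∷ e Z ∷ E adj Z
              (adj z) ∷ E adj (adj z) Z ∷ ∑∈ (adj z) (λ _ → 2) ∷ count (adj z) ∷ [])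
              (3 ⊗ x0 ≼ x3 ⊕ con 6) 0
              ( 1 ·⁻ x1 ≐ 3 ⊗ x0 ∵ ∑-const Z 3
              ⨾ 1 · x1 ≼ x2 ∵ ∑-mono Z cover
              ⨾ 1 · x2 ≐ x3 ⊕ x4 ∵ ∑-+ Z (d Z) (d (adj z))
              ⨾ 1 · x4 ≐ x5 ∵ E-symᵃ Z (adj z)
              ⨾ 1 · x5 ≼ x6 ∵ ∑-mono (adj z) back
              ⨾ 1 · x6 ≐ 2 ⊗ x7 ∵ ∑-const (adj z) 2
              ⨾ 2 · x7 ≐ con 3 ∵ cubic z)
            where
            cover : ∀ u → u ∈ Z → 3 ≤ d Z u + d (adj z) u
            cover u p = linear (d U u ∷ d Z u ∷ d (adj z) u ∷ []) (con 3 ≼ x1 ⊕ x2) 0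
                ( 1 ·⁻ x0 ⊕ x1 ≐ con 3 ∵ d-∁ U u
                ⨾ 1 · x0 ≼ x2 ∵ count-⊆ {P = adj u ∩ U}
                    (λ v r → ∧⁺ (∧⁻ˡ {adj u v} r)
                    (which v (∧⁻ˡ r) (∨⁻ {(M ∪ ⁅ z ⁆) v} (∧⁻ʳ {adj u v} r)))))
              where
              which : ∀ v → v ∈ adj u → v ∈ M ∪ ⁅ z ⁆ ⊎ v ∈ adj z → v ∈ adj z
              which v uv (inj₂ r) = r
              which v uv (inj₁ r) with ∨⁻ {M v} r
              ... | inj₁ s = clash s (d-zero M (cubic-outside M3 (Z∉M u p)) uv)
              ... | inj₂ s = clash (adj⁻¹ (subst (_∈ adj u) (⁅⁆⇒≡ s) uv)) (Z∉zz u p)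
            back : ∀ y → y ∈ adj z → d Z y ≤ 2
            back y p = linear (d Z y ∷ d ⁅ z ⁆ y ∷ []) (x0 ≼ con 2) 0
                ( 1 · x0 ⊕ x1 ≼ con 3 ∵ d-disjoint Z ⁅ z ⁆ y (λ v r → ≢⇒∉⁅⁆ (Z∉z v r))
                ⨾ 1 · con 1 ≼ x1 ∵ d-pos ⁅ z ⁆ (adj⁻¹ p) (⁅⁆-refl z))

      start-tame : (A : Sub n) → count A ≡ q → 2 * q ≤ e A + 2 → Tame full A → Start q q′
      start-tame A |A| dense t = choose (search (∁ A) (λ u → 2 ≤? d A u))
        where
        choose : (∃[ ℓ ] ℓ ∈ ∁ A × 2 ≤ d A ℓ) ⊎ (∀ ℓ → ℓ ∈ ∁ A → ¬ 2 ≤ d A ℓ) → Start q q′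
        choose (inj₂ none) = start-calm A |A| dense λ u p → ≤-pred (≰⇒> (none u (not⁺ p)))
        choose (inj₁ (ℓ , p , 2≤ℓ)) = with-w (nbr (∁ A) ℓ (linear (d A ℓ ∷ d (∁ A) ℓ ∷ []) (con 1 ≼ x1) 0
            ( 1 ·⁻ x0 ⊕ x1 ≐ con 3 ∵ d-∁ A ℓ
            ⨾ 1 · x0 ≐ con 2 ∵ dℓ)))
          where
          ℓ∉A : ℓ ∉ A
          ℓ∉A = not⁻ p
          dℓ : d A ℓ ≡ 2
          dℓ = ≤-antisym (Tame.pending≤2 t ℓ refl ℓ∉A) 2≤ℓ
          calm : ∀ u → u ∉ A → u ≢ ℓ → d A u ≤ 1
          calm u r u≢ℓ with 2 ≤? d A u
          ... | no ¬2≤ = ≤-pred (≰⇒> ¬2≤)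
          ... | yes 2≤ = ⊥-elim (u≢ℓ (Tame.pending-unique t u ℓ refl r refl ℓ∉A 2≤ 2≤ℓ))
          with-w : (∃[ w ] w ∈ adj ℓ × w ∈ ∁ A) → Start q q′
          with-w (w , ℓw , w∉A) = Pending.start-pending A |A| dense ℓ w ℓ∉A dℓ calm ℓw (not⁻ w∉A)

      start : Start q q′
      start = from (grow full q
          (λ u _ → ≤-trans (s≤s (s≤s z≤n)) (≤-reflexive (sym (trans (d-full u) (cubic u)))))
        (linear (n ∷ q ∷ q′ ∷ count {n} full ∷ []) (con 1 ⊕ x1 ≼ x3) 1
            ( 1 ·⁻ x3 ≐ x0 ∵ count-full
            ⨾ 1 ·⁻ x0 ≐ 2 ⊗ x1 ⊕ 2 ⊗ x2 ∵ n≡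
            ⨾ 1 · con 2 ≼ x2 ∵ 2≤q′)))
        where
        from : Grown full q → Start q q′
        from (tame A _ |A| dense t) = start-tame A |A| dense t
        from (cycles A X _ _ X∉A |A| dense X3 X-X X-A away) = start-cycles A X X∉A |A| dense X3 X-X X-A
            (λ u → away u refl)
        from (closed M _ |M| M3) = proj₁ (start-closed M |M| M3)

      Independent3 : Set
      Independent3 = q ≡ 1 × q′ ≡ 2 × (∃[ P ] count P ≡ 3 × (∀ u → u ∈ P → d P u ≡ 0))

      TwoCliques : Set
      TwoCliques = q ≡ 3 × q′ ≡ 3 × (∃[ M ] ∃[ M′ ] (M # M′) × count M ≡ 4 × count M′ ≡ 4 ×
        Closed M × Closed M′)

      -- A is a single vertex, D a pair without an edge, and D has no neighbour in A: three
      -- independent vertices in a graph on six.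
      independent : (S : Start q q′) (F : Finish (Start.Z S) q q′) → q ≡ 1 → q′ ≡ 2 → e (Finish.D F) ≡ 0 →
          Independent3
      independent S F q≡1 q′≡2 eD = q≡1 , q′≡2 , P ,
        (linear (count A ∷ count D ∷ count P ∷ q ∷ q′ ∷ []) (x2 ≐ con 3) 0
            ( 1 · x2 ≐ x0 ⊕ x1 ∵ count-∪ A D A∩D
            ⨾ 1 · x0 ≐ x3 ∵ |A|
            ⨾ 1 · x1 ≐ x4 ∵ |D|
            ⨾ 1 · x3 ≐ con 1 ∵ q≡1
            ⨾ 1 · x4 ≐ con 2 ∵ q′≡2)) ,
        λ u p → count-∅ λ v → refute λ r → no-edge u v p (∧⁻ˡ r) (∧⁻ʳ {adj u v} r)
        where
        open Start S
        open Finish F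
        A∩D : A # D
        A∩D v p = refute λ r → clash p (Z∉A v (D⊆Z v r))
        P = A ∪ D
        no-edge : ∀ u v → u ∈ P → v ∈ adj u → v ∈ P → ⊥
        no-edge u v p uv r = cases (∨⁻ {A u} p) (∨⁻ {A v} r)
          where
          cases : u ∈ A ⊎ u ∈ D → v ∈ A ⊎ v ∈ D → ⊥
          cases (inj₁ s) (inj₁ t) = 1≰0 (linear (d A u ∷ count A ∷ q ∷ []) (con 1 ≼ con 0) 0
              ( 1 · con 1 ⊕ x0 ≼ x1 ∵ d<count A s
              ⨾ 1 · con 1 ≼ x0 ∵ d-pos A uv t
              ⨾ 1 · x1 ≐ x2 ∵ |A|
              ⨾ 1 · x2 ≐ con 1 ∵ q≡1))
          cases (inj₁ s) (inj₂ t) = clash s (d-zero A (Z-far v (D⊆Z v t)) (adj⁻¹ uv))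
          cases (inj₂ s) (inj₁ t) = clash t (d-zero A (Z-far u (D⊆Z u s)) uv)
          cases (inj₂ s) (inj₂ t) = 1≰0 (linear (∑∈ ⁅ u ⁆ (d D) ∷ e D ∷ d D u ∷ []) (con 1 ≼ con 0) 0
              ( 1 ·⁻ x0 ≐ x2 ∵ ∑-⁅⁆ u (d D)
              ⨾ 1 · x0 ≼ x1 ∵ ∑-⊆ ⁅ u ⁆ D (d D) (λ w z → subst (_∈ D) (sym (⁅⁆⇒≡ z)) s)
              ⨾ 1 · con 1 ≼ x2 ∵ d-pos D uv t
              ⨾ 1 · x1 ≐ con 0 ∵ eD))

      conclude : (S : Start q q′) (F : Finish (Start.Z S) q q′) → Balanced q q′ ⊎ Independent3
      conclude S F = by-size (3 ≤? q′) (3 * q′ ≤? 2 * q + 3) (2 * q′ ≤? e D + 2)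
        where
        D = Finish.D F
        by-size : Dec (3 ≤ q′) → Dec (3 * q′ ≤ 2 * q + 3) → Dec (2 * q′ ≤ e D + 2) → Balanced q q′ ⊎
            Independent3
        by-size (yes p) _ _ = inj₁ (combine n≡ q≤q′ q′≤1+q S F (inj₂ (inj₁ p)))
        by-size (no _) (yes p) _ = inj₁ (combine n≡ q≤q′ q′≤1+q S F (inj₂ (inj₂ p)))
        by-size (no _) (no _) (yes p) = inj₁ (combine n≡ q≤q′ q′≤1+q S F (inj₁ p))
        -- q′ = 2 and 2q + 3 < 6 leave only q = 1, and `e D` is even and below 2.
        by-size (no ¬3≤) (no ¬small) (no ¬dense) = inj₂ (independent S F
          (≤-antisym (linear (q ∷ q′ ∷ []) (x0 ≼ con 1) 1
              ( 3 · x1 ≐ con 2 ∵ q′≡2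
              ⨾ 1 · con 1 ⊕ 2 ⊗ x0 ⊕ con 3 ≼ 3 ⊗ x1 ∵ ≰⇒> ¬small)) (linear (q ∷ q′ ∷ []) (con 1 ≼ x0) 0
                  (1 ·⁻ x1 ≐ con 2 ∵ q′≡2 ⨾ 1 · x1 ≼ con 1 ⊕ x0 ∵ q′≤1+q))) q′≡2 (zero-e (e-even D)))
          where
          q′≡2 : q′ ≡ 2
          q′≡2 = ≤-antisym (≤-pred (≰⇒> ¬3≤)) 2≤q′
          zero-e : (∃[ k ] e D ≡ 2 * k) → e D ≡ 0
          zero-e (zero , eq) = eq
          zero-e (suc k , eq) = n≤0⇒n≡0 (linear (k ∷ e D ∷ 2 * suc k ∷ q′ ∷ []) (x1 ≼ con 0) 0
              ( 1 ·⁻ x1 ≐ x2 ∵ eq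
              ⨾ 1 ·⁻ x2 ≐ con 2 ⊕ 2 ⊗ x0 ∵ *-suc 2 k
              ⨾ 2 · con 1 ⊕ x1 ⊕ con 2 ≼ 2 ⊗ x3 ∵ ≰⇒> ¬dense
              ⨾ 4 · x3 ≐ con 2 ∵ q′≡2))

      Outcome : Set
      Outcome = (Balanced q q′ ⊎ Independent3) ⊎ TwoCliques

      attempt : (S : Start q q′) → Finish (Start.Z S) q q′ ⊎ (q′ ≡ 3 × FourClique (Start.Z S))
      attempt S = finish (≤-trans (s≤s z≤n) 2≤q′) q′≤1+q (Start.large S) (Start.larger S)
          (Start.Z-dense S)

      -- The first attempt can only fail by running into a component K₄; starting from that
      -- component instead then works unless G = 3K₄.
      retry : q′ ≡ 3 → FourClique full → Outcome
      retry q′≡3 (M , _ , |M| , M3) = by-q (q ℕ.≟ 3)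
        where
        two-cliques : q ≡ 3 → (S : Start q q′) → (Start.Z S # M) → FourClique (Start.Z S) → TwoCliques
        two-cliques q≡3 S Z∉M (M′ , M′⊆Z , |M′| , M′3) = q≡3 , q′≡3 , M , M′ ,
          (λ u p → refute λ r → clash p (Z∉M u (M′⊆Z u r))) , |M| , |M′| , M3 , M′3
        after : q ≡ 3 → (S : Start q q′) → (Start.Z S # M) →
                Finish (Start.Z S) q q′ ⊎ (q′ ≡ 3 × FourClique (Start.Z S)) → Outcome
        after q≡3 S _   (inj₁ F)       = inj₁ (conclude S F)
        after q≡3 S Z∉M (inj₂ (_ , K)) = inj₂ (two-cliques q≡3 S Z∉M K)
        S₂ : Split M
        S₂ = split M3 (≤-trans (s≤s z≤n) (≤-reflexive (sym |M|)))
        module P = Split S₂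
        -- Here q = 2 and n = 10: two adjacent vertices of the K₄ serve as X and the other two as A.
        six : q ≢ 3 → Start q q′
        six q≢3 = start-cycles P.Y P.X P.X∉Y
          (linear (q ∷ count M ∷ count P.Y ∷ []) (x2 ≐ x0) 0
              ( 1 ·⁻ x1 ≐ con 2 ⊕ x2 ∵ P.|M|
              ⨾ 1 · x1 ≐ con 4 ∵ |M|
              ⨾ 1 ·⁻ x0 ≐ con 2 ∵ q≡2 q≢3))
          (linear (q ∷ count M ∷ e M ∷ e P.Y ∷ []) (2 ⊗ x0 ≼ x3 ⊕ con 2) 0
              ( 1 · x2 ≐ x3 ⊕ con 10 ∵ P.eM
              ⨾ 1 ·⁻ x2 ≐ 3 ⊗ x1 ∵ cubic-e M3
              ⨾ 3 ·⁻ x1 ≐ con 4 ∵ |M|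
              ⨾ 2 · x0 ≐ con 2 ∵ q≡2 q≢3))
          (λ u p → trans (sym (P.degree u)) (M3 u (P.X⊆M u p))) P.X-X (split-Y M3 S₂)
          (λ u p r → n≤0⇒n≡0 (≤-trans (d-⊆ {P.Y} {M} u P.Y⊆M)
              (≤-reflexive (cubic-outside M3 (refute λ s → apart u p r (P.M⊆ u s))))))
          where
          q≡2 : q ≢ 3 → q ≡ 2
          q≡2 q≢3 = ≤-antisym (≤-pred (≤∧≢⇒< (≤-trans q≤q′ (≤-reflexive q′≡3)) q≢3))
              (≤-pred (≤-trans (≤-reflexive (sym q′≡3)) q′≤1+q))
          apart : ∀ u → u ∉ P.Y → u ∉ P.X → u ∈ P.Y ⊎ u ∈ P.X → ⊥
          apart u p r (inj₁ s) = clash s p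
          apart u p r (inj₂ s) = clash s r
        after-six : (q≢3 : q ≢ 3) → Finish (Start.Z (six q≢3)) q q′ ⊎
            (q′ ≡ 3 × FourClique (Start.Z (six q≢3))) → Outcome
        after-six q≢3 (inj₁ F) = inj₁ (conclude (six q≢3) F)
        -- Another K₄ would be disjoint from M, and the two vertices left over would form a closed
        -- set, which needs at least four.
        after-six q≢3 (inj₂ (_ , M′ , M′⊆Z , |M′| , M′3)) = ⊥-elim (too-small (inhabited L
            (linear (n ∷ q ∷ q′ ∷ count {n} full ∷ count U ∷ count L ∷ count M ∷ count M′ ∷ [])
                (con 1 ≼ x5) 1
                ( 1 ·⁻ x3 ≐ x0 ∵ count-full
                ⨾ 1 · x3 ≐ x4 ⊕ x5 ∵ count-split full U
                ⨾ 1 · x4 ≐ x6 ⊕ x7 ∵ |U|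
                ⨾ 1 · x6 ≐ con 4 ∵ |M|
                ⨾ 1 · x7 ≐ con 4 ∵ |M′|
                ⨾ 1 ·⁻ x0 ≐ 2 ⊗ x1 ⊕ 2 ⊗ x2 ∵ n≡
                ⨾ 4 ·⁻ x2 ≐ con 3 ∵ q′≡3
                ⨾ 2 · x2 ≼ con 1 ⊕ x1 ∵ q′≤1+q))))
          where
          U = M ∪ M′
          L = ∁ U
          M∩M′ : M # M′
          M∩M′ v p = refute λ r → apart′ v (M′⊆Z v r) (P.M⊆ v p)
            where
            apart′ : ∀ v → v ∈ Start.Z (six q≢3) → v ∈ P.Y ⊎ v ∈ P.X → ⊥
            apart′ v r (inj₁ s) = clash s (∪-noˡ {P.Y v} {P.X v} (not⁻ r))
            apart′ v r (inj₂ s) = clash s (∪-noʳ {P.Y v} {P.X v} (not⁻ r))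
          |U| : count U ≡ count M + count M′
          |U| = count-∪ M M′ M∩M′
          L3 : Closed L
          L3 u p = linear (d U u ∷ d L u ∷ d M u ∷ d M′ u ∷ []) (x1 ≐ con 3) 0
              ( 1 · x0 ⊕ x1 ≐ con 3 ∵ d-∁ U u
              ⨾ 1 ·⁻ x0 ≐ x2 ⊕ x3 ∵ d-∪ M M′ u M∩M′
              ⨾ 1 ·⁻ x2 ≐ con 0 ∵ cubic-outside M3 (∪-noˡ {M u} {M′ u} (not⁻ p))
              ⨾ 1 ·⁻ x3 ≐ con 0 ∵ cubic-outside M′3 (∪-noʳ {M u} {M′ u} (not⁻ p)))
          too-small : (∃[ u ] u ∈ L) → ⊥
          too-small (u , p) = 1≰0
              (linear (n ∷ q ∷ q′ ∷ count {n} full ∷ count U ∷ count L ∷ count M ∷ count M′ ∷ [])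
              (con 1 ≼ con 0) 1
              ( 1 · x3 ≐ x0 ∵ count-full
              ⨾ 1 ·⁻ x3 ≐ x4 ⊕ x5 ∵ count-split full U
              ⨾ 1 ·⁻ x4 ≐ x6 ⊕ x7 ∵ |U|
              ⨾ 1 ·⁻ x6 ≐ con 4 ∵ |M|
              ⨾ 1 ·⁻ x7 ≐ con 4 ∵ |M′|
              ⨾ 1 · x0 ≐ 2 ⊗ x1 ⊕ 2 ⊗ x2 ∵ n≡
              ⨾ 2 · x2 ≐ con 3 ∵ q′≡3
              ⨾ 2 · x1 ≼ con 2 ∵ ≤-pred (≤∧≢⇒< (≤-trans q≤q′ (≤-reflexive q′≡3)) q≢3)
              ⨾ 1 · con 4 ≼ x5 ∵ cubic-large L3 p))
        by-q : Dec (q ≡ 3) → Outcome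
        by-q (no q≢3) = after-six q≢3 (attempt (six q≢3))
        by-q (yes q≡3) = let S , Z∉M = start-closed M (trans |M| (cong suc (sym q≡3))) M3 in after q≡3 S
            Z∉M (attempt S)

      outcome : Outcome
      outcome = first start (attempt start)
        where
        first : (S : Start q q′) → Finish (Start.Z S) q q′ ⊎ (q′ ≡ 3 × FourClique (Start.Z S)) → Outcome
        first S (inj₁ F) = inj₁ (conclude S F)
        first S (inj₂ (q′≡3 , M , _ , |M| , M3)) = retry q′≡3 (M , (λ _ _ → refl) , |M| , M3)

  -- Deviations

  ∣⊖∣≤ : ∀ x n c → x ≤ n + c → n ≤ x + c → ℤ.∣ x ⊖ n ∣ ≤ c
  ∣⊖∣≤ x n c p q with ≤-total x n
  ... | inj₁ x≤n = subst (_≤ c) (sym (ℤ.∣⊖∣-≤ x≤n)) (m≤n+o⇒m∸n≤o n x q)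
  ... | inj₂ n≤x = subst (_≤ c) (sym (trans (ℤ.∣m⊖n∣≡∣n⊖m∣ x n) (ℤ.∣⊖∣-≤ n≤x))) (m≤n+o⇒m∸n≤o x n p)

  -- Computed with unnormalised fractions, where a/1 - n/4 has the numerator 4a - n, so that only
  -- natural numbers have to be compared.
  near-quarter : ∀ a n c → 4 * a ≤ n + 2 * c → n ≤ 4 * a + 2 * c → ℚ.∣ ℤ.+ a ℚ./ 1 ℚ.- ℤ.+ n ℚ./ 4 ∣ ℚ.≤
      ℤ.+ c ℚ./ 2
  near-quarter a n c p q =
      ℚ.toℚᵘ-cancel-≤ (ℚᵘ.≤-respˡ-≃ (ℚᵘ.≃-sym lhs)
      (ℚᵘ.≤-respʳ-≃ (ℚᵘ.≃-sym (ℚ.toℚᵘ-fromℚᵘ (mkℚᵘ (ℤ.+ c) 1))) middle))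
    where
    P = mkℚᵘ (ℤ.+ a) 0
    N = mkℚᵘ (ℤ.+ n) 3
    lhs : toℚᵘ ℚ.∣ ℤ.+ a ℚ./ 1 ℚ.- ℤ.+ n ℚ./ 4 ∣ ℚᵘ.≃ ℚᵘ.∣ P ℚᵘ.- N ∣
    lhs = ℚᵘ.≃-trans (ℚ.toℚᵘ-homo-∣-∣ (ℤ.+ a ℚ./ 1 ℚ.- ℤ.+ n ℚ./ 4)) (ℚᵘ.∣-∣-cong
      (ℚᵘ.≃-trans (ℚ.toℚᵘ-homo-+ (ℤ.+ a ℚ./ 1) (ℚ.- (ℤ.+ n ℚ./ 4)))
        (ℚᵘ.+-cong (ℚ.toℚᵘ-fromℚᵘ P) (ℚᵘ.≃-trans (ℚ.toℚᵘ-homo‿- (ℤ.+ n ℚ./ 4))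
            (ℚᵘ.-‿cong (ℚ.toℚᵘ-fromℚᵘ N))))))
    numerator : ℤ.+ a ℤ.* ℤ.+ 4 ℤ.+ ℤ.- (ℤ.+ n) ℤ.* ℤ.+ 1 ≡ (4 * a) ⊖ n
    numerator = trans (cong₂ ℤ._+_ (trans (sym (ℤ.pos-* a 4)) (cong ℤ.+_ (*-comm a 4)))
        (ℤ.*-identityʳ (ℤ.- (ℤ.+ n)))) (ℤ.m-n≡m⊖n (4 * a) n)
    middle : ℚᵘ.∣ P ℚᵘ.- N ∣ ℚᵘ.≤ mkℚᵘ (ℤ.+ c) 1
    middle = *≤* (subst₂ ℤ._≤_ (ℤ.pos-* (ℤ.∣ ℤ.+ a ℤ.* ℤ.+ 4 ℤ.+ ℤ.- (ℤ.+ n) ℤ.* ℤ.+ 1 ∣) 2) (ℤ.pos-* c 4)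
      (ℤ.+≤+ (subst (λ z → ℤ.∣ z ∣ * 2 ≤ c * 4) (sym numerator)
        (≤-trans (*-monoˡ-≤ 2 (∣⊖∣≤ (4 * a) n (2 * c) p q))
            (≤-reflexive (trans (cong (_* 2) (*-comm 2 c)) (*-assoc c 2 2)))))))

  -- Recognising the exceptional graphs

  Injective : (Fin k → Fin n) → Set
  Injective g = ∀ {i j} → g i ≡ g j → i ≡ j

  enumerate : ∀ k (P : Sub n) → k ≤ count P → ∃[ g ] Injective {k} {n} g × (∀ i → g i ∈ P)
  enumerate zero    P _ = (λ ()) , (λ {i} → λ _ → ⊥-elim (no-fin i)) , λ ()
    where
    no-fin : Fin 0 → ⊥
    no-fin ()
  enumerate (suc k) P k< = first (inhabited P (≤-trans (s≤s z≤n) k<))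
    where
    first : (∃[ v ] v ∈ P) → ∃[ g ] Injective g × (∀ i → g i ∈ P)
    first (v , v∈P) = rest
        (enumerate k (P ∖ ⁅ v ⁆) (≤-pred (≤-trans k< (≤-reflexive (count-delete P v∈P)))))
      where
      rest : (∃[ g ] Injective g × (∀ i → g i ∈ P ∖ ⁅ v ⁆)) → ∃[ g ] Injective g × (∀ i → g i ∈ P)
      rest (g , inj , im) = g′ , inj′ , im′
        where
        g′ : Fin (suc k) → Fin _
        g′ zero    = v
        g′ (suc i) = g i
        fresh : ∀ i → v ≢ g i
        fresh i v≡ = clash (subst (_∈ ⁅ v ⁆) v≡ (⁅⁆-refl v)) (∖⁻ {P (g i)} (im i))
        inj′ : Injective g′
        inj′ {zero}  {zero}  _ = refl
        inj′ {zero}  {suc j} p = ⊥-elim (fresh j p)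
        inj′ {suc i} {zero}  p = ⊥-elim (fresh i (sym p))
        inj′ {suc i} {suc j} p = cong suc (inj p)
        im′ : ∀ i → g′ i ∈ P
        im′ zero    = v∈P
        im′ (suc i) = ∧⁻ˡ (im i)

  -- Punching out a missed v would map `suc n` elements injectively to n.
  injective⇒surjective : (g : Fin n → Fin n) → Injective g → ∀ v → ∃[ i ] g i ≡ v
  injective⇒surjective {n} g inj v with any? (λ i → g i ≟ v)
  ... | yes p = p
  injective⇒surjective {suc n} g inj v | no ¬p =
      collide (Fin.pigeonhole (n<1+n n) (λ i → punchOut (missed i)))
    where
    missed : ∀ i → v ≢ g i
    missed i p = ¬p (i , sym p)
    collide : (∃[ i ] ∃[ j ] (i Fin.< j) × punchOut (missed i) ≡ punchOut (missed j)) → _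
    collide (i , j , i<j , p) =
        ⊥-elim (Fin.<⇒≢ i<j (inj (Fin.punchOut-injective (missed i) (missed j) p)))

  injective⇒↔ : (g : Fin n → Fin n) → Injective g → Fin n ↔ Fin n
  injective⇒↔ g inj = mk↔ₛ′ from g (λ i → inj (proj₂ (injective⇒surjective g inj (g i))))
      (λ v → proj₂ (injective⇒surjective g inj v))
    where
    from : _ → _
    from v = proj₁ (injective⇒surjective g inj v)

  fromGraph : (G : Graph n) → D.Cubic G → (∀ v → D.degree G v ≡ count (λ u → does (Graph.adj? G v u))) →
      CubicGraph n
  fromGraph G cubic deg = record
    { adj      = λ u v → does (Graph.adj? G u v)
    ; adj-sym  = λ u v → ⇔⇒≡ (flip u v) (flip v u)
    ; loopless = λ u → refute λ p → Graph.irrefl G refl (from-does (Graph.adj? G u u) p)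
    ; cubic    = λ u → trans (sym (deg u)) (cubic u)
    }
    where
    flip : ∀ u v → does (Graph.adj? G u v) ≡ true → does (Graph.adj? G v u) ≡ true
    flip u v p = dec-true (Graph.adj? G v u) (Graph.sym G (from-does (Graph.adj? G u v) p))

  module Embedding {n} (G : CubicGraph n) where
    open Starter G

    record Embeds {k} (X : Graph k) (P : Sub n) : Set where
      field
        place     : Fin k → Fin n
        injective : Injective place
        inside    : ∀ i → place i ∈ P
        adjacent  : ∀ i j → D.Adj X i j ⇔ place j ∈ adj (place i)

    clique-embeds : ∀ {P} k → k ≤ count P → (∀ u v → u ∈ P → v ∈ P → u ≢ v → v ∈ adj u) → Embeds (K k) P
    clique-embeds {P} k k≤ full-P = make (enumerate k P k≤)
      where
      make : (∃[ g ] Injective g × (∀ i → g i ∈ P)) → Embeds (K k) P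
      make (g , inj , im) = record
        { place = g ; injective = inj ; inside = im
        ; adjacent = λ i j → mk⇔ (λ i≢j → full-P (g i) (g j) (im i) (im j) (i≢j ∘ inj))
            (λ p i≡j → adj⇒≢ p (cong g i≡j)) }

    -- A vertex of M has three neighbours among the three other vertices of M, hence all of them.
    four-clique : ∀ {M} → count M ≡ 4 → Closed M → Embeds (K 4) M
    four-clique {M} |M| M3 = clique-embeds 4 (≤-reflexive (sym |M|)) λ u v p q u≢v →
      ∧⁻ˡ (⊆-count⇒⊇ (adj u ∩ M) (M ∖ ⁅ u ⁆) (λ w r → ∖⁺ (∧⁻ʳ {adj u w} r) (≢⇒∉⁅⁆ (adj⇒≢ (∧⁻ˡ r) ∘ sym)))
        (≤-reflexive (suc-injective
            (trans (sym (count-delete M p)) (trans |M| (cong suc (sym (M3 u p))))))) v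
            (∖⁺ q (≢⇒∉⁅⁆ (u≢v ∘ sym))))

    union : ∀ {k l} → (Fin k → Fin n) → (Fin l → Fin n) → Fin (k + l) → Fin n
    union {k} g h i = [ g , h ]′ (splitAt k i)

    splitAt-injective : ∀ {k l} {i j : Fin (k + l)} → splitAt k i ≡ splitAt k j → i ≡ j
    splitAt-injective {k} {l} {i} {j} p =
      trans (sym (Fin.join-splitAt k l i)) (trans (cong (Fin.join k l) p) (Fin.join-splitAt k l j))

    union-injective : ∀ {k l P Q} → (P # Q) → {g : Fin k → Fin n} {h : Fin l → Fin n} →
      Injective g → Injective h → (∀ i → g i ∈ P) → (∀ i → h i ∈ Q) → Injective (union g h)
    union-injective {k} {l} {P} {Q} P∩Q {g} {h} g-inj h-inj g∈ h∈ {i} {j} p =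
      splitAt-injective {k} {l} (aux (splitAt k i) (splitAt k j) p)
      where
      aux : ∀ s t → [ g , h ]′ s ≡ [ g , h ]′ t → s ≡ t
      aux (inj₁ a) (inj₁ b) q = cong inj₁ (g-inj q)
      aux (inj₂ a) (inj₂ b) q = cong inj₂ (h-inj q)
      aux (inj₁ a) (inj₂ b) q = clash (h∈ b) (subst (_∉ Q) q (P∩Q (g a) (g∈ a)))
      aux (inj₂ a) (inj₁ b) q = clash (h∈ a) (subst (_∉ Q) (sym q) (P∩Q (g b) (g∈ b)))

    union-inside : ∀ {k l} (P Q : Sub n) {g : Fin k → Fin n} {h : Fin l → Fin n} → (∀ i → g i ∈ P) →
        (∀ i → h i ∈ Q) →
      ∀ i → union g h i ∈ P ∪ Q
    union-inside {k} P Q {g} {h} g∈ h∈ i = aux (splitAt k i)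
      where
      aux : ∀ s → [ g , h ]′ s ∈ P ∪ Q
      aux (inj₁ a) = ∨⁺ˡ (g∈ a)
      aux (inj₂ b) = ∨⁺ʳ {P (h b)} (h∈ b)

    ⊍-embeds : ∀ {k l} {X : Graph k} {Y : Graph l} {P Q} → (P # Q) →
      (∀ u v → u ∈ P → v ∈ adj u → v ∉ Q) → Embeds X P → Embeds Y Q → Embeds (X ⊍ Y) (P ∪ Q)
    ⊍-embeds {k} {l} {X} {Y} {P} {Q} P∩Q apart EX EY = record
      { place = union EX.place EY.place
      ; injective = union-injective P∩Q EX.injective EY.injective EX.inside EY.inside
      ; inside = union-inside P Q EX.inside EY.inside
      ; adjacent = λ i j → aux (splitAt k i) (splitAt k j)
      }
      where
      module EX = Embeds EX
      module EY = Embeds EY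
      at = [ EX.place , EY.place ]′
      aux : ∀ s t → Pointwise (D.Adj X) (D.Adj Y) s t ⇔ at t ∈ adj (at s)
      aux (inj₁ a) (inj₁ b) = mk⇔ (λ { (inj₁ p) → Equivalence.to (EX.adjacent a b) p })
          (λ p → inj₁ (Equivalence.from (EX.adjacent a b) p))
      aux (inj₂ a) (inj₂ b) = mk⇔ (λ { (inj₂ p) → Equivalence.to (EY.adjacent a b) p })
          (λ p → inj₂ (Equivalence.from (EY.adjacent a b) p))
      aux (inj₁ a) (inj₂ b) =
          mk⇔ (λ ()) (λ p → clash (EY.inside b) (apart (EX.place a) (EY.place b) (EX.inside a) p))
      aux (inj₂ a) (inj₁ b) =
          mk⇔ (λ ()) (λ p → clash (EY.inside a) (apart (EX.place b) (EY.place a) (EX.inside b) (adj⁻¹ p)))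

    Kᵇ-embeds : ∀ {P Q} k l → k ≤ count P → l ≤ count Q → (P # Q) →
      (∀ u v → u ∈ P → v ∈ P → v ∉ adj u) → (∀ u v → u ∈ Q → v ∈ Q → v ∉ adj u) →
          (∀ u v → u ∈ P → v ∈ Q → v ∈ adj u) →
      Embeds (Kᵇ k l) (P ∪ Q)
    Kᵇ-embeds {P} {Q} k l k≤ l≤ P∩Q noP noQ all = make (enumerate k P k≤) (enumerate l Q l≤)
      where
      make : (∃[ g ] Injective g × (∀ i → g i ∈ P)) → (∃[ h ] Injective h × (∀ i → h i ∈ Q)) →
          Embeds (Kᵇ k l) (P ∪ Q)
      make (g , g-inj , g∈) (h , h-inj , h∈) = record
        { place = union g h
        ; injective = union-injective P∩Q g-inj h-inj g∈ h∈
        ; inside = union-inside P Q g∈ h∈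
        ; adjacent = λ i j → aux (splitAt k i) (splitAt k j)
        }
        where
        at = [ g , h ]′
        aux : ∀ s t → Across s t ⇔ at t ∈ adj (at s)
        aux (inj₁ a) (inj₁ b) = mk⇔ (λ ()) (λ p → clash p (noP (g a) (g b) (g∈ a) (g∈ b)))
        aux (inj₂ a) (inj₂ b) = mk⇔ (λ ()) (λ p → clash p (noQ (h a) (h b) (h∈ a) (h∈ b)))
        aux (inj₁ a) (inj₂ b) = mk⇔ (λ _ → all (g a) (h b) (g∈ a) (h∈ b)) (λ _ → left-right)
        aux (inj₂ a) (inj₁ b) = mk⇔ (λ _ → adj⁻¹ (all (g b) (h a) (g∈ b) (h∈ a))) (λ _ → right-left)

    embeds⇒≅ : ∀ {X : Graph n} {P} (H : Graph n) → (∀ u v → adj u v ≡ does (Graph.adj? H u v)) →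
        Embeds X P → H ≅ X
    embeds⇒≅ {X} H same EX = record
      { vertices = f
      ; adjacent = λ u v → mk⇔
          (λ p → Equivalence.from (adjacent (to u) (to v)) (subst₂ (λ a b → b ∈ adj a) (sym (back u))
              (sym (back v))
            (trans (same u v) (dec-true (Graph.adj? H u v) p))))
          (λ p → from-does (Graph.adj? H u v)
              (trans (sym (same u v)) (subst₂ (λ a b → b ∈ adj a) (back u) (back v)
              (Equivalence.to (adjacent (to u) (to v)) p))))
      }
      where
      open Embeds EX
      f = injective⇒↔ place injective
      to = Inverse.to f
      back : ∀ u → place (to u) ≡ u
      back u = proj₂ (injective⇒surjective place injective u)

  -- Degree counts and the exceptional graphs

  opaque
    unfolding count

    length-filter : {A : Fin n → Set} (A? : ∀ v → Dec (A v)) → length (filter A? (allFin n)) ≡ count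
        (λ v → does (A? v))
    length-filter A? = go A? (λ v → v)
      where
      go : ∀ {m k} {A : Fin k → Set} (A? : ∀ v → Dec (A v)) (f : Fin m → Fin k) →
           length (filter A? (tabulate f)) ≡ count (λ i → does (A? (f i)))
      go {zero}  A? f = refl
      go {suc m} A? f with does (A? (f zero))
      ... | true  = cong suc (go A? (f ∘ suc))
      ... | false = go A? (f ∘ suc)

    count-permute : ∀ {m k} (P : Sub k) (π : Fin m ↔ Fin k) → count (P ∘ Inverse.to π) ≡ count P
    count-permute P π = sym (sum-permute (ind ∘ P) π)

  degree-count : (G : Graph n) → ∀ v → D.degree G v ≡ count (λ u → does (Graph.adj? G v u))
  degree-count G v = length-filter (Graph.adj? G v)

  m-count : (H : Graph n) → ∀ k → D.m H k ≡ count (λ v → does (D.degree H v ℕ.≟ k))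
  m-count H k = length-filter (λ v → D.degree H v ℕ.≟ k)

  pullback : ∀ {m} (f : Fin n → Fin m) (X : Graph m) → Graph n
  pullback f X = record
    { Adj    = λ u v → D.Adj X (f u) (f v)
    ; adj?   = λ u v → Graph.adj? X (f u) (f v)
    ; sym    = Graph.sym X
    ; irrefl = λ { refl → Graph.irrefl X refl }
    }

  module _ {k} (π : Fin n ↔ Fin k) (X : Graph k) where
    private
      f = Inverse.to π
      Y = pullback f X

    degree-pullback : ∀ v → D.degree Y v ≡ D.degree X (f v)
    degree-pullback v = trans (degree-count Y v)
        (trans (count-permute (λ w → does (Graph.adj? X (f v) w)) π) (sym (degree-count X (f v))))

    m-pullback : ∀ j → D.m Y j ≡ D.m X j
    m-pullback j = trans (m-count Y j)
        (trans (count-cong λ v → cong (λ d → does (d ℕ.≟ j)) (degree-pullback v))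
      (trans (count-permute (λ w → does (D.degree X w ℕ.≟ j)) π) (sym (m-count X j))))

  -- Deviations of at most c/2, cleared of denominators.
  Close : ℕ → Graph n → Set
  Close {n} c H = ∀ k → k ≤ 3 → 4 * D.m H k ≤ n + 2 * c × n ≤ 4 * D.m H k + 2 * c

  close⇒deviation : ∀ c (H : Graph n) → Close c H → ∀ k → k ≤ 3 → deviation H k ℚ.≤ ℤ.+ c ℚ./ 2
  close⇒deviation {n} c H close k k≤3 = near-quarter (D.m H k) n c (proj₁ (close k k≤3))
      (proj₂ (close k k≤3))

  close⇒maxDeviation : ∀ c (H : Graph n) → Close c H → maxDeviation H ℚ.≤ ℤ.+ c ℚ./ 2
  close⇒maxDeviation c H close =
      ℚ.⊔-lub (ℚ.⊔-lub (ℚ.⊔-lub (dev 0 z≤n) (dev 1 (s≤s z≤n))) (dev 2 (s≤s (s≤s z≤n)))) (dev 3 ≤-refl)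
    where dev = close⇒deviation c H close

  -- The witness is built once on the standard graph and carried over; the isomorphism preserves
  -- degrees and the order.
  ≅-pullback : ∀ {k} c {G : Graph n} {X : Graph k} → G ≅ X → (X′ : Graph k) → IsSpanningSubgraph X′ X →
      Close c X′ →
               ∃[ H ] (IsSpanningSubgraph H G × maxDeviation H ℚ.≤ ℤ.+ c ℚ./ 2)
  ≅-pullback {n} {k} c {X = X} iso X′ sub close = Y ,
      (λ p → Equivalence.from (_≅_.adjacent iso _ _) (sub p)) , close⇒maxDeviation c Y close′
    where
    π = _≅_.vertices iso
    Y = pullback (Inverse.to π) X′
    close′ : Close c Y
    close′ j j≤3 rewrite m-pullback π X′ j | ↔⇒≡ π = close j j≤3

  fromEdges : (e : Fin n → Fin n → Bool) → (∀ u → e u u ≡ false) → Graph n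
  fromEdges e loopless = record
    { Adj    = λ u v → e u v ∨ e v u ≡ true
    ; adj?   = λ u v → (e u v ∨ e v u) Bool.≟ true
    ; sym    = λ {u} {v} p → trans (Bool.∨-comm (e v u) (e u v)) p
    ; irrefl = λ { {u} refl p → clash p (∪-no (loopless u) (loopless u)) }
    }

  0≤⋯≤3 : ∀ {A : ℕ → Set} → A 0 → A 1 → A 2 → A 3 → ∀ k → k ≤ 3 → A k
  0≤⋯≤3 a b c d 0 _ = a
  0≤⋯≤3 a b c d 1 _ = b
  0≤⋯≤3 a b c d 2 _ = c
  0≤⋯≤3 a b c d 3 _ = d
  0≤⋯≤3 a b c d (suc (suc (suc (suc k)))) (s≤s (s≤s (s≤s ())))

  -- A single edge: degrees 0 to 3 occur 2, 2, 0, 0 times, against n/4 = 1.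
  edge₄ : Fin 4 → Fin 4 → Bool
  edge₄ 0F 1F = true
  edge₄ _  _  = false

  -- A path with two edges: degrees 0 to 3 occur 3, 2, 1, 0 times, against n/4 = 3/2; degrees 0 and
  -- 3 attain the bound.
  edges₃₃ : Fin 6 → Fin 6 → Bool
  edges₃₃ 0F 3F = true
  edges₃₃ 0F 4F = true
  edges₃₃ _  _  = false

  -- An edge in the first K₄, all but an edge of the second, a path with two edges in the third.
  edges₁₂ : Fin 12 → Fin 12 → Bool
  edges₁₂ 0F 1F = true
  edges₁₂ 4F 6F = true
  edges₁₂ 4F 7F = true
  edges₁₂ 5F 6F = true
  edges₁₂ 5F 7F = true
  edges₁₂ 6F 7F = true
  edges₁₂ 8F 9F = true
  edges₁₂ 9F (suc 9F) = true
  edges₁₂ _  _  = false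

  spanning? : (H G : Graph n) → Dec (∀ u v → D.Adj H u v → D.Adj G u v)
  spanning? H G = all? λ u → all? λ v → Graph.adj? H u v →-dec Graph.adj? G u v

  exceptional : (G : Graph n) → Exceptional G → ∃[ H ] (IsSpanningSubgraph H G × maxDeviation H ℚ.≤ ℤ.+ 3
      ℚ./ 2)
  exceptional G (inj₁ iso) = ≅-pullback 3 iso H (λ {u} {v} → from-yes (spanning? H (K 4)) u v)
    (0≤⋯≤3 (bound 2 _ _) (bound 2 _ _) (bound 0 _ _) (bound 0 _ _))
    where
    H = fromEdges edge₄ (from-yes (all? λ u → edge₄ u u Bool.≟ false))
    bound : ∀ a → Bool.T (does (4 * a ≤? 10)) → Bool.T (does (4 ≤? 4 * a + 6)) → 4 * a ≤ 10 ×
        4 ≤ 4 * a + 6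
    bound a p q = ≤ᵇ⇒≤ (4 * a) 10 p , ≤ᵇ⇒≤ 4 (4 * a + 6) q
  exceptional G (inj₂ (inj₁ iso)) = ≅-pullback 3 iso H (λ {u} {v} → from-yes (spanning? H 3K₄) u v)
    -- Here the counts 3, 4, 3, 2 compare with n/4 = 3.
    (0≤⋯≤3 (bound 3 _ _) (bound 4 _ _) (bound 3 _ _) (bound 2 _ _))
    where
    H = fromEdges edges₁₂ (from-yes (all? λ u → edges₁₂ u u Bool.≟ false))
    bound : ∀ a → Bool.T (does (4 * a ≤? 18)) → Bool.T (does (12 ≤? 4 * a + 6)) → 4 * a ≤ 18 ×
        12 ≤ 4 * a + 6
    bound a p q = ≤ᵇ⇒≤ (4 * a) 18 p , ≤ᵇ⇒≤ 12 (4 * a + 6) q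
  exceptional G (inj₂ (inj₂ iso)) = ≅-pullback 3 iso H (λ {u} {v} → from-yes (spanning? H (Kᵇ 3 3)) u v)
    (0≤⋯≤3 (bound 3 _ _) (bound 2 _ _) (bound 1 _ _) (bound 0 _ _))
    where
    H = fromEdges edges₃₃ (from-yes (all? λ u → edges₃₃ u u Bool.≟ false))
    bound : ∀ a → Bool.T (does (4 * a ≤? 12)) → Bool.T (does (6 ≤? 4 * a + 6)) → 4 * a ≤ 12 ×
        6 ≤ 4 * a + 6
    bound a p q = ≤ᵇ⇒≤ (4 * a) 12 p , ≤ᵇ⇒≤ 6 (4 * a + 6) q

  -- Graphs that are not exceptional

  module Ordinary {n} (G : Graph n) (cubic : D.Cubic G) where
    private
      C : CubicGraph n
      C = fromGraph G cubic (degree-count G)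
      module B = Balancing C
    open Starter C
    open Embedding C

    adj-count : ∀ u → count (adj u) ≡ 3
    adj-count = CubicGraph.cubic C

    -- By the handshake lemma 3n = 2k for some k, and then n = 2(k - n).
    n-even : ∃[ h ] n ≡ 2 * h
    n-even = half (e-even full)
      where
      total : e full ≡ 3 * n
      total = trans (cubic-e λ u _ → trans (d-full u) (adj-count u)) (cong (3 *_) count-full)
      half : (∃[ k ] e full ≡ 2 * k) → ∃[ h ] n ≡ 2 * h
      half (k , eq) = rest (m≤n⇒∃[o]m+o≡n {n} {k} (linear (n ∷ k ∷ e full ∷ []) (x0 ≼ x1) 2
          (1 ·⁻ x2 ≐ 3 ⊗ x0 ∵ total ⨾ 1 · x2 ≐ 2 ⊗ x1 ∵ eq)))
        where
        rest : (∃[ h ] n + h ≡ k) → ∃[ h ] n ≡ 2 * h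
        rest (h , r) = h , (linear (n ∷ k ∷ h ∷ e full ∷ []) (x0 ≐ 2 ⊗ x2) 0
            ( 1 ·⁻ x3 ≐ 3 ⊗ x0 ∵ total
            ⨾ 1 · x3 ≐ 2 ⊗ x1 ∵ eq
            ⨾ 2 ·⁻ x0 ⊕ x2 ≐ x1 ∵ r))

    spanning : B.Subgraph → Graph n
    spanning S = record
      { Adj    = λ u v → v ∈ B.Subgraph.rel S u
      ; adj?   = λ u v → B.Subgraph.rel S u v Bool.≟ true
      ; sym    = λ {u} {v} p → trans (B.Subgraph.rel-sym S v u) p
      ; irrefl = λ { {u} refl p → clash p (B.Subgraph.rel-loopless S u) }
      }

    m-spanning : ∀ S k → D.m (spanning S) k ≡ count (B.Subgraph.level S k)
    m-spanning S k = trans (m-count (spanning S) k) (count-cong λ v → cong (λ d → does (d ℕ.≟ k))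
      (trans (degree-count (spanning S) v) (count-cong λ u →
          ⇔⇒≡ (from-does (B.Subgraph.rel S v u Bool.≟ true))
          (dec-true (B.Subgraph.rel S v u Bool.≟ true)))))

    Goal : Set₁
    Goal = ∃[ H ] (IsSpanningSubgraph H G × (∀ k → k ≤ 3 → deviation H k ℚ.≤ ℤ.+ 1 ℚ./ 2))

    balanced⇒goal : ∀ {q q′} → n ≡ 2 * q + 2 * q′ → q ≤ q′ → q′ ≤ 1 + q → Balanced q q′ → Goal
    balanced⇒goal {q} {q′} n≡ q≤q′ q′≤1+q b@(S , zs , ts , _) = spanning S ,
        (λ {u} {v} p → from-does (Graph.adj? G u v) (∧⁻ˡ p)) ,
      close⇒deviation 1 (spanning S) (0≤⋯≤3 (small 0 zs) (large 1 (proj₁ (B.balanced-levels n≡ b)))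
          (small 2 (proj₂ (B.balanced-levels n≡ b))) (large 3 ts))
      where
      small : ∀ k → count (B.Subgraph.level S k) ≡ q → 4 * D.m (spanning S) k ≤ n + 2 * 1 ×
          n ≤ 4 * D.m (spanning S) k + 2 * 1
      small k p =
        (linear (n ∷ D.m (spanning S) k ∷ count (B.Subgraph.level S k) ∷ q ∷ q′ ∷ [])
            (4 ⊗ x1 ≼ x0 ⊕ con 2) 0
            ( 4 · x1 ≐ x2 ∵ m-spanning S k
            ⨾ 4 · x2 ≐ x3 ∵ p
            ⨾ 1 ·⁻ x0 ≐ 2 ⊗ x3 ⊕ 2 ⊗ x4 ∵ n≡
            ⨾ 2 · x3 ≼ x4 ∵ q≤q′)) ,
        (linear (n ∷ D.m (spanning S) k ∷ count (B.Subgraph.level S k) ∷ q ∷ q′ ∷ [])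
            (x0 ≼ 4 ⊗ x1 ⊕ con 2) 0
            ( 4 ·⁻ x1 ≐ x2 ∵ m-spanning S k
            ⨾ 4 ·⁻ x2 ≐ x3 ∵ p
            ⨾ 1 · x0 ≐ 2 ⊗ x3 ⊕ 2 ⊗ x4 ∵ n≡
            ⨾ 2 · x4 ≼ con 1 ⊕ x3 ∵ q′≤1+q))
      large : ∀ k → count (B.Subgraph.level S k) ≡ q′ → 4 * D.m (spanning S) k ≤ n + 2 * 1 ×
          n ≤ 4 * D.m (spanning S) k + 2 * 1
      large k p =
        (linear (n ∷ D.m (spanning S) k ∷ count (B.Subgraph.level S k) ∷ q ∷ q′ ∷ [])
            (4 ⊗ x1 ≼ x0 ⊕ con 2) 0
            ( 4 · x1 ≐ x2 ∵ m-spanning S k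
            ⨾ 4 · x2 ≐ x4 ∵ p
            ⨾ 1 ·⁻ x0 ≐ 2 ⊗ x3 ⊕ 2 ⊗ x4 ∵ n≡
            ⨾ 2 · x4 ≼ con 1 ⊕ x3 ∵ q′≤1+q)) ,
        (linear (n ∷ D.m (spanning S) k ∷ count (B.Subgraph.level S k) ∷ q ∷ q′ ∷ [])
            (x0 ≼ 4 ⊗ x1 ⊕ con 2) 0
            ( 4 ·⁻ x1 ≐ x2 ∵ m-spanning S k
            ⨾ 4 ·⁻ x2 ≐ x4 ∵ p
            ⨾ 1 · x0 ≐ 2 ⊗ x3 ⊕ 2 ⊗ x4 ∵ n≡
            ⨾ 2 · x3 ≼ x4 ∵ q≤q′))

    isK₄ : n ≡ 4 → G ≅ K 4
    isK₄ refl = embeds⇒≅ G (λ _ _ → refl) (four-clique count-full λ u _ → trans (d-full u) (adj-count u))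

    -- The three neighbours of a vertex of P fill the complement of P, which has three elements. So
    -- the vertices there spend all their edges on P.
    isK₃₃ : n ≡ 6 → (∃[ P ] count P ≡ 3 × (∀ u → u ∈ P → d P u ≡ 0)) → G ≅ Kᵇ 3 3
    isK₃₃ refl (P , |P| , P0) = embeds⇒≅ G (λ _ _ → refl)
      (Kᵇ-embeds 3 3 (≤-reflexive (sym |P|)) (≤-reflexive (sym |Q|)) (λ v p → cong not p) (λ u v p r →
          refute λ s → clash r (d-zero P (P0 u p) s))
        (λ u v p r → refute λ s → clash (back u p v s) (not⁻ r))
        (λ u v p r → across u p v r))
      where
      Q = ∁ P
      |Q| : count Q ≡ 3
      |Q| = linear (count {6} full ∷ count P ∷ count Q ∷ []) (x2 ≐ con 3) 0
          ( 1 · x0 ≐ con 6 ∵ count-full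
          ⨾ 1 ·⁻ x0 ≐ x1 ⊕ x2 ∵ count-split full P
          ⨾ 1 ·⁻ x1 ≐ con 3 ∵ |P|)
      across : ∀ u → u ∈ P → ∀ v → v ∈ Q → v ∈ adj u
      across u p = ⊆-count⇒⊇ (adj u) Q (λ v r → not⁺ (d-zero P (P0 u p) r))
          (≤-reflexive (trans |Q| (sym (adj-count u))))
      back : ∀ u → u ∈ Q → ∀ v → v ∈ adj u → v ∈ P
      back u p = ⊆-count⇒⊇ P (adj u) (λ v r → adj⁻¹ (across v r u p))
          (≤-reflexive (trans (adj-count u) (sym |P|)))

    is3K₄ : n ≡ 12 → (M M′ : Sub n) → (M # M′) → count M ≡ 4 → count M′ ≡ 4 →
            Closed M → Closed M′ → G ≅ 3K₄
    is3K₄ refl M M′ M∩M′ |M| |M′| M3 M′3 = embeds⇒≅ G (λ _ _ → refl)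
      (⊍-embeds (λ v p → ∪-no (M∩M′ v p) (cong not (∨⁺ˡ p)))
        (λ u v p r → ∪-no (M∩M′ v (d-all M (M3 u p) r)) (cong not (∨⁺ˡ (d-all M (M3 u p) r))))
        (four-clique |M| M3)
        (⊍-embeds (λ v p → cong not (∨⁺ʳ {M v} p)) (λ u v p r →
            cong not (∨⁺ʳ {M v} (d-all M′ (M′3 u p) r)))
          (four-clique |M′| M′3) (four-clique |L| L3)))
      where
      U = M ∪ M′
      L = ∁ U
      |L| : count L ≡ 4
      |L| = linear (count {12} full ∷ count U ∷ count L ∷ count M ∷ count M′ ∷ []) (x2 ≐ con 4) 0
          ( 1 · x0 ≐ con 12 ∵ count-full
          ⨾ 1 ·⁻ x0 ≐ x1 ⊕ x2 ∵ count-split full U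
          ⨾ 1 ·⁻ x1 ≐ x3 ⊕ x4 ∵ count-∪ M M′ M∩M′
          ⨾ 1 ·⁻ x3 ≐ con 4 ∵ |M|
          ⨾ 1 ·⁻ x4 ≐ con 4 ∵ |M′|)
      L3 : Closed L
      L3 u p = linear (d U u ∷ d L u ∷ d M u ∷ d M′ u ∷ []) (x1 ≐ con 3) 0
          ( 1 · x0 ⊕ x1 ≐ con 3 ∵ d-∁ U u
          ⨾ 1 ·⁻ x0 ≐ x2 ⊕ x3 ∵ d-∪ M M′ u M∩M′
          ⨾ 1 ·⁻ x2 ≐ con 0 ∵ cubic-outside M3 (∪-noˡ {M u} {M′ u} (not⁻ p))
          ⨾ 1 ·⁻ x3 ≐ con 0 ∵ cubic-outside M′3 (∪-noʳ {M u} {M′ u} (not⁻ p)))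

    halves : ∀ h → ∃[ q ] ∃[ q′ ] q + q′ ≡ h × q ≤ q′ × q′ ≤ 1 + q
    halves zero = 0 , 0 , refl , z≤n , z≤n
    halves (suc h) = next (halves h)
      where
      next : (∃[ q ] ∃[ q′ ] q + q′ ≡ h × q ≤ q′ × q′ ≤ 1 + q) → ∃[ q ] ∃[ q′ ] q + q′ ≡ suc h × q ≤ q′ ×
          q′ ≤ 1 + q
      next (q , q′ , eq , le , ge) = q′ , suc q , trans (+-comm q′ (suc q)) (cong suc eq) , ge , s≤s le

    empty-goal : n ≡ 0 → Goal
    empty-goal refl = G , (λ p → p) , close⇒deviation 1 G λ _ _ → z≤n , z≤n

    not-2 : n ≡ 2 → ⊥
    not-2 refl = 1≰0 (linear (count {2} full ∷ count (adj 0F) ∷ []) (con 1 ≼ con 0) 0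
        ( 1 ·⁻ x1 ≐ con 3 ∵ adj-count 0F
        ⨾ 1 · x1 ≼ x0 ∵ count-⊆ {P = adj 0F} (λ _ _ → refl)
        ⨾ 1 · x0 ≐ con 2 ∵ count-full))

    regular : ¬ Exceptional G → Goal
    regular ordinary = from-half n-even
      where
      from-outcome : ∀ {q q′} (n≡ : n ≡ 2 * q + 2 * q′) (q≤q′ : q ≤ q′) (q′≤ : q′ ≤ 1 + q)
          (2≤q′ : 2 ≤ q′) → Outcome n≡ q≤q′ q′≤ 2≤q′ → Goal
      from-outcome n≡ q≤q′ q′≤ _ (inj₁ (inj₁ b)) = balanced⇒goal n≡ q≤q′ q′≤ b
      from-outcome n≡ _ _ _ (inj₁ (inj₂ (refl , refl , P))) = ⊥-elim (ordinary (inj₂ (inj₂ (isK₃₃ n≡ P))))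
      from-outcome n≡ _ _ _ (inj₂ (refl , refl , M , M′ , disj , |M| , |M′| , M3 , M′3)) =
        ⊥-elim (ordinary (inj₂ (inj₁ (is3K₄ n≡ M M′ disj |M| |M′| M3 M′3))))
      tiny : ∀ q q′ → n ≡ 2 * q + 2 * q′ → q ≤ q′ → q′ ≤ 1 → Goal
      -- q′ ≤ 1 leaves n = 0, 2 or 4: the empty graph is its own witness, two vertices cannot have
      -- degree 3, and four give K₄.
      tiny zero    zero          n≡ _ _ = empty-goal n≡
      tiny zero    (suc zero)    n≡ _ _ = ⊥-elim (not-2 n≡)
      tiny (suc zero) (suc zero) n≡ _ _ = ⊥-elim (ordinary (inj₁ (isK₄ n≡)))
      tiny (suc (suc q)) (suc zero) n≡ (s≤s ()) _
      tiny q (suc (suc q′)) n≡ _ (s≤s ())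
      by-size : ∀ {q q′} → n ≡ 2 * q + 2 * q′ → q ≤ q′ → q′ ≤ 1 + q → Dec (2 ≤ q′) → Goal
      by-size n≡ q≤q′ q′≤ (yes 2≤) = from-outcome n≡ q≤q′ q′≤ 2≤ (outcome n≡ q≤q′ q′≤ 2≤)
      by-size n≡ q≤q′ q′≤ (no ¬2≤) = tiny _ _ n≡ q≤q′ (≤-pred (≰⇒> ¬2≤))
      from-halves : ∀ {h} → n ≡ 2 * h → (∃[ q ] ∃[ q′ ] q + q′ ≡ h × q ≤ q′ × q′ ≤ 1 + q) → Goal
      from-halves n≡ (q , q′ , refl , q≤q′ , q′≤) = by-size (trans n≡ (*-distribˡ-+ 2 q q′)) q≤q′ q′≤
          (2 ≤? q′)
      from-half : (∃[ h ] n ≡ 2 * h) → Goal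
      from-half (h , n≡) = from-halves n≡ (halves h)

open import Defs
open import Data.Integer.Base using (+_)
open import Data.Nat.Base as ℕ using (ℕ)
open import Data.Product.Base using (_×_; _,_; ∃-syntax)
open import Data.Rational.Base using (_/_; _≤_)
open import Relation.Nullary.Negation.Core using (¬_)

corollary3p1 : ∀ (n : ℕ) (G : Graph n) → Cubic G →
    (¬ Exceptional G →
    ∃[ H ] (IsSpanningSubgraph H G × (∀ k → k ℕ.≤ 3 → deviation H k ≤ + 1 / 2)))
    × (Exceptional G →
    ∃[ H ] (IsSpanningSubgraph H G × maxDeviation H ≤ + 3 / 2))
corollary3p1 n G cubic = Development.Ordinary.regular G cubic , Development.exceptional G
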